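{- Let $a\in\mathcal{F}$ and let $Z$ be a zone. If $\lambda,\mu\in Z$, then the set of alcoves $\{\mathcal{A}_w: w\in PB_a(\lambda)\cap W_{\mathrm{aff}}^+\}$ is a translate (by a vector of $E$) of the set $\{\mathcal{A}_w: w\in PB_a(\mu)\cap W_{\mathrm{aff}}^+\}$. In particular $|PB_a(\lambda)|=|PB_a(\mu)|$.
   Context: Fix $n\ge1$. Let $E=\{x\in\mathbb{R}^{n+1}:\sum_i x_i=0\}$ with the standard inner product, $\Phi=\{\varepsilon_i-\varepsilon_j:i\neq j\}$ the type $A_n$ root system, simple roots $\alpha_i=\varepsilon_i-\varepsilon_{i+1}$, positive roots $\Phi^+=\{\varepsilon_i-\varepsilon_j:i<j\}$, highest root $\tilde\alpha=\varepsilon_1-\varepsilon_{n+1}$, fundamental weights $\varpi_i\in E$ with $\langle\varpi_i,\alpha_j\rangle=\delta_{ij}$. $\Lambda=\bigoplus\mathbb{Z}\varpi_i$, $\Lambda^+=\{\lambda\in\Lambda:\langle\lambda,\alpha_i\rangle\ge0\ \forall i\}$, $C^+=\{x\in E:\langle x,\alpha_i\rangle\ge0\ \forall i\}$. Dominance order: $\mu\le\lambda$ iff $\lambda-\mu\in\sum\mathbb{Z}_{\ge0}\alpha_i$. $W_{\mathrm{aff}}$ is generated by the reflections $s_{\alpha,k}$ in the hyperplanes $H_{\alpha,k}=\{\langle x,\alpha\rangle=k\}$ ($\alpha\in\Phi,k\in\mathbb{Z}$); $W_{\mathrm f}$ is generated by $s_{\alpha_i,0}$, with longest element $w_0$. Fundamental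 alcove $\mathcal{A}_{\mathrm{id}}=\{x:-1<\langle x,\alpha\rangle<0\ \forall\alpha\in\Phi^+\}$, $\mathcal{A}_w=w(\mathcal{A}_{\mathrm{id}})$ (a bijection onto alcoves). Bruhat order $\le$ on $W_{\mathrm{aff}}$ is with respect to $S=\{s_{\alpha_i,0}\}\cup\{s_{\tilde\alpha,-1}\}$. $W_{\mathrm{aff}}^+=\{w:\mathcal{A}_w\subset C^+\}$. $\Pi^+=\{x:0\le\langle x,\alpha_i\rangle\le1\ \forall i\}$, $\Pi^-=w_0(\Pi^+)$, $\mathcal{F}=\{a\in W_{\mathrm{aff}}:\mathcal{A}_a\subset\Pi^-\}$. For $\lambda\in\Lambda^+$, $a\in\mathcal{F}$: $\theta_a(\lambda)$ is the unique element with $\mathcal{A}_{\theta_a(\lambda)}=\mathcal{A}_{w_0a}+\lambda$; $\mathcal{I}_a(\lambda)=\{x:x\le\theta_a(\lambda)\}$; $\mu\lessdot\lambda$ means $\lambda$ covers $\mu$ in $(\Lambda^+,\le)$; $PB_a(\lambda)=\mathcal{I}_a(\lambda)\setminus\bigcup_{\mu\lessdot\lambda}\mathcal{I}_a(\mu)$. Zones: for $\boldsymbol{i}=(i_1,\dots,i_n)\in\{0,1,2\}^n$, $Z(\boldsymbol{i})=\{\lambda\in\Lambda^+:\langle\lambda,\alpha_j\rangle=i_j\text{ if }i_j\in\{0,1\},\ \langle\lambda,\alpha_j\rangle\ge2\text{ if }i_j=2\}$; a zone is any $Z(\boldsymbol{i})$. -}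

module Defs where

open import Data.Nat as ℕ using (ℕ; zero; suc)
open import Data.Integer as ℤ using (ℤ; +_)
open import Data.Rational as ℚ using (ℚ; 0ℚ; 1ℚ; _/_)
open import Data.Fin as Fin using (Fin; zero; suc; inject₁; fromℕ; opposite)
open import Data.Vec as Vec using (Vec; tabulate; lookup; replicate)
open import Data.List as List using (List; []; _∷_; length; foldr; map)
open import Data.List.Relation.Binary.Sublist.Propositional using (_⊆_)
open import Data.Product using (Σ; ∃; _×_; _,_)
open import Data.Sum using (_⊎_)
open import Data.Bool using (if_then_else_)
open import Relation.Nullary using (¬_; does)
open import Relation.Binary.PropositionalEquality using (_≡_; _≢_)

-- Ambient space.  Coordinates ε_1,…,ε_{n+1} are indexed by Fin (suc n)
-- (ε_{p+1} ↔ p).  Points of ℝ^{n+1} are represented by their rational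
-- points.

Pt : ℕ → Set
Pt n = Fin (suc n) → ℚ

ℤ→ℚ : ℤ → ℚ
ℤ→ℚ k = k / 1

ℕ→ℚ : ℕ → ℚ
ℕ→ℚ k = (+ k) / 1

sumℚ : ∀ {m} → (Fin m → ℚ) → ℚ
sumℚ {zero}  f = 0ℚ
sumℚ {suc m} f = f zero ℚ.+ sumℚ (λ p → f (suc p))

InE : ∀ {n} → Pt n → Set
InE x = sumℚ x ≡ 0ℚ

pairRoot : ∀ {n} → Pt n → Fin (suc n) → Fin (suc n) → ℚ
pairRoot x i j = x i ℚ.- x j

-- ⟨x, α_r⟩ for the simple root α_{r+1} = ε_{r+1} - ε_{r+2}, r : Fin n
pairα : ∀ {n} → Pt n → Fin n → ℚ
pairα x r = pairRoot x (inject₁ r) (suc r)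

αvec : ∀ {n} → Fin n → Pt n
αvec r p = (if does (p Fin.≟ inject₁ r) then 1ℚ else 0ℚ)
           ℚ.- (if does (p Fin.≟ suc r) then 1ℚ else 0ℚ)

_≗ₚ_ : ∀ {n} → Pt n → Pt n → Set
x ≗ₚ y = ∀ p → x p ≡ y p

-- Affine maps x ↦ (p ↦ x (perm p) + trans p)  with a permutation part and
-- an integral translation part.  Every element of W_aff is of this form,
-- and distinct data give distinct maps on E (n ≥ 1).

record Aff (n : ℕ) : Set where
  constructor aff
  field
    perm  : Vec (Fin (suc n)) (suc n)
    trans : Vec ℤ (suc n)
open Aff public

act : ∀ {n} → Aff n → Pt n → Pt n
act f x p = x (lookup (perm f) p) ℚ.+ ℤ→ℚ (lookup (trans f) p)

idAff : ∀ {n} → Aff n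
idAff = aff (tabulate (λ p → p)) (replicate _ (+ 0))

-- composition: act (f ∘ₐ g) = act f ∘ act g
_∘ₐ_ : ∀ {n} → Aff n → Aff n → Aff n
f ∘ₐ g = aff (tabulate (λ p → lookup (perm g) (lookup (perm f) p)))
             (tabulate (λ p → lookup (trans g) (lookup (perm f) p) ℤ.+ lookup (trans f) p))

-- the reflection s_{ε_i-ε_j, k} in H_{ε_i-ε_j,k}:
--   x ↦ x - (⟨x,ε_i-ε_j⟩ - k)(ε_i-ε_j),  i.e.  x_i ↦ x_j + k,  x_j ↦ x_i - k
reflData : ∀ {n} → Fin (suc n) → Fin (suc n) → ℤ → Aff n
reflData i j k =
  aff (tabulate (λ p → if does (p Fin.≟ i) then j else (if does (p Fin.≟ j) then i else p)))
      (tabulate (λ p → if does (p Fin.≟ i) then k else (if does (p Fin.≟ j) then ℤ.- k else + 0)))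

record Refl (n : ℕ) : Set where
  constructor mkRefl
  field
    ri  : Fin (suc n)
    rj  : Fin (suc n)
    rk  : ℤ
    ri≢rj : ri ≢ rj

reflAff : ∀ {n} → Refl n → Aff n
reflAff (mkRefl i j k _) = reflData i j k

InWaff : ∀ {n} → Aff n → Set
InWaff {n} f = Σ (List (Refl n)) λ rs → foldr _∘ₐ_ idAff (map reflAff rs) ≡ f

data SGen (n : ℕ) : Set where
  simple : Fin n → SGen n
  affine : SGen n

genAff : ∀ {n} → SGen n → Aff n
genAff (simple r)   = reflData (inject₁ r) (suc r) (+ 0)
genAff {n} affine   = reflData zero (fromℕ n) (ℤ.- (+ 1))

evalS : ∀ {n} → List (SGen n) → Aff n
evalS ws = foldr _∘ₐ_ idAff (map genAff ws)

Reduced : ∀ {n} → List (SGen n) → Set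
Reduced {n} ws = ∀ (vs : List (SGen n)) → evalS vs ≡ evalS ws → length ws ℕ.≤ length vs

_≤B_ : ∀ {n} → Aff n → Aff n → Set
_≤B_ {n} x w = Σ (List (SGen n)) λ ws → Reduced ws × evalS ws ≡ w ×
               Σ (List (SGen n)) λ us → us ⊆ ws × evalS us ≡ x

w₀ : ∀ {n} → Aff n
w₀ = aff (tabulate opposite) (replicate _ (+ 0))

InAid : ∀ {n} → Pt n → Set
InAid x = InE x × (∀ i j → i Fin.< j →
            (ℚ.- 1ℚ) ℚ.< pairRoot x i j × pairRoot x i j ℚ.< 0ℚ)

InAlc : ∀ {n} → Aff n → Pt n → Set
InAlc w x = Σ (Pt _) λ y → InAid y × act w y ≗ₚ x

InTrans : ∀ {n} → (Pt n → Set) → Pt n → Pt n → Set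
InTrans X v x = Σ (Pt _) λ y → X y × (∀ p → x p ≡ y p ℚ.+ v p)

SameSet : ∀ {n} → (Pt n → Set) → (Pt n → Set) → Set
SameSet X Y = ∀ x → (X x → Y x) × (Y x → X x)

InCplus : ∀ {n} → Pt n → Set
InCplus x = InE x × (∀ r → 0ℚ ℚ.≤ pairα x r)

InΠplus : ∀ {n} → Pt n → Set
InΠplus x = InE x × (∀ r → 0ℚ ℚ.≤ pairα x r × pairα x r ℚ.≤ 1ℚ)

InΠminus : ∀ {n} → Pt n → Set
InΠminus x = Σ (Pt _) λ y → InΠplus y × act w₀ y ≗ₚ x

InWplus : ∀ {n} → Aff n → Set
InWplus w = InWaff w × (∀ x → InAlc w x → InCplus x)

InF : ∀ {n} → Aff n → Set
InF a = InWaff a × (∀ x → InAlc a x → InΠminus x)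

-- Weights.  Λ = ⊕ ℤϖ_i = {x ∈ E : ⟨x,α_i⟩ ∈ ℤ ∀ i} (ϖ_i dual basis).

InΛplus : ∀ {n} → Pt n → Set
InΛplus x = InE x × (∀ r → Σ ℕ λ k → pairα x r ≡ ℕ→ℚ k)

_≤D_ : ∀ {n} → Pt n → Pt n → Set
_≤D_ {n} μ lam = Σ (Fin n → ℕ) λ d →
  ∀ p → lam p ℚ.- μ p ≡ sumℚ (λ r → ℕ→ℚ (d r) ℚ.* αvec r p)

_<D_ : ∀ {n} → Pt n → Pt n → Set
μ <D lam = μ ≤D lam × ¬ (μ ≗ₚ lam)

_⋖_ : ∀ {n} → Pt n → Pt n → Set
_⋖_ {n} μ lam = InΛplus μ × InΛplus lam × μ <D lam ×
  ¬ (Σ (Pt n) λ ν → InΛplus ν × μ <D ν × ν <D lam)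

IsTheta : ∀ {n} → Aff n → Pt n → Aff n → Set
IsTheta a lam θ = InWaff θ × SameSet (InAlc θ) (InTrans (InAlc (w₀ ∘ₐ a)) lam)

InI : ∀ {n} → Aff n → Pt n → Aff n → Set
InI {n} a lam x = InWaff x × Σ (Aff n) λ θ → IsTheta a lam θ × x ≤B θ

InPB : ∀ {n} → Aff n → Pt n → Aff n → Set
InPB {n} a lam x = InI a lam x × ¬ (Σ (Pt n) λ μ → μ ⋖ lam × InI a μ x)

zoneCond : Fin 3 → ℚ → Set
zoneCond zero q = q ≡ 0ℚ
zoneCond (suc zero) q = q ≡ 1ℚ
zoneCond (suc (suc zero)) q = ℕ→ℚ 2 ℚ.≤ q

InZone : ∀ {n} → (Fin n → Fin 3) → Pt n → Set
InZone 𝒊 x = InΛplus x × (∀ r → zoneCond (𝒊 r) (pairα x r))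

open import Data.List.Relation.Unary.Unique.Propositional using (Unique)
open import Data.List.Membership.Propositional using (_∈_)

Enumerates : ∀ {n} → List (Aff n) → (Aff n → Set) → Set
Enumerates L P = Unique L × (∀ w → (w ∈ L → P w) × (P w → w ∈ L))

{-# OPTIONS --safe #-}

-- Encode w ∈ W_aff by its window g_p = σ(p) + N t_p (N = n + 1), the image of the barycentre of
-- the fundamental alcove scaled by N and shifted.  Translating alcoves by a weight λ adds N λ to the window, and
-- right multiplication by a generator exchanges two adjacent residues modulo N.  The vertices of the
-- alcove are V_j(g)_p = ⌊(g_p + j)/N⌋.
--
-- Bruhat order: x ≤ y iff Φ_{j,j'}(x) ≤ Φ_{j,j'}(y) for all j, j', where Φ_{j,j'}(g) is the sum of the
-- positive parts of V_j(g) - V_{j'}(id).  Along a descent of y, Φ_j takes the largest value allowed by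
-- Φ_{j-1} and Φ_{j+1}, along an ascent the smallest, so the criterion propagates through reduced words.
-- If y is dominant, the criterion says that every vertex of the dominant alcove in the W_f-orbit of x is
-- ≤ the corresponding vertex of y in the dominance order.
--
-- Hence the weights enter only through partial sums of vertices, which are compatible with translation
-- by μ - λ.  The weights covered by λ are the λ - (α_i + … + α_k) with pairings ≥ 2 (i = k) or
-- 1, 0, …, 0, 1, so they depend on the zone only.  It remains to see that the translated alcove stays
-- dominant: if ⟨λ,α_r⟩ ≥ 2, not being below λ - α_r makes some vertex of x tight in its r-th partial
-- sum, which keeps x away from the wall of α_r.  Translating along W_f-chambers then gives a bijection
-- of the full sets PB_a(λ) and PB_a(μ).

module Submission where

open import Defs renaming (trans to transl)
open import Data.Nat as ℕ using (ℕ; zero; suc; z≤n; s≤s)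
import Data.Nat.Properties as ℕₚ
open import Data.Integer as ℤ using (ℤ; +_; -[1+_]; 0ℤ; 1ℤ; -1ℤ; _+_; _-_; _*_; -_; _≤_; _<_; _/ℕ_; _%ℕ_)
import Data.Integer.Properties as ℤₚ
open import Data.Integer.DivMod using (n%ℕd<d; a≡a%ℕn+[a/ℕn]*n; [n/ℕd]*d≤n; n<s[n/ℕd]*d)
open import Data.Integer.Divisibility.Signed using (_∣_; divides; _∣?_; ∣m∣n⇒∣m+n; ∣m∣n⇒∣m-n; ∣⇒∣ᵤ)
open import Data.Integer.Tactic.RingSolver using (solve-∀)
import Data.Nat.Divisibility as ℕᵈ
open import Data.Rational as ℚ using (ℚ; 0ℚ; 1ℚ)
import Data.Rational.Properties as ℚₚ
import Data.Rational.Unnormalised as ℚᵘ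
open import Data.Fin as Fin using (Fin; zero; suc; inject₁; fromℕ; fromℕ<; toℕ; opposite; punchOut)
import Data.Fin.Properties as Finₚ
open import Data.Fin.Permutation as Perm using (Permutation; _⟨$⟩ʳ_; _⟨$⟩ˡ_)
open import Data.Vec using (Vec; []; _∷_; tabulate; lookup)
import Data.Vec.Properties as Vecₚ
open import Data.Bool using (Bool; true; false; if_then_else_)
open import Data.List as List using (List; []; _∷_; length; map; foldr; reverse; _++_)
import Data.List.Properties as Listₚ
open import Data.List.Membership.Propositional using (_∈_)
import Data.List.Membership.Propositional.Properties as Memₚ
open import Data.List.Relation.Binary.Sublist.Propositional using (_⊆_; []; _∷_; _∷ʳ_)
open import Data.Product using (Σ; ∃; _×_; _,_; proj₁; proj₂)
open import Data.Sum using (_⊎_; inj₁; inj₂)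
open import Data.Empty using (⊥; ⊥-elim)
open import Function using (_∘_)
open import Relation.Nullary using (¬_; Dec; yes; no; does; contradiction)
open import Relation.Nullary.Decidable using (dec-true; dec-false; map′; _×-dec_; _⊎-dec_; ¬?; _→-dec_)
open import Relation.Binary using (DecidableEquality; tri<; tri≈; tri>)
open import Relation.Binary.PropositionalEquality using (_≡_; _≢_; refl; sym; trans; cong; cong₂; subst; subst₂; module ≡-Reasoning)
import Algebra.Properties.CommutativeMonoid.Sum as CMSum
open import Data.Fin.Relation.Unary.Top using (view; ‵fromℕ; ‵inj₁)
import Data.List.Relation.Binary.Sublist.Propositional.Properties as Subₚ
open import Data.Fin.Induction using (<-weakInduction)
import Tactic.RingSolver as RS
open import Tactic.RingSolver.Core.AlmostCommutativeRing using (AlmostCommutativeRing; fromCommutativeRing)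
open import Data.Maybe using (Maybe; just; nothing)
import Data.Rational.Unnormalised.Properties as ℚᵘₚ
open import Level using (0ℓ)
open import Data.List.Relation.Unary.Any using (here; there)
import Data.List.Relation.Unary.All as All
import Data.List.Relation.Unary.All.Properties as Allₚ
open import Data.List.Relation.Unary.AllPairs using ([]; _∷_)
open import Data.List.Relation.Unary.Unique.Propositional using (Unique)
import Data.List.Relation.Unary.Unique.DecPropositional.Properties as DecUnique
import Data.List.Membership.DecPropositional as DecMem

-- Subwords do not see translations: moving an alcove by a weight outside the root lattice rotates
-- the residues of its window. Comparing all Φ at once is insensitive to this. The entries of Nλ
-- share one residue c modulo N, so adding Nλ to two windows renumbers the levels j by c and adds
-- equal amounts to both sides of every partial sum. Since θ_a(λ) is dominant, I_a(λ) is a union of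
-- left W_f-cosets, each recorded by its sorted window. Translation keeps every inequality between
-- sorted windows; the one thing that can fail is that the result stays sorted. Here the number 2
-- enters: λ - α_r is dominant exactly when ⟨λ,α_r⟩ ≥ 2, and smaller pairings agree throughout a
-- zone, so that the gap between neighbouring entries does not change there. For larger pairings the
-- failure to lie below λ - α_r bounds that gap below by (⟨λ,α_r⟩ - 1)N, enough to survive lowering
-- the pairing. The cardinality concerns non-dominant elements too. They are moved by `transport`,
-- each in its own chamber, and strict sortedness of the translate makes this invertible.

module ℤΣ = CMSum ℤₚ.+-0-commutativeMonoid
module ℕΣ = CMSum ℕₚ.+-0-commutativeMonoid
module ℚΣ = CMSum ℚₚ.+-0-commutativeMonoid

-- Linear integer inequalities

infixl 6 _⊕_

_⊕_ : ∀ {a b} → 0ℤ ≤ a → 0ℤ ≤ b → 0ℤ ≤ a + b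
_⊕_ = ℤₚ.+-mono-≤

gap : ∀ {a b} → a ≤ b → 0ℤ ≤ b - a
gap = ℤₚ.i≤j⇒0≤j-i

gap< : ∀ {a b} → a < b → 0ℤ ≤ b - (1ℤ + a)
gap< a<b = gap (ℤₚ.i<j⇒suc[i]≤j a<b)

gap≡ : ∀ {a b} → a ≡ b → 0ℤ ≤ b - a
gap≡ eq = gap (ℤₚ.≤-reflexive eq)

-- A linear inequality is certified by writing the difference of its sides as a sum of nonnegative
-- gaps of the hypotheses. Choosing the summands is the whole content; the remaining equation is a
-- ring identity.
lin≤ : ∀ {a b e} → 0ℤ ≤ e → b - a ≡ e → a ≤ b
lin≤ h eq = ℤₚ.0≤i-j⇒j≤i (subst (0ℤ ≤_) (sym eq) h)

lin< : ∀ {a b e} → 0ℤ ≤ e → b - (1ℤ + a) ≡ e → a < b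
lin< h eq = ℤₚ.suc[i]≤j⇒i<j (lin≤ h eq)

lin⊥ : ∀ {e} → 0ℤ ≤ e → e ≡ -1ℤ → ⊥
lin⊥ h refl with h
... | ()

dvd : ∀ {k x y} → k ∣ x → y ≡ x → k ∣ y
dvd d eq = subst (_ ∣_) (sym eq) d

-- Floor division by N

module _ (n : ℕ) where

  opaque
    N : ℤ
    N = + suc n

    fl : ℤ → ℤ
    fl z = z /ℕ suc n

    N≡ : N ≡ + suc n
    N≡ = refl

    fl-lower : ∀ z → fl z * N ≤ z
    fl-lower z = [n/ℕd]*d≤n z (suc n)

    fl-upper : ∀ z → z < (1ℤ + fl z) * N
    fl-upper z = n<s[n/ℕd]*d z (suc n)

    fl-residue : ∀ z → z ≡ + (z %ℕ suc n) + fl z * N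
    fl-residue z = a≡a%ℕn+[a/ℕn]*n z (suc n)

    0≤N-1 : 0ℤ ≤ N - 1ℤ
    0≤N-1 = ℤ.+≤+ z≤n

    0≤*N : ∀ k → 0ℤ ≤ + k * N
    0≤*N k = subst (0ℤ ≤_) (ℤₚ.pos-* k (suc n)) (ℤ.+≤+ z≤n)

    *N-cancel-< : ∀ i j → i * N < j * N → i < j
    *N-cancel-< i j = ℤₚ.*-cancelʳ-<-nonNeg N

    *N-cancel-≡ : ∀ i j → i * N ≡ j * N → i ≡ j
    *N-cancel-≡ i j = ℤₚ.*-cancelʳ-≡ i j N

  ≤fl : ∀ k z → k * N ≤ z → k ≤ fl z
  ≤fl k z h = lin≤ (gap< (*N-cancel-< k (1ℤ + fl z) (ℤₚ.≤-<-trans h (fl-upper z)))) (eq k (fl z))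
    where
    eq : ∀ a b → b - a ≡ 1ℤ + b - (1ℤ + a)
    eq = solve-∀

  fl< : ∀ k z → z < k * N → fl z < k
  fl< k z h = *N-cancel-< (fl z) k (ℤₚ.≤-<-trans (fl-lower z) h)

  fl-unique : ∀ k z → k * N ≤ z → z < (1ℤ + k) * N → fl z ≡ k
  fl-unique k z lo hi = ℤₚ.≤-antisym (lin≤ (gap< (fl< (1ℤ + k) z hi)) (eq (fl z) k)) (≤fl k z lo)
    where
    eq : ∀ a k → k - a ≡ 1ℤ + k - (1ℤ + a)
    eq = solve-∀

  fl-mono : ∀ {z z'} → z ≤ z' → fl z ≤ fl z'
  fl-mono {z} {z'} h = ≤fl (fl z) z' (ℤₚ.≤-trans (fl-lower z) h)

  fl-shift : ∀ z k → fl (z + k * N) ≡ fl z + k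
  fl-shift z k = fl-unique (fl z + k) (z + k * N)
    (lin≤ (gap (fl-lower z)) (eq₁ z (fl z) k N))
    (lin< (gap< (fl-upper z)) (eq₂ z (fl z) k N))
    where
    eq₁ : ∀ z f k N → z + k * N - (f + k) * N ≡ z - f * N
    eq₁ = solve-∀
    eq₂ : ∀ z f k N → (1ℤ + (f + k)) * N - (1ℤ + (z + k * N)) ≡ (1ℤ + f) * N - (1ℤ + z)
    eq₂ = solve-∀

  fl-mult : ∀ k → fl (k * N) ≡ k
  fl-mult k = fl-unique k (k * N) ℤₚ.≤-refl (lin< (0≤N-1) (eq k N))
    where
    eq : ∀ k N → (1ℤ + k) * N - (1ℤ + k * N) ≡ N - 1ℤ
    eq = solve-∀

  fl-≡mult : ∀ z k → z ≡ k * N → fl z ≡ k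
  fl-≡mult z k refl = fl-mult k

  fl-pred-mult : ∀ z k → z + 1ℤ ≡ k * N → fl z ≡ k - 1ℤ
  fl-pred-mult z k eq = fl-unique (k - 1ℤ) z
    (lin≤ (gap≡ (sym eq) ⊕ 0≤N-1) (eq₁ z k N))
    (lin< (gap≡ eq) (eq₂ z k N))
    where
    eq₁ : ∀ z k N → z - (k - 1ℤ) * N ≡ (z + 1ℤ - k * N) + (N - 1ℤ)
    eq₁ = solve-∀
    eq₂ : ∀ z k N → (1ℤ + (k - 1ℤ)) * N - (1ℤ + z) ≡ k * N - (z + 1ℤ)
    eq₂ = solve-∀

  -- The floor moves only when the argument reaches a multiple of N. For a window with distinct
  -- residues the vertices therefore change one coordinate at a time.
  fl-step : ∀ z → ¬ N ∣ z + 1ℤ → fl (z + 1ℤ) ≡ fl z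
  fl-step z ∤ = fl-unique (fl z) (z + 1ℤ)
    (ℤₚ.≤-trans (fl-lower z) (ℤₚ.i≤i+j z 1ℤ))
    (ℤₚ.≤∧≢⇒< (lin≤ (gap< (fl-upper z)) (eq (fl z) z N)) λ e → ∤ (divides (1ℤ + fl z) e))
    where
    eq : ∀ f z N → (1ℤ + f) * N - (z + 1ℤ) ≡ (1ℤ + f) * N - (1ℤ + z)
    eq = solve-∀

-- Finite sets and sums

injective⇒surjective : ∀ {m} (f : Fin m → Fin m) → (∀ {p q} → f p ≡ f q → p ≡ q) → ∀ y → ∃ λ x → f x ≡ y
injective⇒surjective {suc m} f inj y with Finₚ.any? (λ x → f x Fin.≟ y)
... | yes hit = hit
... | no  miss = ⊥-elim (ℕₚ.1+n≰n (Finₚ.injective⇒≤ {f = λ x → punchOut (y≢ x)}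
        λ eq → inj (Finₚ.punchOut-injective (y≢ _) (y≢ _) eq)))
  where
  y≢ : ∀ x → y ≢ f x
  y≢ x eq = miss (x , sym eq)

injective⇒permutation : ∀ {m} (f : Fin m → Fin m) → (∀ {p q} → f p ≡ f q → p ≡ q) →
  Σ (Permutation m m) λ π → ∀ p → π ⟨$⟩ʳ p ≡ f p
injective⇒permutation f inj =
  Perm.permutation f (proj₁ ∘ surj) (proj₂ ∘ surj) (λ x → inj (proj₂ (surj (f x)))) , λ _ → refl
  where surj = injective⇒surjective f inj

sum-bump : ∀ {m} (f f' : Fin m → ℕ) i → f' i ≡ suc (f i) → (∀ p → p ≢ i → f' p ≡ f p) →
  ℕΣ.sum f' ≡ suc (ℕΣ.sum f)
sum-bump f f' zero at off = cong₂ ℕ._+_ at (ℕΣ.sum-cong-≗ λ p → off (suc p) λ ())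
sum-bump f f' (suc i) at off = trans
  (cong₂ ℕ._+_ (off zero λ ()) (sum-bump (f ∘ suc) (f' ∘ suc) i at λ p p≢i → off (suc p) (p≢i ∘ Finₚ.suc-injective)))
  (ℕₚ.+-suc (f zero) _)

sumℤ-zero : ∀ {m} (f : Fin m → ℤ) → (∀ p → f p ≤ 0ℤ) → ℤΣ.sum f ≡ 0ℤ → ∀ p → f p ≡ 0ℤ
sumℤ-zero {suc m} f f≤0 Σ≡0 = λ where
    zero → head
    (suc p) → sumℤ-zero (f ∘ suc) (f≤0 ∘ suc) tail p
  where
  sum≤0 : ∀ {m} (f : Fin m → ℤ) → (∀ p → f p ≤ 0ℤ) → ℤΣ.sum f ≤ 0ℤ
  sum≤0 {zero} f h = ℤₚ.≤-refl
  sum≤0 {suc m} f h = ℤₚ.+-mono-≤ (h zero) (sum≤0 (f ∘ suc) (h ∘ suc))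
  rest : ℤ
  rest = ℤΣ.sum (f ∘ suc)
  eq : ∀ a b → a - 0ℤ ≡ (a + b - 0ℤ) + (0ℤ - b)
  eq = solve-∀
  head : f zero ≡ 0ℤ
  head = ℤₚ.≤-antisym (f≤0 zero) (lin≤ (gap≡ (sym Σ≡0) ⊕ gap (sum≤0 (f ∘ suc) (f≤0 ∘ suc))) (eq (f zero) rest))
  tail : rest ≡ 0ℤ
  tail = trans (sym (ℤₚ.+-identityˡ rest)) (trans (cong (_+ rest) (sym head)) Σ≡0)

sumℤ-scale : ∀ {m} (f : Fin m → ℤ) c → ℤΣ.sum (λ p → f p * c) ≡ ℤΣ.sum f * c
sumℤ-scale {zero} f c = refl
sumℤ-scale {suc m} f c = trans (cong (λ z → f zero * c + z) (sumℤ-scale (f ∘ suc) c)) (sym (ℤₚ.*-distribʳ-+ c (f zero) _))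

sumℤ-const : ∀ m c → ℤΣ.sum {m} (λ _ → c) ≡ + m * c
sumℤ-const zero c = sym (ℤₚ.*-zeroˡ c)
sumℤ-const (suc m) c = trans (cong (λ z → c + z) (sumℤ-const m c)) (eq c (+ m))
  where
  eq : ∀ c m → c + m * c ≡ (1ℤ + m) * c
  eq = solve-∀

constant-zero : ∀ {m} (e : Fin (suc m) → ℤ) → (∀ p q → e p ≡ e q) → ℤΣ.sum e ≡ 0ℤ → ∀ p → e p ≡ 0ℤ
constant-zero {m} e const Σ≡0 p = cancel (ℤₚ.i*j≡0⇒i≡0∨j≡0 (+ suc m) {e p}
    (trans (sym (sumℤ-const (suc m) (e p))) (trans (ℤΣ.sum-cong-≗ {suc m} {λ _ → e p} {e} (const p)) Σ≡0)))
  where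
  cancel : ∀ {c} → + suc m ≡ 0ℤ ⊎ c ≡ 0ℤ → c ≡ 0ℤ
  cancel (inj₂ c≡0) = c≡0

-- Integer windows g with pairwise distinct residues modulo N

Window : ℕ → Set
Window n = Fin (suc n) → ℤ

ι : ∀ {n} → Window n
ι p = + toℕ p

record Distinct {n : ℕ} (g : Window n) : Set where
  constructor distinct
  field separate : ∀ p q → N n ∣ g p - g q → p ≡ q
open Distinct

same-residue : ∀ n x y → x %ℕ suc n ≡ y %ℕ suc n → N n ∣ x - y
same-residue n x y eq = divides (fl n x - fl n y) (begin
  x - y ≡⟨ cong₂ _-_ (fl-residue n x) (fl-residue n y) ⟩
  (+ (x %ℕ suc n) + fl n x * N n) - (+ (y %ℕ suc n) + fl n y * N n) ≡⟨ cong (λ r → (+ (x %ℕ suc n) + fl n x * N n) - (+ r + fl n y * N n)) (sym eq) ⟩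
  (+ (x %ℕ suc n) + fl n x * N n) - (+ (x %ℕ suc n) + fl n y * N n) ≡⟨ ring (+ (x %ℕ suc n)) (fl n x) (fl n y) (N n) ⟩
  (fl n x - fl n y) * N n ∎)
  where
  open ≡-Reasoning
  ring : ∀ r a b N → (r + a * N) - (r + b * N) ≡ (a - b) * N
  ring = solve-∀

-- Pigeonhole: N distinct residues modulo N leave no class out.
position : ∀ {n} {g : Window n} → Distinct g → ∀ z → ∃ λ p → N n ∣ g p - z
position {n} {g} dist z = proj₁ hit , same-residue n (g (proj₁ hit)) z
    (trans (sym (Finₚ.toℕ-fromℕ< _)) (trans (cong toℕ (proj₂ hit)) (Finₚ.toℕ-fromℕ< _)))
  where
  res : ℤ → Fin (suc n)
  res x = fromℕ< (n%ℕd<d x (suc n))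
  res-inj : ∀ {p q} → res (g p) ≡ res (g q) → p ≡ q
  res-inj {p} {q} eq = separate dist p q (same-residue n (g p) (g q)
    (trans (sym (Finₚ.toℕ-fromℕ< _)) (trans (cong toℕ eq) (Finₚ.toℕ-fromℕ< _))))
  hit = injective⇒surjective (λ p → res (g p)) res-inj (res z)

-- Following residues r, r + 1, r + 2, … cyclically passes through every position.
cyclic-constant : ∀ {n} {g : Window n} → Distinct g → (e : Window n) →
  (∀ a b → N n ∣ g b - g a - 1ℤ → e a ≤ e b) → ∀ p q → e p ≡ e q
cyclic-constant {n} {g} dist e step p q = ℤₚ.≤-antisym (below p q) (below q p)
  where
  walk : ∀ k a b → N n ∣ g b - g a - + k → e a ≤ e b
  walk zero a b d = ℤₚ.≤-reflexive (cong e (sym (separate dist b a (dvd d (eq (g b) (g a))))))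
    where
    eq : ∀ x y → x - y ≡ x - y - + 0
    eq = solve-∀
  walk (suc k) a b d = ℤₚ.≤-trans (walk k a c (dvd dc (eq₁ (g c) (g a) (+ k)))) (step c b (dvd (∣m∣n⇒∣m-n d dc) (eq₂ (g b) (g c) (g a) (+ k))))
    where
    c = proj₁ (position dist (g a + + k))
    dc = proj₂ (position dist (g a + + k))
    eq₁ : ∀ x y k → x - y - k ≡ x - (y + k)
    eq₁ = solve-∀
    eq₂ : ∀ b c a k → b - c - 1ℤ ≡ (b - a - (1ℤ + k)) - (c - (a + k))
    eq₂ = solve-∀
  below : ∀ a b → e a ≤ e b
  -- The residue of `g b - g a` is the number of unit steps leading from the class of `g a` to the
  -- class of `g b`.
  below a b = walk ((g b - g a) %ℕ suc n) a b (divides (fl n (g b - g a))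
    (trans (cong (_- + ((g b - g a) %ℕ suc n)) (fl-residue n (g b - g a))) (eq (+ ((g b - g a) %ℕ suc n)) (fl n (g b - g a) * N n))))
    where
    eq : ∀ r m → r + m - r ≡ m
    eq = solve-∀

-- The order invariants Φ and the effect of adjacent transpositions of residues

pos : ℤ → ℕ
pos (+ k) = k
pos -[1+ _ ] = 0

pos-up : ∀ d → 0ℤ < d → pos d ≡ suc (pos (d - 1ℤ))
pos-up (+ suc k) _ = refl
pos-up (+ zero) (ℤ.+<+ ())

pos-stay : ∀ d → d ≤ 0ℤ → pos d ≡ pos (d - 1ℤ)
pos-stay (+ zero) _ = refl
pos-stay (+ suc k) (ℤ.+≤+ ())
pos-stay -[1+ k ] _ = refl

opaque
  -- As j' runs through the integers, p ↦ ⌊(p + j')/N⌋ runs through the vectors c, ..., c, c + 1,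
  -- ..., c + 1. Multiples of N give the constant ones, the only thresholds that `⊑⇒Dom` uses.
  Φ : ∀ {n} → Window n → ℤ → ℤ → ℕ
  Φ {n} g j j' = ℕΣ.sum λ p → pos (fl n (g p + j) - fl n (ι {n} p + j'))

  Φ≡ : ∀ {n} (g : Window n) j j' → Φ g j j' ≡ ℕΣ.sum (λ p → pos (fl n (g p + j) - fl n (ι {n} p + j')))
  Φ≡ g j j' = refl

infix 4 _⊑_

_⊑_ : ∀ {n} → Window n → Window n → Set
x ⊑ y = ∀ j j' → Φ x j j' ℕ.≤ Φ y j j'

δ : ∀ {n} → Window n → Window n
δ g p = g p - ι p

module _ {n : ℕ} {g : Window n} (dist : Distinct g) (p : Fin (suc n)) (j j' : ℤ) (p∣ : N n ∣ g p + (j + 1ℤ)) where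
  private
    t : ℤ
    t = fl n (ι p + j')
    m : ℤ
    m = _∣_.quotient p∣
    at₁ : fl n (g p + (j + 1ℤ)) ≡ m
    at₁ = fl-≡mult n (g p + (j + 1ℤ)) m (_∣_.equality p∣)
    at₀ : fl n (g p + j) ≡ m - 1ℤ
    at₀ = fl-pred-mult n (g p + j) m (trans (ℤₚ.+-assoc (g p) j 1ℤ) (_∣_.equality p∣))
    eqd : ∀ m t → m - t - 1ℤ ≡ m - 1ℤ - t
    eqd = solve-∀
    off : ∀ q → q ≢ p → pos (fl n (g q + (j + 1ℤ)) - fl n (ι q + j')) ≡ pos (fl n (g q + j) - fl n (ι q + j'))
    off q q≢p = cong (λ z → pos (z - fl n (ι q + j'))) (trans (cong (fl n) (sym (ℤₚ.+-assoc (g q) j 1ℤ)))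
      (fl-step n (g q + j) λ d → q≢p (separate dist q p (dvd (∣m∣n⇒∣m-n d p∣) (eq (g q) (g p) j)))))
      where
      eq : ∀ x y j → x - y ≡ x + j + 1ℤ - (y + (j + 1ℤ))
      eq = solve-∀

  -- Between the levels j and j + 1 only the floor at `p` moves, from m - 1 to m. The move counts
  -- exactly when m > t, that is, when ι p + j' < mN = g p + j + 1.
  Φ-up : j' < δ g p + (j + 1ℤ) → Φ g (j + 1ℤ) j' ≡ suc (Φ g j j')
  Φ-up h = trans (Φ≡ g (j + 1ℤ) j') (trans (sum-bump _ _ p
    (trans (cong (λ z → pos (z - t)) at₁) (trans (pos-up (m - t) 0<) (cong suc (cong pos (trans (eqd m t) (cong (_- t) (sym at₀)))))))
    off) (cong suc (sym (Φ≡ g j j'))))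
    where
    eq : ∀ g p j j' → (g + (j + 1ℤ)) - (1ℤ + (p + j')) ≡ (g - p + (j + 1ℤ)) - (1ℤ + j')
    eq = solve-∀
    eq0 : ∀ m t → m - t - (1ℤ + 0ℤ) ≡ m - (1ℤ + t)
    eq0 = solve-∀
    0< : 0ℤ < m - t
    0< = lin< (gap< (fl< n m (ι p + j') (subst (ι p + j' <_) (_∣_.equality p∣) (lin< (gap< h) (eq (g p) (ι p) j j'))))) (eq0 m t)

  Φ-stay : δ g p + (j + 1ℤ) ≤ j' → Φ g (j + 1ℤ) j' ≡ Φ g j j'
  Φ-stay h = trans (Φ≡ g (j + 1ℤ) j') (trans (ℕΣ.sum-cong-≗ go) (sym (Φ≡ g j j')))
    where
    eq : ∀ g p j j' → (p + j') - (g + (j + 1ℤ)) ≡ j' - (g - p + (j + 1ℤ))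
    eq = solve-∀
    eq0 : ∀ m t → 0ℤ - (m - t) ≡ t - m
    eq0 = solve-∀
    ≤0 : m - t ≤ 0ℤ
    ≤0 = lin≤ (gap (≤fl n m (ι p + j') (subst (_≤ ι p + j') (_∣_.equality p∣) (lin≤ (gap h) (eq (g p) (ι p) j j'))))) (eq0 m t)
    go : ∀ q → pos (fl n (g q + (j + 1ℤ)) - fl n (ι q + j')) ≡ pos (fl n (g q + j) - fl n (ι q + j'))
    go q with q Fin.≟ p
    ... | no q≢p = off q q≢p
    ... | yes refl = trans (cong (λ z → pos (z - t)) at₁) (trans (pos-stay (m - t) ≤0) (cong pos (trans (eqd m t) (cong (_- t) (sym at₀)))))

  Φ-step : (Φ g (j + 1ℤ) j' ≡ suc (Φ g j j')) ⊎ (Φ g (j + 1ℤ) j' ≡ Φ g j j')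
  Φ-step with j' ℤₚ.<? δ g p + (j + 1ℤ)
  ... | yes h = inj₁ (Φ-up h)
  ... | no h = inj₂ (Φ-stay (ℤₚ.≮⇒≥ h))

Φ-mono : ∀ {n} {g : Window n} → Distinct g → ∀ j j' → Φ g j j' ℕ.≤ Φ g (j + 1ℤ) j' × Φ g (j + 1ℤ) j' ℕ.≤ suc (Φ g j j')
Φ-mono {n} {g} dist j j' = bounds (Φ-step dist p j j' (dvd (proj₂ (position dist (- (j + 1ℤ)))) (eq (g p) (j + 1ℤ))))
  where
  p : Fin (suc n)
  p = proj₁ (position dist (- (j + 1ℤ)))
  eq : ∀ x y → x + y ≡ x - - y
  eq x y = cong (λ z → x + z) (sym (ℤₚ.neg-involutive y))
  bounds : ∀ {k l} → k ≡ suc l ⊎ k ≡ l → l ℕ.≤ k × k ℕ.≤ suc l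
  bounds (inj₁ refl) = ℕₚ.n≤1+n _ , ℕₚ.≤-refl
  bounds (inj₂ refl) = ℕₚ.≤-refl , ℕₚ.n≤1+n _

record Adjacent {n : ℕ} (r : ℤ) (g : Window n) (a b : Fin (suc n)) : Set where
  constructor adjacent
  field
    res-a : N n ∣ g a - r
    res-b : N n ∣ g b - (r + 1ℤ)
open Adjacent

-- For adjacent a, b write g_b = g_a + 1 + κN. The alcove and its swap share the wall x_a - x_b =
-- -κ, and the inequality says that this wall separates `g` from the identity window `ι`.
Descent : ∀ {n} → Window n → Fin (suc n) → Fin (suc n) → Set
Descent g a b = δ g a < δ g b

∤1 : ∀ {n} → 1 ℕ.≤ n → ¬ N n ∣ 1ℤ
∤1 {suc n} _ d with ℕᵈ.∣⇒≤ (∣⇒∣ᵤ (subst (_∣ 1ℤ) (N≡ (suc n)) d))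
... | s≤s ()

module _ {n : ℕ} (1≤n : 1 ℕ.≤ n) (r : ℤ) where
  private
    -- Since N ≥ 2, the two levels next to an affected level are unaffected.
    free : ∀ j → N n ∣ r + (j + 1ℤ) + 1ℤ → ¬ N n ∣ r + j + 1ℤ × ¬ N n ∣ r + (j + 1ℤ + 1ℤ) + 1ℤ
    free j d = (λ d' → ∤1 1≤n (dvd (∣m∣n⇒∣m-n d d') (eq₁ r j))) , (λ d' → ∤1 1≤n (dvd (∣m∣n⇒∣m-n d' d) (eq₂ r j)))
      where
      eq₁ : ∀ r j → 1ℤ ≡ r + (j + 1ℤ) + 1ℤ - (r + j + 1ℤ)
      eq₁ = solve-∀
      eq₂ : ∀ r j → 1ℤ ≡ r + (j + 1ℤ + 1ℤ) + 1ℤ - (r + (j + 1ℤ) + 1ℤ)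
      eq₂ = solve-∀
    at-b : ∀ {g : Window n} {a b} → Adjacent r g a b → ∀ j → N n ∣ r + (j + 1ℤ) + 1ℤ → N n ∣ g b + (j + 1ℤ)
    at-b {g} {a} {b} adj j d = dvd (∣m∣n⇒∣m+n (res-b adj) d) (eq (g b) r j)
      where
      eq : ∀ g r j → g + (j + 1ℤ) ≡ g - (r + 1ℤ) + (r + (j + 1ℤ) + 1ℤ)
      eq = solve-∀
    at-a : ∀ {g : Window n} {a b} → Adjacent r g a b → ∀ j → N n ∣ r + (j + 1ℤ) + 1ℤ → N n ∣ g a + (j + 1ℤ + 1ℤ)
    at-a {g} {a} adj j d = dvd (∣m∣n⇒∣m+n (res-a adj) d) (eq (g a) r j)
      where
      eq : ∀ g r j → g + (j + 1ℤ + 1ℤ) ≡ g - r + (r + (j + 1ℤ) + 1ℤ)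
      eq = solve-∀
    pred-suc : ∀ j → j - 1ℤ + 1ℤ ≡ j
    pred-suc = solve-∀

  -- At a descent Φ_j = min (Φ_{j-1} + 1, Φ_{j+1}), the largest value its neighbours allow.
  descent-⊑ : ∀ {y z : Window n} {a b} → Distinct y → Distinct z → Adjacent r y a b → Descent y a b →
    (∀ j j' → ¬ N n ∣ r + j + 1ℤ → Φ z j j' ℕ.≤ Φ y j j') → z ⊑ y
  descent-⊑ {y} {z} {a} {b} dy dz adj desc off j j' with N n ∣? r + j + 1ℤ
  ... | no ∤ = off j j' ∤
  ... | yes d = subst (λ j → Φ z j j' ℕ.≤ Φ y j j') (pred-suc j) (go (j - 1ℤ) (subst (λ j → N n ∣ r + j + 1ℤ) (sym (pred-suc j)) d))
    where
    go : ∀ i → N n ∣ r + (i + 1ℤ) + 1ℤ → Φ z (i + 1ℤ) j' ℕ.≤ Φ y (i + 1ℤ) j'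
    -- Position `b` jumps between the levels i and i + 1, position `a` between i + 1 and i + 2. By
    -- the descent, if the jump of `b` does not count then neither does that of `a`; so Φ_{i+1} is
    -- either Φ_i + 1 or Φ_{i+2}.
    go i d with j' ℤₚ.<? δ y b + (i + 1ℤ)
    ... | yes h = ℕₚ.≤-trans (proj₂ (Φ-mono dz i j')) (subst (_ ℕ.≤_) (sym (Φ-up dy b i j' (at-b adj i d) h)) (s≤s (off i j' (proj₁ (free i d)))))
    ... | no h = ℕₚ.≤-trans (proj₁ (Φ-mono dz (i + 1ℤ) j')) (subst (_ ℕ.≤_)
        (Φ-stay dy a (i + 1ℤ) j' (at-a adj i d) (lin≤ (gap (ℤₚ.≮⇒≥ h) ⊕ gap< desc) (eq (δ y a) (δ y b) i j')))
        (off (i + 1ℤ + 1ℤ) j' (proj₂ (free i d))))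
      where
      eq : ∀ a b i j' → j' - (a + (i + 1ℤ + 1ℤ)) ≡ (j' - (b + (i + 1ℤ))) + (b - (1ℤ + a))
      eq = solve-∀

  -- At an ascent Φ_j = max (Φ_{j-1}, Φ_{j+1} - 1), the smallest value its neighbours allow.
  ascent-⊑ : ∀ {x z : Window n} {a b} → Distinct x → Distinct z → Adjacent r x a b → ¬ Descent x a b →
    (∀ j j' → ¬ N n ∣ r + j + 1ℤ → Φ x j j' ℕ.≤ Φ z j j') → x ⊑ z
  ascent-⊑ {x} {z} {a} {b} dx dz adj asc off j j' with N n ∣? r + j + 1ℤ
  ... | no ∤ = off j j' ∤
  ... | yes d = subst (λ j → Φ x j j' ℕ.≤ Φ z j j') (pred-suc j) (go (j - 1ℤ) (subst (λ j → N n ∣ r + j + 1ℤ) (sym (pred-suc j)) d))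
    where
    go : ∀ i → N n ∣ r + (i + 1ℤ) + 1ℤ → Φ x (i + 1ℤ) j' ℕ.≤ Φ z (i + 1ℤ) j'
    go i d with j' ℤₚ.<? δ x b + (i + 1ℤ)
    ... | no h = subst (ℕ._≤ _) (sym (Φ-stay dx b i j' (at-b adj i d) (ℤₚ.≮⇒≥ h)))
        (ℕₚ.≤-trans (off i j' (proj₁ (free i d))) (proj₁ (Φ-mono dz i j')))
    ... | yes h = ℕₚ.≤-pred (subst (ℕ._≤ _)
        (Φ-up dx a (i + 1ℤ) j' (at-a adj i d) (lin< (gap< h ⊕ gap (ℤₚ.≮⇒≥ asc) ⊕ ℤ.+≤+ (z≤n {1})) (eq (δ x a) (δ x b) i j')))
        (ℕₚ.≤-trans (off (i + 1ℤ + 1ℤ) j' (proj₂ (free i d))) (proj₂ (Φ-mono dz (i + 1ℤ) j'))))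
      where
      eq : ∀ a b i j' → a + (i + 1ℤ + 1ℤ) - (1ℤ + j') ≡ (b + (i + 1ℤ) - (1ℤ + j')) + (a - b) + 1ℤ
      eq = solve-∀

-- Exchanging two adjacent residues

record Swap {n : ℕ} (r : ℤ) (g g' : Window n) (a b : Fin (suc n)) : Set where
  constructor swapped
  field
    before : Adjacent r g a b
    at-a   : g' a ≡ g a + 1ℤ
    at-b   : g' b ≡ g b - 1ℤ
    off    : ∀ p → p ≢ a → p ≢ b → g' p ≡ g p
open Swap

module _ {n : ℕ} (1≤n : 1 ℕ.≤ n) where

  adjacent-≢ : ∀ {r} {g : Window n} {a b} → Adjacent r g a b → a ≢ b
  adjacent-≢ {r} {g} {a} adj refl = ∤1 1≤n (dvd (∣m∣n⇒∣m-n (res-a adj) (res-b adj)) (eq (g a) r))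
    where
    eq : ∀ g r → 1ℤ ≡ g - r - (g - (r + 1ℤ))
    eq = solve-∀

  swap-sym : ∀ {r} {g g' : Window n} {a b} → Swap r g g' a b → Swap r g' g b a
  swap-sym {r} {g} {g'} {a} {b} s = swapped
    (adjacent (dvd (res-b (before s)) (trans (cong (_- r) (at-b s)) (eq₁ (g b) r)))
              (dvd (res-a (before s)) (trans (cong (_- (r + 1ℤ)) (at-a s)) (eq₂ (g a) r))))
    (trans (eq₃ (g b)) (cong (_+ 1ℤ) (sym (at-b s))))
    (trans (eq₄ (g a)) (cong (_- 1ℤ) (sym (at-a s))))
    (λ p p≢b p≢a → sym (off s p p≢a p≢b))
    where
    eq₁ : ∀ g r → g - 1ℤ - r ≡ g - (r + 1ℤ)
    eq₁ = solve-∀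
    eq₂ : ∀ g r → g + 1ℤ - (r + 1ℤ) ≡ g - r
    eq₂ = solve-∀
    eq₃ : ∀ g → g ≡ g - 1ℤ + 1ℤ
    eq₃ = solve-∀
    eq₄ : ∀ g → g ≡ g + 1ℤ - 1ℤ
    eq₄ = solve-∀

  swap-descent : ∀ {r} {g g' : Window n} {a b} → Swap r g g' a b → ¬ Descent g a b → Descent g' b a
  swap-descent {r} {g} {g'} {a} {b} s asc = lin< (gap (ℤₚ.≮⇒≥ asc) ⊕ ℤ.+≤+ (z≤n {1}))
    (trans (cong₂ (λ x y → x - ι a - (1ℤ + (y - ι b))) (at-a s) (at-b s)) (eq (g a) (ι a) (g b) (ι b)))
    where
    eq : ∀ ga a gb b → ga + 1ℤ - a - (1ℤ + (gb - 1ℤ - b)) ≡ ga - a - (gb - b) + 1ℤ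
    eq = solve-∀

  -- A swapped entry moves by one between the residues r and r + 1, so its floor at level j can
  -- change only if r + 1 + j is a multiple of N.
  Φ-swap : ∀ {r} {g g' : Window n} {a b} → Swap r g g' a b → ∀ j j' → ¬ N n ∣ r + j + 1ℤ → Φ g' j j' ≡ Φ g j j'
  Φ-swap {r} {g} {g'} {a} {b} s j j' ∤ =
    trans (Φ≡ g' j j') (trans (ℕΣ.sum-cong-≗ λ p → cong (λ z → pos (z - fl n (ι p + j'))) (level p)) (sym (Φ≡ g j j')))
    where
    eqa : ∀ g j → g + 1ℤ + j ≡ g + j + 1ℤ
    eqa = solve-∀
    eqb : ∀ g j → g + j ≡ g - 1ℤ + j + 1ℤ
    eqb = solve-∀
    eqa' : ∀ g j r → r + j + 1ℤ ≡ g + j + 1ℤ - (g - r)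
    eqa' = solve-∀
    eqb' : ∀ g j r → r + j + 1ℤ ≡ g - 1ℤ + j + 1ℤ - (g - (r + 1ℤ))
    eqb' = solve-∀
    level : ∀ p → fl n (g' p + j) ≡ fl n (g p + j)
    level p with p Fin.≟ a | p Fin.≟ b
    ... | yes refl | _ = trans (cong (fl n) (trans (cong (_+ j) (at-a s)) (eqa (g p) j)))
          (fl-step n (g p + j) λ d → ∤ (dvd (∣m∣n⇒∣m-n d (res-a (before s))) (eqa' (g p) j r)))
    ... | no _ | yes refl = trans (cong (λ z → fl n (z + j)) (at-b s)) (sym (trans (cong (fl n) (eqb (g p) j))
          (fl-step n (g p - 1ℤ + j) λ d → ∤ (dvd (∣m∣n⇒∣m-n d (res-b (before s))) (eqb' (g p) j r)))))
    ... | no p≢a | no p≢b = cong (λ z → fl n (z + j)) (off s p p≢a p≢b)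

-- The length function: hyperplanes separating an alcove from the fundamental one

-- For p < q the identity alcove has ⌊(ι p - ι q)/N⌋ = -1. Hence the summand 1: the absolute value
-- counts the hyperplanes x_p - x_q = k between the two alcoves.
cross : ∀ {n} → Window n → Fin (suc n) → Fin (suc n) → ℕ
cross {n} g p q = if does (p Fin.<? q) then ℤ.∣ fl n (g p - g q) + 1ℤ ∣ else 0

inv : ∀ {n} → Window n → ℕ
inv g = ℕΣ.sum λ p → ℕΣ.sum λ q → cross g p q

cross-< : ∀ {n} (g : Window n) {p q} → p Fin.< q → cross g p q ≡ ℤ.∣ fl n (g p - g q) + 1ℤ ∣
cross-< {n} g {p} {q} p<q = cong (λ b → if b then ℤ.∣ fl n (g p - g q) + 1ℤ ∣ else 0) (dec-true (p Fin.<? q) p<q)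

cross-≮ : ∀ {n} (g : Window n) {p q} → ¬ p Fin.< q → cross g p q ≡ 0
cross-≮ {n} g {p} {q} p≮q = cong (λ b → if b then ℤ.∣ fl n (g p - g q) + 1ℤ ∣ else 0) (dec-false (p Fin.<? q) p≮q)

inv-bump : ∀ {n} (g g' : Window n) p q → cross g' p q ≡ suc (cross g p q) →
  (∀ p' q' → ¬ (p' ≡ p × q' ≡ q) → cross g' p' q' ≡ cross g p' q') → inv g' ≡ suc (inv g)
inv-bump g g' p q at off = sum-bump _ _ p
  (sum-bump _ _ q at λ q' q'≢q → off p q' (q'≢q ∘ proj₂))
  (λ p' p'≢p → ℕΣ.sum-cong-≗ λ q' → off p' q' (p'≢p ∘ proj₁))

abs-up : ∀ z → 0ℤ ≤ z → ℤ.∣ z + 1ℤ ∣ ≡ suc ℤ.∣ z ∣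
abs-up (+ k) _ = ℕₚ.+-comm k 1

abs-down : ∀ z → z < 0ℤ → ℤ.∣ z ∣ ≡ suc ℤ.∣ z + 1ℤ ∣
abs-down -[1+ zero ] _ = refl
abs-down -[1+ suc k ] _ = refl
abs-down (+ k) (ℤ.+<+ ())

ι<N : ∀ {n} (p : Fin (suc n)) → ι p < N n
ι<N {n} p = subst (ι p <_) (sym (N≡ n)) (ℤ.+<+ (Finₚ.toℕ<n p))

0≤ι : ∀ {n} (p : Fin (suc n)) → 0ℤ ≤ ι p
0≤ι p = ℤ.+≤+ z≤n

1<N : ∀ {n} → 1 ℕ.≤ n → 1ℤ < N n
1<N {n} 1≤n = subst (1ℤ <_) (sym (N≡ n)) (ℤ.+<+ (s≤s 1≤n))

module _ {n : ℕ} (1≤n : 1 ℕ.≤ n) where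

  fl-succ-mult : ∀ z k → z ≡ k * N n + 1ℤ → fl n z ≡ k
  fl-succ-mult z k refl = fl-unique n k _ (ℤₚ.i≤i+j (k * N n) 1ℤ) (lin< (gap< (1<N 1≤n)) (eq k (N n)))
    where
    eq : ∀ k N → (1ℤ + k) * N - (1ℤ + (k * N + 1ℤ)) ≡ N - (1ℤ + 1ℤ)
    eq = solve-∀

  private
   module _ {r : ℤ} {g g' : Window n} {a b : Fin (suc n)} (dist : Distinct g) (s : Swap r g g' a b)
           (κ : ℤ) (gb : g b ≡ g a + 1ℤ + κ * N n) where
      a≢b : a ≢ b
      a≢b = adjacent-≢ 1≤n (before s)

      quot : N n ∣ g b - g a - 1ℤ
      quot = divides κ (trans (cong (λ z → z - g a - 1ℤ) gb) (eq (g a) (κ * N n)))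
        where
        eq : ∀ x y → x + 1ℤ + y - x - 1ℤ ≡ y
        eq = solve-∀

      eqA : ∀ x y → x + 1ℤ - y ≡ x - y + 1ℤ
      eqA = solve-∀
      eqB : ∀ x y → x - y ≡ x - 1ℤ - y + 1ℤ
      eqB = solve-∀
      eqC : ∀ x y → x - y ≡ x - (y + 1ℤ) + 1ℤ
      eqC = solve-∀
      eqD : ∀ x y → x - (y - 1ℤ) ≡ x - y + 1ℤ
      eqD = solve-∀
      eqA' : ∀ ga gb gq → gb - gq ≡ ga - gq + 1ℤ + (gb - ga - 1ℤ)
      eqA' = solve-∀
      eqD' : ∀ ga gb gp → gp - ga ≡ gp - gb + 1ℤ + (gb - ga - 1ℤ)
      eqD' = solve-∀

      -- The difference changes by at most one. If it crossed a multiple of N on the way, two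
      -- different positions would have the same residue.
      same : ∀ p q → p ≢ q → ¬ (p ≡ a × q ≡ b) → ¬ (p ≡ b × q ≡ a) → fl n (g' p - g' q) ≡ fl n (g p - g q)
      same p q p≢q ¬ab ¬ba with p Fin.≟ a | p Fin.≟ b | q Fin.≟ a | q Fin.≟ b
      ... | yes refl | _ | yes refl | _ = ⊥-elim (p≢q refl)
      ... | yes refl | _ | no _ | yes refl = ⊥-elim (¬ab (refl , refl))
      ... | yes refl | _ | no q≢a | no q≢b =
            trans (cong (fl n) (trans (cong₂ _-_ (at-a s) (off s q q≢a q≢b)) (eqA (g p) (g q))))
              (fl-step n (g p - g q) λ d → q≢b (sym (separate dist b q (dvd (∣m∣n⇒∣m+n d quot) (eqA' (g p) (g b) (g q))))))
      ... | no _ | yes refl | yes refl | _ = ⊥-elim (¬ba (refl , refl))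
      ... | no _ | yes refl | no _ | yes refl = ⊥-elim (p≢q refl)
      ... | no _ | yes refl | no q≢a | no q≢b =
            trans (cong (fl n) (cong₂ _-_ (at-b s) (off s q q≢a q≢b))) (sym (trans (cong (fl n) (eqB (g p) (g q)))
              (fl-step n (g p - 1ℤ - g q) λ d → p≢q (separate dist p q (dvd d (eqB (g p) (g q)))))))
      ... | no p≢a | no p≢b | yes refl | _ =
            trans (cong (fl n) (cong₂ _-_ (off s p p≢a p≢b) (at-a s))) (sym (trans (cong (fl n) (eqC (g p) (g q)))
              (fl-step n (g p - (g q + 1ℤ)) λ d → p≢q (separate dist p q (dvd d (eqC (g p) (g q)))))))
      ... | no p≢a | no p≢b | no _ | yes refl =
            trans (cong (fl n) (trans (cong₂ _-_ (off s p p≢a p≢b) (at-b s)) (eqD (g p) (g q))))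
              (fl-step n (g p - g q) λ d → p≢a (separate dist p a (dvd (∣m∣n⇒∣m+n d quot) (eqD' (g a) (g q) (g p)))))
      ... | no p≢a | no p≢b | no q≢a | no q≢b = cong (fl n) (cong₂ _-_ (off s p p≢a p≢b) (off s q q≢a q≢b))

      cross-same : ∀ p q → ¬ (p ≡ a × q ≡ b) → ¬ (p ≡ b × q ≡ a) → cross g' p q ≡ cross g p q
      cross-same p q ¬ab ¬ba with p Fin.<? q
      ... | no  p≮q = trans (cross-≮ g' p≮q) (sym (cross-≮ g p≮q))
      ... | yes p<q = trans (cross-< g' p<q) (trans (cong (λ z → ℤ.∣ z + 1ℤ ∣) (same p q (Finₚ.<⇒≢ p<q) ¬ab ¬ba)) (sym (cross-< g p<q)))

      cancel : ∀ z → z - 1ℤ + 1ℤ ≡ z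
      cancel = solve-∀

      ab-before : fl n (g a - g b) + 1ℤ ≡ - κ
      ab-before = trans (cong (_+ 1ℤ) (fl-pred-mult n (g a - g b) (- κ) (trans (cong (λ z → g a - z + 1ℤ) gb) (eq (g a) κ (N n))))) (cancel (- κ))
        where
        eq : ∀ x k N → x - (x + 1ℤ + k * N) + 1ℤ ≡ - k * N
        eq = solve-∀
      ab-after : fl n (g' a - g' b) + 1ℤ ≡ - κ + 1ℤ
      ab-after = cong (_+ 1ℤ) (fl-succ-mult (g' a - g' b) (- κ)
        (trans (cong₂ _-_ (at-a s) (trans (at-b s) (cong (_- 1ℤ) gb))) (eq (g a) κ (N n))))
        where
        eq : ∀ x k N → x + 1ℤ - (x + 1ℤ + k * N - 1ℤ) ≡ - k * N + 1ℤ
        eq = solve-∀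
      ba-before : fl n (g b - g a) + 1ℤ ≡ κ + 1ℤ
      ba-before = cong (_+ 1ℤ) (fl-succ-mult (g b - g a) κ (trans (cong (_- g a) gb) (eq (g a) κ (N n))))
        where
        eq : ∀ x k N → x + 1ℤ + k * N - x ≡ k * N + 1ℤ
        eq = solve-∀
      ba-after : fl n (g' b - g' a) + 1ℤ ≡ κ
      ba-after = trans (cong (_+ 1ℤ) (fl-pred-mult n (g' b - g' a) κ
        (trans (cong₂ (λ x y → x - y + 1ℤ) (trans (at-b s) (cong (_- 1ℤ) gb)) (at-a s)) (eq (g a) κ (N n))))) (cancel κ)
        where
        eq : ∀ x k N → x + 1ℤ + k * N - 1ℤ - (x + 1ℤ) + 1ℤ ≡ k * N
        eq = solve-∀

      descent⇒ : Descent g a b → ι b - ι a ≤ κ * N n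
      descent⇒ d = lin≤ (gap< d) (trans (eq (g a) (ι a) (ι b) (κ * N n)) (cong (λ z → z - ι b - (1ℤ + (g a - ι a))) (sym gb)))
        where
        eq : ∀ x a b kN → kN - (b - a) ≡ x + 1ℤ + kN - b - (1ℤ + (x - a))
        eq = solve-∀

      ascent⇒ : ¬ Descent g a b → κ * N n < ι b - ι a
      ascent⇒ d = lin< (gap (ℤₚ.≮⇒≥ d)) (trans (eq (g a) (ι a) (ι b) (κ * N n)) (cong (λ z → g a - ι a - (z - ι b)) (sym gb)))
        where
        eq : ∀ x a b kN → b - a - (1ℤ + kN) ≡ x - a - (x + 1ℤ + kN - b)
        eq = solve-∀

      ι-< : ∀ {p q : Fin (suc n)} → p Fin.< q → ι p < ι q
      ι-< p<q = ℤ.+<+ p<q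

      -- Since ι b - ι a lies strictly between -N and N, comparing it with κN fixes the sign of κ.
      -- This and the next three bounds decide whether the absolute value in `cross` grows or
      -- shrinks.
      <⇒0<κ : a Fin.< b → ι b - ι a ≤ κ * N n → - κ < 0ℤ
      <⇒0<κ a<b h = ℤₚ.neg-mono-< {0ℤ} {κ} (*N-cancel-< n 0ℤ κ (lin< (gap h ⊕ gap< (ι-< a<b)) (eq (ι a) (ι b) (κ * N n))))
        where
        eq : ∀ a b kN → kN - (1ℤ + 0ℤ) ≡ kN - (b - a) + (b - (1ℤ + a))
        eq = solve-∀

      <⇒κ≤0 : κ * N n < ι b - ι a → 0ℤ ≤ - κ
      <⇒κ≤0 h = ℤₚ.neg-mono-≤ {κ} {0ℤ} (lin≤ (gap< (*N-cancel-< n κ 1ℤ (lin< (gap< h ⊕ gap< (ι<N b) ⊕ 0≤ι a ⊕ ℤ.+≤+ (z≤n {1})) (eq₁ (ι a) (ι b) (κ * N n) (N n))))) (eq₂ κ))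
        where
        eq₁ : ∀ a b kN N → 1ℤ * N - (1ℤ + kN) ≡ b - a - (1ℤ + kN) + (N - (1ℤ + b)) + a + 1ℤ
        eq₁ = solve-∀
        eq₂ : ∀ k → 0ℤ - k ≡ 1ℤ - (1ℤ + k)
        eq₂ = solve-∀

      >⇒0≤κ : ι b - ι a ≤ κ * N n → 0ℤ ≤ κ
      >⇒0≤κ h = lin≤ (gap< (*N-cancel-< n -1ℤ κ (lin< (gap h ⊕ gap< (ι<N a) ⊕ 0≤ι b) (eq₁ (ι a) (ι b) (κ * N n) (N n))))) (eq₂ κ)
        where
        eq₁ : ∀ a b kN N → kN - (1ℤ + -1ℤ * N) ≡ kN - (b - a) + (N - (1ℤ + a)) + b
        eq₁ = solve-∀
        eq₂ : ∀ k → k - 0ℤ ≡ k - (1ℤ + -1ℤ)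
        eq₂ = solve-∀

      >⇒κ<0 : b Fin.< a → κ * N n < ι b - ι a → κ < 0ℤ
      >⇒κ<0 b<a h = *N-cancel-< n κ 0ℤ (lin< (gap< h ⊕ gap< (ι-< b<a) ⊕ ℤ.+≤+ (z≤n {1})) (eq (ι a) (ι b) (κ * N n)))
        where
        eq : ∀ a b kN → 0ℤ - (1ℤ + kN) ≡ b - a - (1ℤ + kN) + (a - (1ℤ + b)) + 1ℤ
        eq = solve-∀

      off-ab : a Fin.< b → ∀ p q → ¬ (p ≡ a × q ≡ b) → cross g' p q ≡ cross g p q
      off-ab a<b p q ¬ab with (p Fin.≟ b) ×-dec (q Fin.≟ a)
      ... | no ¬ba = cross-same p q ¬ab ¬ba
      ... | yes (refl , refl) = trans (cross-≮ g' (ℕₚ.<-asym a<b)) (sym (cross-≮ g (ℕₚ.<-asym a<b)))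

      off-ba : b Fin.< a → ∀ p q → ¬ (p ≡ b × q ≡ a) → cross g' p q ≡ cross g p q
      off-ba b<a p q ¬ba with (p Fin.≟ a) ×-dec (q Fin.≟ b)
      ... | no ¬ab = cross-same p q ¬ab ¬ba
      ... | yes (refl , refl) = trans (cross-≮ g' (ℕₚ.<-asym b<a)) (sym (cross-≮ g (ℕₚ.<-asym b<a)))

      inv-ascent′ : ¬ Descent g a b → inv g' ≡ suc (inv g)
      inv-ascent′ asc with Finₚ.<-cmp a b
      ... | tri≈ _ a≡b _ = ⊥-elim (a≢b a≡b)
      ... | tri< a<b _ _ = inv-bump g g' a b
            (trans (cross-< g' a<b) (trans (cong ℤ.∣_∣ ab-after) (trans (abs-up (- κ) (<⇒κ≤0 (ascent⇒ asc)))
              (cong suc (trans (cong ℤ.∣_∣ (sym ab-before)) (sym (cross-< g a<b)))))))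
            (off-ab a<b)
      ... | tri> _ _ b<a = inv-bump g g' b a
            (trans (cross-< g' b<a) (trans (cong ℤ.∣_∣ ba-after) (trans (abs-down κ (>⇒κ<0 b<a (ascent⇒ asc)))
              (cong suc (trans (cong ℤ.∣_∣ (sym ba-before)) (sym (cross-< g b<a)))))))
            (off-ba b<a)

      inv-descent′ : Descent g a b → inv g ≡ suc (inv g')
      inv-descent′ desc with Finₚ.<-cmp a b
      ... | tri≈ _ a≡b _ = ⊥-elim (a≢b a≡b)
      ... | tri< a<b _ _ = inv-bump g' g a b
            (trans (cross-< g a<b) (trans (cong ℤ.∣_∣ ab-before) (trans (abs-down (- κ) (<⇒0<κ a<b (descent⇒ desc)))
              (cong suc (trans (cong ℤ.∣_∣ (sym ab-after)) (sym (cross-< g' a<b)))))))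
            (λ p q h → sym (off-ab a<b p q h))
      ... | tri> _ _ b<a = inv-bump g' g b a
            (trans (cross-< g b<a) (trans (cong ℤ.∣_∣ ba-before) (trans (abs-up κ (>⇒0≤κ (descent⇒ desc)))
              (cong suc (trans (cong ℤ.∣_∣ (sym ba-after)) (sym (cross-< g' b<a)))))))
            (λ p q h → sym (off-ba b<a p q h))

  private
    quotient-form : ∀ {r} {g : Window n} {a b} → Adjacent r g a b → ∃ λ κ → g b ≡ g a + 1ℤ + κ * N n
    quotient-form {r} {g} {a} {b} (adjacent (divides x ex) (divides y ey)) = y - x ,
      trans (eq₁ (g a) (g b) r) (trans (cong₂ (λ u v → g a + 1ℤ + (u - v)) ey ex) (eq₂ (g a) x y (N n)))
      where
      eq₁ : ∀ ga gb r → gb ≡ ga + 1ℤ + (gb - (r + 1ℤ) - (ga - r))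
      eq₁ = solve-∀
      eq₂ : ∀ ga x y N → ga + 1ℤ + (y * N - x * N) ≡ ga + 1ℤ + (y - x) * N
      eq₂ = solve-∀

  module _ {r : ℤ} {g g' : Window n} {a b : Fin (suc n)} (dist : Distinct g) (s : Swap r g g' a b) where

    inv-ascent : ¬ Descent g a b → inv g' ≡ suc (inv g)
    inv-ascent = let κ , gb = quotient-form (before s) in inv-ascent′ dist s κ gb

    inv-descent : Descent g a b → inv g ≡ suc (inv g')
    inv-descent = let κ , gb = quotient-form (before s) in inv-descent′ dist s κ gb

inv-ι : ∀ {n} → inv (ι {n}) ≡ 0
inv-ι {n} = zero-sum (λ p → zero-sum (cross-ι p))
  where
  zero-sum : ∀ {m} {f : Fin m → ℕ} → (∀ p → f p ≡ 0) → ℕΣ.sum f ≡ 0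
  zero-sum {m} h = trans (ℕΣ.sum-cong-≗ h) (ℕΣ.sum-replicate-zero m)
  cross-ι : ∀ p q → cross (ι {n}) p q ≡ 0
  cross-ι p q with p Fin.<? q
  ... | no p≮q = cross-≮ ι p≮q
  ... | yes p<q = trans (cross-< ι p<q) (cong (λ z → ℤ.∣ z + 1ℤ ∣) (fl-unique n -1ℤ (ι p - ι q)
        (lin≤ (gap< (ι<N q) ⊕ 0≤ι p ⊕ ℤ.+≤+ (z≤n {1})) (eq₁ (ι p) (ι q) (N n))) (lin< (gap< (ℤ.+<+ p<q)) (eq₂ (ι p) (ι q) (N n)))))
    where
    eq₁ : ∀ p q N → p - q - -1ℤ * N ≡ N - (1ℤ + q) + p + 1ℤ
    eq₁ = solve-∀
    eq₂ : ∀ p q N → (1ℤ + -1ℤ) * N - (1ℤ + (p - q)) ≡ q - (1ℤ + p)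
    eq₂ = solve-∀

-- Windows of affine maps

σ : ∀ {n} → Aff n → Fin (suc n) → Fin (suc n)
σ w p = lookup (perm w) p

τ : ∀ {n} → Aff n → Window n
τ w p = lookup (transl w) p

-- The image of the barycentre of the fundamental alcove under w is, up to a common shift, window w / N.
window : ∀ {n} → Aff n → Window n
window {n} w p = ι (σ w p) + τ w p * N n

-- The two conditions single out W_aff, the semidirect product of the permutations with the root
-- lattice: see `InWaff⇒Good` and `Good⇒InWaff`.
record Good {n : ℕ} (w : Aff n) : Set where
  constructor good
  field
    σ-injective : ∀ {p q} → σ w p ≡ σ w q → p ≡ q
    τ-sum       : ℤΣ.sum (τ w) ≡ 0ℤ
open Good

Aff-ext : ∀ {n} {f g : Aff n} → (∀ p → σ f p ≡ σ g p) → (∀ p → τ f p ≡ τ g p) → f ≡ g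
Aff-ext {f = f} {g} hσ hτ = cong₂ aff (vec-ext hσ) (vec-ext hτ)
  where
  vec-ext : ∀ {A : Set} {m} {xs ys : Vec A m} → (∀ p → lookup xs p ≡ lookup ys p) → xs ≡ ys
  vec-ext {xs = xs} {ys} h = trans (sym (Vecₚ.tabulate∘lookup xs)) (trans (Vecₚ.tabulate-cong h) (Vecₚ.tabulate∘lookup ys))

σ-∘ : ∀ {n} (f g : Aff n) p → σ (f ∘ₐ g) p ≡ σ g (σ f p)
σ-∘ f g p = Vecₚ.lookup∘tabulate (λ p → lookup (perm g) (lookup (perm f) p)) p

τ-∘ : ∀ {n} (f g : Aff n) p → τ (f ∘ₐ g) p ≡ τ g (σ f p) + τ f p
τ-∘ f g p = Vecₚ.lookup∘tabulate (λ p → lookup (transl g) (lookup (perm f) p) + lookup (transl f) p) p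

σ-id : ∀ {n} (p : Fin (suc n)) → σ (idAff {n}) p ≡ p
σ-id p = Vecₚ.lookup∘tabulate (λ p → p) p

τ-id : ∀ {n} (p : Fin (suc n)) → τ (idAff {n}) p ≡ 0ℤ
τ-id p = Vecₚ.lookup-replicate p (+ 0)

∘ₐ-assoc : ∀ {n} (f g h : Aff n) → (f ∘ₐ g) ∘ₐ h ≡ f ∘ₐ (g ∘ₐ h)
∘ₐ-assoc f g h = Aff-ext
  (λ p → trans (σ-∘ (f ∘ₐ g) h p) (trans (cong (σ h) (σ-∘ f g p)) (sym (trans (σ-∘ f (g ∘ₐ h) p) (σ-∘ g h (σ f p))))))
  (λ p → trans (τ-∘ (f ∘ₐ g) h p) (trans (cong₂ _+_ (cong (τ h) (σ-∘ f g p)) (τ-∘ f g p))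
     (sym (trans (τ-∘ f (g ∘ₐ h) p) (trans (cong (_+ τ f p) (τ-∘ g h (σ f p))) (ℤₚ.+-assoc (τ h (σ g (σ f p))) (τ g (σ f p)) (τ f p)))))))

∘ₐ-identityˡ : ∀ {n} (f : Aff n) → idAff ∘ₐ f ≡ f
∘ₐ-identityˡ f = Aff-ext
  (λ p → trans (σ-∘ idAff f p) (cong (σ f) (σ-id p)))
  (λ p → trans (τ-∘ idAff f p) (trans (cong₂ _+_ (cong (τ f) (σ-id p)) (τ-id p)) (ℤₚ.+-identityʳ (τ f p))))

∘ₐ-identityʳ : ∀ {n} (f : Aff n) → f ∘ₐ idAff ≡ f
∘ₐ-identityʳ f = Aff-ext
  (λ p → trans (σ-∘ f idAff p) (σ-id (σ f p)))
  (λ p → trans (τ-∘ f idAff p) (trans (cong (_+ τ f p) (τ-id (σ f p))) (ℤₚ.+-identityˡ (τ f p))))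

good-id : ∀ {n} → Good (idAff {n})
good-id {n} = good (λ {p} {q} eq → trans (sym (σ-id p)) (trans eq (σ-id q)))
  (trans (ℤΣ.sum-cong-≗ {suc n} {τ (idAff {n})} {λ _ → 0ℤ} τ-id) (ℤΣ.sum-replicate-zero (suc n)))

sum-σ : ∀ {n} {w : Aff n} → Good w → (f : Window n) → ℤΣ.sum (f ∘ σ w) ≡ ℤΣ.sum f
sum-σ {w = w} gw f with injective⇒permutation (σ w) (σ-injective gw)
... | π , π≡ = trans (ℤΣ.sum-cong-≗ λ p → cong f (sym (π≡ p))) (sym (ℤΣ.sum-permute f π))

good-∘ : ∀ {n} {f g : Aff n} → Good f → Good g → Good (f ∘ₐ g)
good-∘ {f = f} {g} gf gg = good
  (λ {p} {q} eq → σ-injective gf (σ-injective gg (trans (sym (σ-∘ f g p)) (trans eq (σ-∘ f g q)))))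
  (trans (ℤΣ.sum-cong-≗ (τ-∘ f g)) (trans (ℤΣ.∑-distrib-+ (τ g ∘ σ f) (τ f))
    (cong₂ _+_ (trans (sum-σ gf (τ g)) (τ-sum gg)) (τ-sum gf))))

module _ {n : ℕ} {i j : Fin (suc n)} (i≢j : i ≢ j) (k : ℤ) where
  private
    ρ = reflData i j k

    refl-σ : ∀ p → σ ρ p ≡ (if does (p Fin.≟ i) then j else (if does (p Fin.≟ j) then i else p))
    refl-σ p = Vecₚ.lookup∘tabulate (λ p → if does (p Fin.≟ i) then j else (if does (p Fin.≟ j) then i else p)) p

    refl-τ : ∀ p → τ ρ p ≡ (if does (p Fin.≟ i) then k else (if does (p Fin.≟ j) then - k else + 0))
    refl-τ p = Vecₚ.lookup∘tabulate (λ p → if does (p Fin.≟ i) then k else (if does (p Fin.≟ j) then - k else + 0)) p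

    if-yes : ∀ {A : Set} (q : Fin (suc n)) {x y : A} → (if does (q Fin.≟ q) then x else y) ≡ x
    if-yes q {x} {y} = cong (λ b → if b then x else y) (dec-true (q Fin.≟ q) refl)

    if-no : ∀ {A : Set} {p q : Fin (suc n)} {x y : A} → p ≢ q → (if does (p Fin.≟ q) then x else y) ≡ y
    if-no {p = p} {q} {x} {y} p≢q = cong (λ b → if b then x else y) (dec-false (p Fin.≟ q) p≢q)

  refl-σ-i : σ ρ i ≡ j
  refl-σ-i = trans (refl-σ i) (if-yes i)

  refl-σ-j : σ ρ j ≡ i
  refl-σ-j = trans (refl-σ j) (trans (if-no (i≢j ∘ sym)) (if-yes j))

  refl-σ-off : ∀ {p} → p ≢ i → p ≢ j → σ ρ p ≡ p
  refl-σ-off {p} p≢i p≢j = trans (refl-σ p) (trans (if-no p≢i) (if-no p≢j))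

  refl-τ-i : τ ρ i ≡ k
  refl-τ-i = trans (refl-τ i) (if-yes i)

  refl-τ-j : τ ρ j ≡ - k
  refl-τ-j = trans (refl-τ j) (trans (if-no (i≢j ∘ sym)) (if-yes j))

  refl-τ-off : ∀ {p} → p ≢ i → p ≢ j → τ ρ p ≡ 0ℤ
  refl-τ-off {p} p≢i p≢j = trans (refl-τ p) (trans (if-no p≢i) (if-no p≢j))

  good-refl : Good ρ
  good-refl = good (λ {p} {q} eq → trans (sym (invol p)) (trans (cong (σ ρ) eq) (invol q)))
    (trans (ℤΣ.sum-cong-≗ split) (trans (ℤΣ.∑-distrib-+ (single i k) (single j (- k)))
      (trans (cong₂ _+_ (sum-single i k) (sum-single j (- k))) (ℤₚ.+-inverseʳ k))))
    where
    invol : ∀ p → σ ρ (σ ρ p) ≡ p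
    invol p with p Fin.≟ i | p Fin.≟ j
    ... | yes refl | _ = trans (cong (σ ρ) refl-σ-i) refl-σ-j
    ... | no _ | yes refl = trans (cong (σ ρ) refl-σ-j) refl-σ-i
    ... | no p≢i | no p≢j = trans (cong (σ ρ) (refl-σ-off p≢i p≢j)) (refl-σ-off p≢i p≢j)
    single : ∀ {m} → Fin m → ℤ → Fin m → ℤ
    single q c p = if does (p Fin.≟ q) then c else 0ℤ
    sum-single : ∀ {m} (q : Fin m) c → ℤΣ.sum (single q c) ≡ c
    sum-single {suc m} zero c = trans (cong (λ z → c + z) (ℤΣ.sum-replicate-zero m)) (ℤₚ.+-identityʳ c)
    sum-single {suc m} (suc q) c = trans (ℤₚ.+-identityˡ _) (sum-single q c)
    split : ∀ p → τ ρ p ≡ single i k p + single j (- k) p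
    split p with p Fin.≟ i | p Fin.≟ j
    ... | yes refl | yes refl = ⊥-elim (i≢j refl)
    ... | yes refl | no _ = trans refl-τ-i (sym (ℤₚ.+-identityʳ k))
    ... | no _ | yes refl = trans refl-τ-j (sym (ℤₚ.+-identityˡ (- k)))
    ... | no p≢i | no p≢j = refl-τ-off p≢i p≢j

InWaff⇒Good : ∀ {n} {w : Aff n} → InWaff w → Good w
InWaff⇒Good (rs , refl) = go rs
  where
  go : ∀ {n} (rs : List (Refl n)) → Good (foldr _∘ₐ_ idAff (map reflAff rs))
  go [] = good-id
  go (mkRefl i j k i≢j ∷ rs) = good-∘ (good-refl i≢j k) (go rs)

fl-ι : ∀ {n} (p : Fin (suc n)) → fl n (ι p) ≡ 0ℤ
fl-ι {n} p = fl-unique n 0ℤ (ι p) (subst (_≤ ι p) (sym (ℤₚ.*-zeroˡ (N n))) (0≤ι p)) (subst (ι p <_) (eq (N n)) (ι<N p))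
  where
  eq : ∀ N → N ≡ (1ℤ + 0ℤ) * N
  eq = solve-∀

fl-window : ∀ {n} (w : Aff n) p → fl n (window w p) ≡ τ w p
fl-window {n} w p = trans (fl-shift n (ι (σ w p)) (τ w p)) (trans (cong (_+ τ w p) (fl-ι (σ w p))) (ℤₚ.+-identityˡ (τ w p)))

ι-injective : ∀ {n} {p q : Fin (suc n)} → ι p ≡ ι q → p ≡ q
ι-injective eq = Finₚ.toℕ-injective (ℤₚ.+-injective eq)

ι-residue : ∀ {n} (p q : Fin (suc n)) → N n ∣ ι p - ι q → p ≡ q
ι-residue {n} p q (divides k eq) = ι-injective (trans ip (trans (cong (λ c → ι q + c * N n) k≡0) (trans (cong (λ z → ι q + z) (ℤₚ.*-zeroˡ (N n))) (ℤₚ.+-identityʳ (ι q)))))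
  where
  ring : ∀ p q → p ≡ q + (p - q)
  ring = solve-∀
  ip : ι p ≡ ι q + k * N n
  ip = trans (ring (ι p) (ι q)) (cong (λ z → ι q + z) eq)
  k≡0 : k ≡ 0ℤ
  k≡0 = trans (sym (trans (cong (_+ k) (fl-ι q)) (ℤₚ.+-identityˡ k))) (trans (sym (fl-shift n (ι q) k)) (trans (cong (fl n) (sym ip)) (fl-ι p)))

window-injective : ∀ {n} {v w : Aff n} → (∀ p → window v p ≡ window w p) → v ≡ w
window-injective {n} {v} {w} h = Aff-ext (λ p → ι-injective (trans (ring (ι (σ v p)) (τ v p * N n))
    (trans (cong₂ _-_ (h p) (cong (_* N n) (sameτ p))) (sym (ring (ι (σ w p)) (τ w p * N n)))))) sameτ
  where
  ring : ∀ a b → a ≡ a + b - b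
  ring = solve-∀
  sameτ : ∀ p → τ v p ≡ τ w p
  sameτ p = trans (sym (fl-window v p)) (trans (cong (fl n) (h p)) (fl-window w p))

window-distinct : ∀ {n} {w : Aff n} → Good w → Distinct (window w)
window-distinct {n} {w} gw = distinct λ p q d → σ-injective gw (ι-residue (σ w p) (σ w q)
  (dvd (∣m∣n⇒∣m-n d (divides (τ w p - τ w q) refl)) (ring (ι (σ w p)) (ι (σ w q)) (τ w p) (τ w q) (N n))))
  where
  ring : ∀ a b s t N → a - b ≡ a + s * N - (b + t * N) - (s - t) * N
  ring = solve-∀

window-sum : ∀ {n} {w : Aff n} → Good w → ℤΣ.sum (window w) ≡ ℤΣ.sum (ι {n})
window-sum {n} {w} gw = trans (ℤΣ.∑-distrib-+ (ι ∘ σ w) (λ p → τ w p * N n)) (trans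
  (cong₂ _+_ (sum-σ gw ι) (trans (sumℤ-scale (τ w) (N n)) (trans (cong (_* N n) (τ-sum gw)) (ℤₚ.*-zeroˡ (N n))))) (ℤₚ.+-identityʳ _))

δ-sum : ∀ {n} {w : Aff n} → Good w → ℤΣ.sum (δ (window w)) ≡ 0ℤ
δ-sum {n} {w} gw = trans (ring₁ (ℤΣ.sum (ι {n})) (ℤΣ.sum (δ (window w)))) (trans (cong (_- ℤΣ.sum (ι {n})) total) (ℤₚ.+-inverseʳ (ℤΣ.sum (ι {n}))))
  where
  ring₁ : ∀ a b → b ≡ a + b - a
  ring₁ = solve-∀
  ring₂ : ∀ i g → i + (g - i) ≡ g
  ring₂ = solve-∀
  total : ℤΣ.sum (ι {n}) + ℤΣ.sum (δ (window w)) ≡ ℤΣ.sum (ι {n})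
  total = trans (sym (ℤΣ.∑-distrib-+ (ι {n}) (δ (window w))))
    (trans (ℤΣ.sum-cong-≗ {suc n} {λ p → ι p + δ (window w) p} {window w} (λ p → ring₂ (ι p) (window w p))) (window-sum gw))

window-id : ∀ {n} p → window (idAff {n}) p ≡ ι p
window-id {n} p = trans (cong₂ (λ x y → ι x + y * N n) (σ-id p) (τ-id p)) (trans (cong (λ z → ι p + z) (ℤₚ.*-zeroˡ (N n))) (ℤₚ.+-identityʳ (ι p)))

unwindow : ∀ {n} → Window n → Aff n
unwindow {n} g = aff (tabulate λ p → fromℕ< (n%ℕd<d (g p) (suc n))) (tabulate λ p → fl n (g p))

window-unwindow : ∀ {n} (g : Window n) p → window (unwindow g) p ≡ g p
window-unwindow {n} g p = trans (cong₂ (λ x y → ι x + y * N n) (Vecₚ.lookup∘tabulate (λ p → fromℕ< (n%ℕd<d (g p) (suc n))) p) (Vecₚ.lookup∘tabulate (λ p → fl n (g p)) p))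
  (trans (cong (λ x → + x + fl n (g p) * N n) (Finₚ.toℕ-fromℕ< (n%ℕd<d (g p) (suc n)))) (sym (fl-residue n (g p))))

-- Distinct residues are a permutation of 0, ..., n and contribute the sum of `ι`. The prescribed
-- total then leaves N times the sum of the translation part equal to 0.
unwindow-good : ∀ {n} (g : Window n) → Distinct g → ℤΣ.sum g ≡ ℤΣ.sum (ι {n}) → Good (unwindow g)
unwindow-good {n} g dist Σg = good inj (*N-cancel-≡ n (ℤΣ.sum (τ w)) 0ℤ (trans (sym (sumℤ-scale (τ w) (N n))) (trans sum0 (sym (ℤₚ.*-zeroˡ (N n))))))
  where
  w : Aff n
  w = unwindow g
  ring₁ : ∀ a s t N → a + s * N - (a + t * N) ≡ (s - t) * N
  ring₁ = solve-∀
  inj : ∀ {p q} → σ w p ≡ σ w q → p ≡ q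
  inj {p} {q} eq = separate dist p q (divides (τ w p - τ w q)
    (trans (cong₂ _-_ (sym (window-unwindow g p)) (sym (window-unwindow g q)))
      (trans (cong (λ x → ι (σ w p) + τ w p * N n - (ι x + τ w q * N n)) (sym eq)) (ring₁ (ι (σ w p)) (τ w p) (τ w q) (N n)))))
  π : Permutation (suc n) (suc n)
  π = proj₁ (injective⇒permutation (σ w) inj)
  A B : ℤ
  A = ℤΣ.sum (λ p → ι (σ w p))
  B = ℤΣ.sum (λ p → τ w p * N n)
  A≡ : A ≡ ℤΣ.sum (ι {n})
  A≡ = trans (ℤΣ.sum-cong-≗ λ p → cong ι (sym (proj₂ (injective⇒permutation (σ w) inj) p))) (sym (ℤΣ.sum-permute (ι {n}) π))
  A+B≡ : A + B ≡ ℤΣ.sum (ι {n})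
  A+B≡ = trans (sym (ℤΣ.∑-distrib-+ (λ p → ι (σ w p)) (λ p → τ w p * N n))) (trans (ℤΣ.sum-cong-≗ (window-unwindow g)) Σg)
  ring₂ : ∀ a b → b ≡ a + b - a
  ring₂ = solve-∀
  sum0 : B ≡ 0ℤ
  sum0 = trans (ring₂ A B) (trans (cong₂ _-_ A+B≡ A≡) (ℤₚ.+-inverseʳ (ℤΣ.sum (ι {n}))))

-- Generators, reduced words and the Bruhat order

-- One shape for both kinds of generators. By `wrap`, `ib` follows `ia` cyclically: c = 0 for a
-- simple reflection, c = 1 for the affine one, where the last index is followed by the first.
record Generator {n : ℕ} (s : SGen n) : Set where
  constructor generator
  field
    {ia ib} : Fin (suc n)
    c       : ℤ
    σ-a     : σ (genAff s) ia ≡ ib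
    σ-b     : σ (genAff s) ib ≡ ia
    σ-off   : ∀ {p} → p ≢ ia → p ≢ ib → σ (genAff s) p ≡ p
    τ-a     : τ (genAff s) ia ≡ c
    τ-b     : τ (genAff s) ib ≡ - c
    τ-off   : ∀ {p} → p ≢ ia → p ≢ ib → τ (genAff s) p ≡ 0ℤ
    wrap    : ι ib + c * N n ≡ ι ia + 1ℤ

descent? : ∀ {n} (g : Window n) a b → Dec (Descent g a b)
descent? g a b = δ g a ℤₚ.<? δ g b

inject₁≢suc : ∀ {n} (r : Fin n) → inject₁ r ≢ suc r
inject₁≢suc (suc r) eq = inject₁≢suc r (Finₚ.suc-injective eq)

zero≢fromℕ : ∀ {n} → 1 ℕ.≤ n → zero ≢ fromℕ n
zero≢fromℕ {suc n} _ ()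

module _ {n : ℕ} (1≤n : 1 ℕ.≤ n) where

  gen : (s : SGen n) → Generator s
  gen (simple r) = generator (+ 0) (refl-σ-i i≢j 0ℤ) (refl-σ-j i≢j 0ℤ) (refl-σ-off i≢j 0ℤ)
    (refl-τ-i i≢j 0ℤ) (refl-τ-j i≢j 0ℤ) (refl-τ-off i≢j 0ℤ)
    (trans (cong (λ z → ι (suc r) + z) (ℤₚ.*-zeroˡ (N n))) (trans (ℤₚ.+-identityʳ (ι (suc r)))
      (trans (cong (λ k → + suc k) (sym (Finₚ.toℕ-inject₁ r))) (ℤₚ.+-comm 1ℤ (ι (inject₁ r))))))
    where
    i≢j : inject₁ r ≢ suc r
    i≢j = inject₁≢suc r
  gen affine = generator 1ℤ (refl-σ-j i≢j -1ℤ) (refl-σ-i i≢j -1ℤ) (λ p≢j p≢i → refl-σ-off i≢j -1ℤ p≢i p≢j)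
    (refl-τ-j i≢j -1ℤ) (refl-τ-i i≢j -1ℤ) (λ p≢j p≢i → refl-τ-off i≢j -1ℤ p≢i p≢j)
    (trans (ring (N n)) (trans (N≡ n) (trans (cong (λ k → + suc k) (sym (Finₚ.toℕ-fromℕ n))) (ℤₚ.+-comm 1ℤ (ι (fromℕ n))))))
    where
    i≢j : zero ≢ fromℕ n
    i≢j = zero≢fromℕ 1≤n
    ring : ∀ N → + 0 + 1ℤ * N ≡ N
    ring = solve-∀

  residue : SGen n → ℤ
  residue s = ι (Generator.ia (gen s))

  good-gen : ∀ s → Good (genAff s)
  good-gen (simple r) = good-refl (inject₁≢suc r) _
  good-gen affine = good-refl (zero≢fromℕ 1≤n) _

  record Step (w : Aff n) (s : SGen n) : Set where
    constructor mkStep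
    field
      {sa sb} : Fin (suc n)
      σ-sa    : σ w sa ≡ Generator.ia (gen s)
      swap    : Swap (residue s) (window w) (window (w ∘ₐ genAff s)) sa sb
  open Step public

  opaque
    gen-step : ∀ {w} → Good w → ∀ s → Step w s
    gen-step {w} gw s = mkStep σa (swapped
        (adjacent (divides (τ w a) (trans (cong (λ x → ι x + τ w a * N n - ι ia) σa) (ring₁ (ι ia) (τ w a * N n))))
                  (divides (τ w b - c) (trans (cong₂ (λ x y → ι x + τ w b * N n - y) σb (sym wrap)) (ring₂ (ι ib) (τ w b) c (N n)))))
        (trans (image a) (trans (cong₂ (λ x y → ι x + (y + τ w a) * N n) (trans (cong (σ (genAff s)) σa) σ-a) (trans (cong (τ (genAff s)) σa) τ-a))
          (trans (ring₃ (ι ib) c (τ w a) (N n)) (trans (cong (_+ τ w a * N n) wrap) (trans (ring₄ (ι ia) (τ w a * N n)) (cong (λ x → ι x + τ w a * N n + 1ℤ) (sym σa)))))))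
        (trans (image b) (trans (cong₂ (λ x y → ι x + (y + τ w b) * N n) (trans (cong (σ (genAff s)) σb) σ-b) (trans (cong (τ (genAff s)) σb) τ-b))
          (trans (ring₅ (ι ia) c (τ w b) (N n)) (trans (cong (λ z → z - 1ℤ - c * N n + τ w b * N n) (sym wrap)) (trans (ring₆ (ι ib) c (τ w b) (N n)) (cong (λ x → ι x + τ w b * N n - 1ℤ) (sym σb)))))))
        (λ p p≢a p≢b → trans (image p) (cong₂ (λ x y → ι x + y * N n) (σ-off (≢a p p≢a) (≢b p p≢b))
          (trans (cong (_+ τ w p) (τ-off (≢a p p≢a) (≢b p p≢b))) (ℤₚ.+-identityˡ (τ w p))))))
      where
      open Generator (gen s)
      a b : Fin (suc n)
      a = proj₁ (injective⇒surjective (σ w) (σ-injective gw) ia)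
      b = proj₁ (injective⇒surjective (σ w) (σ-injective gw) ib)
      σa : σ w a ≡ ia
      σa = proj₂ (injective⇒surjective (σ w) (σ-injective gw) ia)
      σb : σ w b ≡ ib
      σb = proj₂ (injective⇒surjective (σ w) (σ-injective gw) ib)
      ≢a : ∀ p → p ≢ a → σ w p ≢ ia
      ≢a p p≢a eq = p≢a (σ-injective gw (trans eq (sym σa)))
      ≢b : ∀ p → p ≢ b → σ w p ≢ ib
      ≢b p p≢b eq = p≢b (σ-injective gw (trans eq (sym σb)))
      image : ∀ p → window (w ∘ₐ genAff s) p ≡ ι (σ (genAff s) (σ w p)) + (τ (genAff s) (σ w p) + τ w p) * N n
      image p = cong₂ (λ x y → ι x + y * N n) (σ-∘ w (genAff s) p) (τ-∘ w (genAff s) p)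
      ring₁ : ∀ i t → i + t - i ≡ t
      ring₁ = solve-∀
      ring₂ : ∀ i t c N → i + t * N - (i + c * N) ≡ (t - c) * N
      ring₂ = solve-∀
      ring₃ : ∀ i c t N → i + (c + t) * N ≡ i + c * N + t * N
      ring₃ = solve-∀
      ring₄ : ∀ i t → i + 1ℤ + t ≡ i + t + 1ℤ
      ring₄ = solve-∀
      ring₅ : ∀ i c t N → i + (- c + t) * N ≡ i + 1ℤ - 1ℤ - c * N + t * N
      ring₅ = solve-∀
      ring₆ : ∀ i c t N → i + c * N - 1ℤ - c * N + t * N ≡ i + t * N - 1ℤ
      ring₆ = solve-∀

  swap-unique : ∀ {r} {g g₁ g₂ : Window n} {a b a' b'} → Distinct g → Swap r g g₁ a b → Swap r g g₂ a' b' → ∀ p → g₁ p ≡ g₂ p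
  swap-unique {r} {g} {g₁} {g₂} {a} {b} {a'} {b'} dist s s' p
    with separate dist a a' (dvd (∣m∣n⇒∣m-n (res-a (before s)) (res-a (before s'))) (ring (g a) (g a') r))
       | separate dist b b' (dvd (∣m∣n⇒∣m-n (res-b (before s)) (res-b (before s'))) (ring (g b) (g b') (r + 1ℤ)))
       | p Fin.≟ a | p Fin.≟ b
    where
    ring : ∀ x y r → x - y ≡ x - r - (y - r)
    ring = solve-∀
  ... | refl | refl | yes refl | _ = trans (at-a s) (sym (at-a s'))
  ... | refl | refl | no _ | yes refl = trans (at-b s) (sym (at-b s'))
  ... | refl | refl | no p≢a | no p≢b = trans (off s p p≢a p≢b) (sym (off s' p p≢a p≢b))

  gen-involutive : ∀ {w} → Good w → ∀ s → (w ∘ₐ genAff s) ∘ₐ genAff s ≡ w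
  gen-involutive {w} gw s = window-injective (swap-unique (window-distinct gw') (swap (gen-step gw' s)) (swap-sym 1≤n (swap (gen-step gw s))))
    where
    gw' : Good (w ∘ₐ genAff s)
    gw' = good-∘ gw (good-gen s)

  -- Without descents δ never rises from residue r to residue r + 1. The residues form a cycle, so δ
  -- is constant, and its sum vanishes.
  no-descent⇒id : ∀ {w} (gw : Good w) → (∀ s → ¬ Descent (window w) (sa (gen-step gw s)) (sb (gen-step gw s))) → w ≡ idAff
  no-descent⇒id {w} gw asc = window-injective λ p → trans (fix p) (sym (window-id p))
    where
    g : Window n
    g = window w
    dist : Distinct g
    dist = window-distinct gw
    genOf : ∀ i → ∃ λ s → Generator.ia (gen s) ≡ i
    genOf i with view i
    ... | ‵fromℕ = affine , refl
    ... | ‵inj₁ {i = j} _ = simple j , refl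
    ring₁ : ∀ b' b a r → b' - b ≡ b' - (r + 1ℤ) - (b - a - 1ℤ) - (a - r)
    ring₁ = solve-∀
    weak : ∀ a b → N n ∣ g b - g a - 1ℤ → - δ g a ≤ - δ g b
    weak a b d = ℤₚ.neg-mono-≤ {δ g b} {δ g a} (subst₂ (λ x y → δ g y ≤ δ g x) a≡ b≡ (ℤₚ.≮⇒≥ (asc s)))
      where
      s : SGen n
      s = proj₁ (genOf (σ w a))
      a≡ : sa (gen-step gw s) ≡ a
      a≡ = σ-injective gw (trans (σ-sa (gen-step gw s)) (proj₂ (genOf (σ w a))))
      adj : Adjacent (residue s) g (sa (gen-step gw s)) (sb (gen-step gw s))
      adj = before (swap (gen-step gw s))
      b≡ : sb (gen-step gw s) ≡ b
      b≡ = separate dist (sb (gen-step gw s)) b (dvd (∣m∣n⇒∣m-n (∣m∣n⇒∣m-n (res-b adj) d) (subst (λ x → N n ∣ g x - residue s) a≡ (res-a adj)))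
        (ring₁ (g (sb (gen-step gw s))) (g b) (g a) (residue s)))
    const : ∀ p q → δ g p ≡ δ g q
    const p q = ℤₚ.neg-injective {δ g p} {δ g q} (cyclic-constant dist (λ p → - δ g p) weak p q)
    fix : ∀ p → g p ≡ ι p
    fix p = ℤₚ.i-j≡0⇒i≡j (g p) (ι p) (constant-zero (δ g) const (δ-sum gw) p)

  -- At the identity Φ_{j,j} = 0 for every j. The level j = - g p puts the entry at p exactly at 0,
  -- so the vanishing forces g p ≤ ι p; the two windows have the same sum, hence agree.
  ⊑id⇒id : ∀ {x} → Good x → window x ⊑ window (idAff {n}) → x ≡ idAff
  ⊑id⇒id {x} gx h = window-injective λ p → trans (ℤₚ.i-j≡0⇒i≡j (g p) (ι p) (sumℤ-zero (δ g) (λ p → lin≤ (gap (below p)) (ring₁ (g p) (ι p))) (δ-sum gx) p)) (sym (window-id p))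
    where
    g : Window n
    g = window x
    ring₁ : ∀ g i → 0ℤ - (g - i) ≡ i - g
    ring₁ = solve-∀
    Φid : ∀ j → Φ (window (idAff {n})) j j ≡ 0
    Φid j = trans (Φ≡ (window idAff) j j) (trans (ℕΣ.sum-cong-≗ {suc n} {_} {λ _ → 0} (λ p → cong pos (trans (cong (λ z → fl n (z + j) - fl n (ι p + j)) (window-id p)) (ℤₚ.+-inverseʳ (fl n (ι p + j))))))
      (ℕΣ.sum-replicate-zero (suc n)))
    sum-zero : ∀ {m} (f : Fin m → ℕ) → ℕΣ.sum f ≡ 0 → ∀ p → f p ≡ 0
    sum-zero f eq zero = ℕₚ.m+n≡0⇒m≡0 (f zero) eq
    sum-zero f eq (suc p) = sum-zero (f ∘ suc) (ℕₚ.m+n≡0⇒n≡0 (f zero) eq) p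
    pos-zero : ∀ z → pos z ≡ 0 → z ≤ 0ℤ
    pos-zero (+ zero) _ = ℤₚ.≤-refl
    pos-zero -[1+ _ ] _ = ℤ.-≤+
    below : ∀ p → g p ≤ ι p
    below p = lin≤ (gap kN) (trans (ring₂ (g p) (ι p)) (cong (λ z → ι p + - g p - z) (sym (ℤₚ.*-zeroˡ (N n)))))
      where
      ring₂ : ∀ g i → i - g ≡ i + - g - 0ℤ
      ring₂ = solve-∀
      level : fl n (g p + - g p) - fl n (ι p + - g p) ≤ 0ℤ
      level = pos-zero _ (sum-zero (λ p' → pos (fl n (g p' + - g p) - fl n (ι p' + - g p)))
        (trans (sym (Φ≡ g (- g p) (- g p))) (ℕₚ.n≤0⇒n≡0 (subst (Φ g (- g p) (- g p) ℕ.≤_) (Φid (- g p)) (h (- g p) (- g p))))) p)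
      fl0 : fl n (g p + - g p) ≡ 0ℤ
      fl0 = fl-≡mult n (g p + - g p) 0ℤ (trans (ℤₚ.+-inverseʳ (g p)) (sym (ℤₚ.*-zeroˡ (N n))))
      kN : 0ℤ * N n ≤ ι p + - g p
      kN = ℤₚ.≮⇒≥ λ lt → ℤₚ.<⇒≱ (fl< n 0ℤ (ι p + - g p) lt) (lin≤ (gap level) (trans (cong (λ z → fl n (ι p + - g p) - z) (sym fl0)) (ring₄ (fl n (ι p + - g p)) (fl n (g p + - g p)))))
        where
        ring₄ : ∀ a b → a - b ≡ 0ℤ - (b - a)
        ring₄ = solve-∀

  -- Words read from right to left, so that lengthening a word multiplies on the right.
  evalR : List (SGen n) → Aff n
  evalR [] = idAff
  evalR (s ∷ ws) = evalR ws ∘ₐ genAff s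

  evalR-good : ∀ ws → Good (evalR ws)
  evalR-good [] = good-id
  evalR-good (s ∷ ws) = good-∘ (evalR-good ws) (good-gen s)

  evalS-∷ʳ : ∀ (ws : List (SGen n)) s → evalS (ws List.∷ʳ s) ≡ evalS ws ∘ₐ genAff s
  evalS-∷ʳ [] s = trans (∘ₐ-identityʳ (genAff s)) (sym (∘ₐ-identityˡ (genAff s)))
  evalS-∷ʳ (w ∷ ws) s = trans (cong (genAff w ∘ₐ_) (evalS-∷ʳ ws s)) (sym (∘ₐ-assoc (genAff w) (evalS ws) (genAff s)))

  evalS-reverse : ∀ ws → evalS (reverse ws) ≡ evalR ws
  evalS-reverse [] = refl
  evalS-reverse (s ∷ ws) = trans (cong evalS (Listₚ.unfold-reverse s ws)) (trans (evalS-∷ʳ (reverse ws) s) (cong (_∘ₐ genAff s) (evalS-reverse ws)))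

  evalR-reverse : ∀ ws → evalR (reverse ws) ≡ evalS ws
  evalR-reverse ws = trans (sym (evalS-reverse (reverse ws))) (cong evalS (Listₚ.reverse-involutive ws))

  inv≤length : ∀ ws → inv (window (evalR ws)) ℕ.≤ length ws
  inv≤length [] = ℕₚ.≤-reflexive (trans (inv-cong window-id) (inv-ι {n}))
    where
    inv-cong : ∀ {g g' : Window n} → (∀ p → g p ≡ g' p) → inv g ≡ inv g'
    inv-cong {g} {g'} h = ℕΣ.sum-cong-≗ λ p → ℕΣ.sum-cong-≗ λ q →
      cong₂ (λ x y → if does (p Fin.<? q) then ℤ.∣ fl n (x - y) + 1ℤ ∣ else 0) (h p) (h q)
  inv≤length (s ∷ ws) with gen-step (evalR-good ws) s
  ... | st with descent? (window (evalR ws)) (sa st) (sb st)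
  ... | yes desc = ℕₚ.≤-trans (ℕₚ.n≤1+n _) (ℕₚ.≤-trans (ℕₚ.≤-reflexive (sym (inv-descent 1≤n (window-distinct (evalR-good ws)) (swap st) desc)))
                     (ℕₚ.≤-trans (inv≤length ws) (ℕₚ.n≤1+n _)))
  ... | no asc = ℕₚ.≤-trans (ℕₚ.≤-reflexive (inv-ascent 1≤n (window-distinct (evalR-good ws)) (swap st) asc)) (s≤s (inv≤length ws))

  -- A single reduced word serves all x ⊑ w, so `lower` is built together with it. This also
  -- exhibits the lower interval of `w` as the values of finitely many subwords.
  record Word (w : Aff n) : Set where
    field
      letters : List (SGen n)
      value   : evalR letters ≡ w
      minimal : length letters ≡ inv (window w)
      lower   : ∀ {x} → Good x → window x ⊑ window w → Σ (List (SGen n)) λ us → us ⊆ letters × evalR us ≡ x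
  open Word public

  private
    findDescent : ∀ {w} (gw : Good w) → (Σ (SGen n) λ s → Descent (window w) (sa (gen-step gw s)) (sb (gen-step gw s))) ⊎ w ≡ idAff
    findDescent {w} gw with D? affine | Finₚ.any? (λ r → D? (simple r))
      where
      D? : ∀ s → Dec (Descent (window w) (sa (gen-step gw s)) (sb (gen-step gw s)))
      D? s = descent? (window w) _ _
    ... | yes d | _ = inj₁ (affine , d)
    ... | no _ | yes (r , d) = inj₁ (simple r , d)
    ... | no ¬a | no ¬s = inj₂ (no-descent⇒id gw λ where
            affine → ¬a
            (simple r) d → ¬s (r , d))

    base : Word idAff
    base = record { letters = [] ; value = refl
      ; minimal = sym (ℕₚ.n≤0⇒n≡0 (inv≤length [])) ; lower = λ gx h → [] , [] , sym (⊑id⇒id gx h) }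

    module _ {w : Aff n} (gw : Good w) (s : SGen n) (st : Step w s) (d : Descent (window w) (sa st) (sb st)) (rec : Word (w ∘ₐ genAff s)) where
      w' : Aff n
      w' = w ∘ₐ genAff s
      gw' : Good w'
      gw' = good-∘ gw (good-gen s)

      -- Lifting property, with the case of a descent in `lower-desc`. At unaffected levels Φ does
      -- not distinguish `w` from `w'`; at affected ones `x` has an ascent and hence the least
      -- values its neighbours allow.
      lower-asc : ∀ {x} → Good x → window x ⊑ window w → (sx : Step x s) → ¬ Descent (window x) (sa sx) (sb sx) →
        window x ⊑ window w'
      lower-asc gx h sx asc = ascent-⊑ 1≤n (residue s) (window-distinct gx) (window-distinct gw') (before (swap sx)) asc
        λ j j' ∤ → ℕₚ.≤-trans (h j j') (ℕₚ.≤-reflexive (sym (Φ-swap 1≤n (swap st) j j' ∤)))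

      lower-desc : ∀ {x} → Good x → window x ⊑ window w → (sx : Step x s) → Descent (window x) (sa sx) (sb sx) →
        window (x ∘ₐ genAff s) ⊑ window w'
      lower-desc {x} gx h sx desc = ascent-⊑ 1≤n (residue s) (window-distinct gx') (window-distinct gw') (before (swap-sym 1≤n (swap sx))) asc
        λ j j' ∤ → ℕₚ.≤-trans (ℕₚ.≤-reflexive (Φ-swap 1≤n (swap sx) j j' ∤)) (ℕₚ.≤-trans (h j j') (ℕₚ.≤-reflexive (sym (Φ-swap 1≤n (swap st) j j' ∤))))
        where
        gx' : Good (x ∘ₐ genAff s)
        gx' = good-∘ gx (good-gen s)
        asc : ¬ Descent (window (x ∘ₐ genAff s)) (sb sx) (sa sx)
        asc d' = ℕₚ.<-asym (ℕₚ.≤-reflexive (sym (inv-descent 1≤n (window-distinct gx') (swap-sym 1≤n (swap sx)) d')))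
                           (ℕₚ.≤-reflexive (sym (inv-descent 1≤n (window-distinct gx) (swap sx) desc)))

      extend : Word w
      extend = record
        { letters = s ∷ letters rec
        ; value = trans (cong (_∘ₐ genAff s) (value rec)) (gen-involutive gw s)
        ; minimal = trans (cong suc (minimal rec)) (sym (inv-descent 1≤n (window-distinct gw) (swap st) d))
        ; lower = λ {x} gx h → choose gx h (gen-step gx s) (descent? (window x) _ _) }
        where
        choose : ∀ {x} → Good x → window x ⊑ window w → (sx : Step x s) → Dec (Descent (window x) (sa sx) (sb sx)) →
          Σ (List (SGen n)) λ us → us ⊆ s ∷ letters rec × evalR us ≡ x
        choose gx h sx (no asc) = let us , sub , ev = lower rec gx (lower-asc gx h sx asc) in us , s ∷ʳ sub , ev
        choose gx h sx (yes desc) = let us , sub , ev = lower rec (good-∘ gx (good-gen s)) (lower-desc gx h sx desc)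
          in s ∷ us , refl ∷ sub , trans (cong (_∘ₐ genAff s) ev) (gen-involutive gx s)

    build : ∀ k {w} → Good w → inv (window w) ≡ k → Word w
    build′ : ∀ k {w} (gw : Good w) → inv (window w) ≡ k →
      (Σ (SGen n) λ s → Descent (window w) (sa (gen-step gw s)) (sb (gen-step gw s))) ⊎ w ≡ idAff → Word w
    build k gw eq = build′ k gw eq (findDescent gw)
    build′ k gw eq (inj₂ refl) = base
    build′ zero gw eq (inj₁ (s , d)) = ⊥-elim (ℕₚ.1+n≢0 (trans (sym (inv-descent 1≤n (window-distinct gw) (swap (gen-step gw s)) d)) eq))
    build′ (suc k) gw eq (inj₁ (s , d)) = extend gw s (gen-step gw s) d (build k (good-∘ gw (good-gen s))
      (ℕₚ.suc-injective (trans (sym (inv-descent 1≤n (window-distinct gw) (swap (gen-step gw s)) d)) eq)))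

  opaque
    word : ∀ {w} → Good w → Word w
    word {w} gw = build (inv (window w)) gw refl

  -- In a word of minimal length each new letter is an ascent, so the longer product has a descent
  -- there and takes the largest possible values at affected levels. At unaffected levels neither
  -- keeping nor omitting the letter changes Φ, and induction applies.
  subword-⊑ : ∀ ws {us} → length ws ≡ inv (window (evalR ws)) → us ⊆ ws → window (evalR us) ⊑ window (evalR ws)
  subword-⊑ [] _ [] j j' = ℕₚ.≤-refl
  subword-⊑ (s ∷ ws) {us} len sub with gen-step (evalR-good ws) s
  ... | st with descent? (window (evalR ws)) (sa st) (sb st)
  ... | yes desc = ⊥-elim (ℕₚ.1+n≰n (ℕₚ.≤-trans (ℕₚ.≤-trans (ℕₚ.n≤1+n _) (s≤s (ℕₚ.≤-reflexive len)))
                     (ℕₚ.≤-trans (ℕₚ.≤-reflexive (sym (inv-descent 1≤n (window-distinct (evalR-good ws)) (swap st) desc))) (inv≤length ws))))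
  ... | no asc = descent-⊑ 1≤n (residue s) (window-distinct (evalR-good (s ∷ ws))) (window-distinct (evalR-good us))
                   (before (swap-sym 1≤n (swap st))) (swap-descent 1≤n (swap st) asc) (free sub)
    where
    len' : length ws ≡ inv (window (evalR ws))
    len' = ℕₚ.suc-injective (trans len (inv-ascent 1≤n (window-distinct (evalR-good ws)) (swap st) asc))
    free : ∀ {us} → us ⊆ s ∷ ws → ∀ j j' → ¬ N n ∣ residue s + j + 1ℤ → Φ (window (evalR us)) j j' ℕ.≤ Φ (window (evalR (s ∷ ws))) j j'
    free (_ ∷ʳ sub) j j' ∤ = ℕₚ.≤-trans (subword-⊑ ws len' sub j j') (ℕₚ.≤-reflexive (sym (Φ-swap 1≤n (swap st) j j' ∤)))
    free {s ∷ us} (refl ∷ sub) j j' ∤ = ℕₚ.≤-trans (ℕₚ.≤-reflexive (Φ-swap 1≤n (swap (gen-step (evalR-good us) s)) j j' ∤))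
      (ℕₚ.≤-trans (subword-⊑ ws len' sub j j') (ℕₚ.≤-reflexive (sym (Φ-swap 1≤n (swap st) j j' ∤))))

  ≤B⇒⊑ : ∀ {x y : Aff n} → x ≤B y → window x ⊑ window y
  ≤B⇒⊑ (ws , red , refl , us , sub , refl) = subst₂ (λ x y → window x ⊑ window y) (evalR-reverse us) (evalR-reverse ws)
      (subword-⊑ (reverse ws) (ℕₚ.≤-antisym short (inv≤length (reverse ws))) (Subₚ.reverse⁺ sub))
    where
    wd : Word (evalR (reverse ws))
    wd = word (evalR-good (reverse ws))
    -- `Reduced` compares with all words of the same value, in particular with one whose length is
    -- `inv`.
    short : length (reverse ws) ℕ.≤ inv (window (evalR (reverse ws)))
    short = ℕₚ.≤-trans (ℕₚ.≤-reflexive (Listₚ.length-reverse ws)) (ℕₚ.≤-trans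
      (red (reverse (letters wd)) (trans (evalS-reverse (letters wd)) (trans (value wd) (evalR-reverse ws))))
      (ℕₚ.≤-reflexive (trans (Listₚ.length-reverse (letters wd)) (minimal wd))))

  word-reduced : ∀ {w} (wd : Word w) → Reduced (reverse (letters wd))
  word-reduced {w} wd vs eq = ℕₚ.≤-trans (ℕₚ.≤-reflexive (trans (Listₚ.length-reverse (letters wd)) (minimal wd)))
    (subst (λ v → inv (window v) ℕ.≤ length vs) (trans (evalR-reverse vs) (trans eq (trans (evalS-reverse (letters wd)) (value wd))))
      (ℕₚ.≤-trans (inv≤length (reverse vs)) (ℕₚ.≤-reflexive (Listₚ.length-reverse vs))))

  subword⇒≤B : ∀ {w} (wd : Word w) {us} → us ⊆ letters wd → evalR us ≤B w
  subword⇒≤B wd {us} sub = reverse (letters wd) , word-reduced wd , trans (evalS-reverse (letters wd)) (value wd)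
    , reverse us , Subₚ.reverse⁺ sub , evalS-reverse us

  Good⇒InWaff : ∀ {w : Aff n} → Good w → InWaff w
  Good⇒InWaff {w} gw = map reflOf (reverse (letters wd)) , trans (cong (foldr _∘ₐ_ idAff) (trans (sym (Listₚ.map-∘ (reverse (letters wd)))) (Listₚ.map-cong reflOf-gen (reverse (letters wd)))))
      (trans (evalS-reverse (letters wd)) (value wd))
    where
    wd : Word w
    wd = word gw
    reflOf : SGen n → Refl n
    reflOf (simple r) = mkRefl (inject₁ r) (suc r) (+ 0) (inject₁≢suc r)
    reflOf affine = mkRefl zero (fromℕ n) (- (+ 1)) (zero≢fromℕ 1≤n)
    reflOf-gen : ∀ s → reflAff (reflOf s) ≡ genAff s
    reflOf-gen (simple r) = refl
    reflOf-gen affine = refl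

-- Partial sums, majorisation and sorting

psum : ∀ {m} → ℕ → (Fin m → ℤ) → ℤ
psum zero h = 0ℤ
psum {zero} (suc k) h = 0ℤ
psum {suc m} (suc k) h = h zero + psum k (h ∘ suc)

psum-cong : ∀ {m} k {h h' : Fin m → ℤ} → (∀ p → h p ≡ h' p) → psum k h ≡ psum k h'
psum-cong zero eq = refl
psum-cong {zero} (suc k) eq = refl
psum-cong {suc m} (suc k) eq = cong₂ _+_ (eq zero) (psum-cong k (eq ∘ suc))

psum-mono : ∀ {m} k {h h' : Fin m → ℤ} → (∀ p → h p ≤ h' p) → psum k h ≤ psum k h'
psum-mono zero le = ℤₚ.≤-refl
psum-mono {zero} (suc k) le = ℤₚ.≤-refl
psum-mono {suc m} (suc k) le = ℤₚ.+-mono-≤ (le zero) (psum-mono k (le ∘ suc))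

psum-+ : ∀ {m} k (h h' : Fin m → ℤ) → psum k (λ p → h p + h' p) ≡ psum k h + psum k h'
psum-+ zero h h' = refl
psum-+ {zero} (suc k) h h' = refl
psum-+ {suc m} (suc k) h h' = trans (cong (λ z → h zero + h' zero + z) (psum-+ k (h ∘ suc) (h' ∘ suc)))
  (ring (h zero) (h' zero) (psum k (h ∘ suc)) (psum k (h' ∘ suc)))
  where
  ring : ∀ a b c d → a + b + (c + d) ≡ a + c + (b + d)
  ring = solve-∀

psum-neg : ∀ {m} k (h : Fin m → ℤ) → psum k (λ p → - h p) ≡ - psum k h
psum-neg zero h = refl
psum-neg {zero} (suc k) h = refl
psum-neg {suc m} (suc k) h = trans (cong (λ z → - h zero + z) (psum-neg k (h ∘ suc))) (sym (ℤₚ.neg-distrib-+ (h zero) (psum k (h ∘ suc))))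

psum-suc : ∀ {m} (h : Fin m → ℤ) p → psum (suc (toℕ p)) h ≡ psum (toℕ p) h + h p
psum-suc h zero = trans (ℤₚ.+-identityʳ (h zero)) (sym (ℤₚ.+-identityˡ (h zero)))
psum-suc h (suc p) = trans (cong (λ z → h zero + z) (psum-suc (h ∘ suc) p)) (sym (ℤₚ.+-assoc (h zero) (psum (toℕ p) (h ∘ suc)) (h (suc p))))

excess : ∀ {m} → (h t : Fin m → ℤ) → ℕ
excess h t = ℕΣ.sum λ p → pos (h p - t p)

≤pos : ∀ z → z ≤ + pos z
≤pos (+ k) = ℤₚ.≤-refl
≤pos -[1+ k ] = ℤ.-≤+

0≤⇒pos : ∀ z → 0ℤ ≤ z → + pos z ≡ z
0≤⇒pos (+ k) _ = refl

≤0⇒pos : ∀ z → z ≤ 0ℤ → pos z ≡ 0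
≤0⇒pos (+ zero) _ = refl
≤0⇒pos (+ suc k) (ℤ.+≤+ ())
≤0⇒pos -[1+ k ] _ = refl

psum≤excess : ∀ {m} k (h t : Fin m → ℤ) → psum k h ≤ + excess h t + psum k t
psum≤excess zero h t = ℤ.+≤+ z≤n
psum≤excess {zero} (suc k) h t = ℤₚ.≤-refl
psum≤excess {suc m} (suc k) h t = lin≤ (gap (≤pos (h zero - t zero)) ⊕ gap (psum≤excess k (h ∘ suc) (t ∘ suc)))
  (ring (+ pos (h zero - t zero)) (h zero) (t zero) (+ excess (h ∘ suc) (t ∘ suc)) (psum k (h ∘ suc)) (psum k (t ∘ suc)))
  where
  ring : ∀ x h t e H T → x + e + (t + T) - (h + H) ≡ x - (h - t) + (e + T - H)
  ring = solve-∀

-- The equality case of `psum≤excess`: the cut k separates the entries of `h` above `t` from those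
-- below, so the first k terms contain every positive part and nothing negative.
excess-sorted : ∀ {m} k (h t : Fin m → ℤ) → (∀ p → toℕ p ℕ.< k → t p ≤ h p) → (∀ p → k ℕ.≤ toℕ p → h p ≤ t p) →
  + excess h t + psum k t ≡ psum k h
excess-sorted {zero} zero h t _ _ = refl
excess-sorted {zero} (suc k) h t _ _ = refl
excess-sorted {suc m} zero h t lo hi = trans (cong (λ z → + z + excess′ + 0ℤ) (≤0⇒pos (h zero - t zero) (ℤₚ.i≤j⇒i-j≤0 (hi zero z≤n))))
  (trans (ring excess′) (excess-sorted zero (h ∘ suc) (t ∘ suc) (λ p ()) (λ p _ → hi (suc p) z≤n)))
  where
  excess′ : ℤ
  excess′ = + excess (h ∘ suc) (t ∘ suc)
  ring : ∀ e → 0ℤ + e + 0ℤ ≡ e + 0ℤ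
  ring = solve-∀
excess-sorted {suc m} (suc k) h t lo hi = trans
  (cong (λ z → z + + excess (h ∘ suc) (t ∘ suc) + (t zero + psum k (t ∘ suc))) (0≤⇒pos (h zero - t zero) (gap (lo zero (s≤s z≤n)))))
  (trans (ring (h zero) (t zero) (+ excess (h ∘ suc) (t ∘ suc)) (psum k (t ∘ suc)))
    (cong (λ z → h zero + z) (excess-sorted k (h ∘ suc) (t ∘ suc) (λ p p<k → lo (suc p) (s≤s p<k)) (λ p k≤p → hi (suc p) (s≤s k≤p)))))
  where
  ring : ∀ h t e T → h - t + e + (t + T) ≡ h + (e + T)
  ring = solve-∀

count : ∀ {m} → (Fin m → Bool) → ℕ
count P = ℕΣ.sum λ p → if P p then 1 else 0

subsum : ∀ {m} → (Fin m → Bool) → (Fin m → ℤ) → ℤ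
subsum P h = ℤΣ.sum λ p → if P p then h p else 0ℤ

count≤ : ∀ {m} (P : Fin m → Bool) → count P ℕ.≤ m
count≤ {zero} P = z≤n
count≤ {suc m} P with P zero
... | true = s≤s (count≤ (P ∘ suc))
... | false = ℕₚ.m≤n⇒m≤1+n (count≤ (P ∘ suc))

Decreasing : ∀ {m} → (Fin m → ℤ) → Set
Decreasing h = ∀ p q → p Fin.≤ q → h q ≤ h p

psum-shift : ∀ {m} k (h : Fin (suc m) → ℤ) → Decreasing h → k ℕ.≤ m → psum k (h ∘ suc) ≤ psum k h
psum-shift zero h dec _ = ℤₚ.≤-refl
psum-shift {suc m} (suc k) h dec (s≤s k≤m) = ℤₚ.+-mono-≤ (dec zero (suc zero) z≤n)
  (psum-shift k (h ∘ suc) (λ p q p≤q → dec (suc p) (suc q) (s≤s p≤q)) k≤m)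

subsum≤psum : ∀ {m} (P : Fin m → Bool) (h : Fin m → ℤ) → Decreasing h → subsum P h ≤ psum (count P) h
subsum≤psum {zero} P h dec = ℤₚ.≤-refl
subsum≤psum {suc m} P h dec = go (P zero)
  where
  tail : subsum (P ∘ suc) (h ∘ suc) ≤ psum (count (P ∘ suc)) (h ∘ suc)
  tail = subsum≤psum (P ∘ suc) (h ∘ suc) (λ p q p≤q → dec (suc p) (suc q) (s≤s p≤q))
  go : ∀ b → (if b then h zero else 0ℤ) + subsum (P ∘ suc) (h ∘ suc) ≤ psum ((if b then 1 else 0) ℕ.+ count (P ∘ suc)) h
  go true = ℤₚ.+-monoʳ-≤ (h zero) tail
  go false = ℤₚ.≤-trans (ℤₚ.≤-reflexive (ℤₚ.+-identityˡ _)) (ℤₚ.≤-trans tail (psum-shift (count (P ∘ suc)) h dec (count≤ (P ∘ suc))))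

subsum-neg : ∀ {m} (P : Fin m → Bool) (h : Fin m → ℤ) → subsum P (λ p → - h p) ≡ - subsum P h
subsum-neg {zero} P h = refl
subsum-neg {suc m} P h = trans (cong₂ _+_ (neg-if (P zero)) (subsum-neg (P ∘ suc) (h ∘ suc)))
  (sym (ℤₚ.neg-distrib-+ (if P zero then h zero else 0ℤ) (subsum (P ∘ suc) (h ∘ suc))))
  where
  neg-if : ∀ b → (if b then - h zero else 0ℤ) ≡ - (if b then h zero else 0ℤ)
  neg-if true = refl
  neg-if false = refl

psum≤subsum : ∀ {m} (P : Fin m → Bool) (t : Fin m → ℤ) → (∀ p q → p Fin.≤ q → t p ≤ t q) → psum (count P) t ≤ subsum P t
psum≤subsum P t inc = ℤₚ.neg-cancel-≤ {subsum P t} {psum (count P) t} (subst₂ _≤_ (subsum-neg P t) (psum-neg (count P) t)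
  (subsum≤psum P (λ p → - t p) (λ p q p≤q → ℤₚ.neg-mono-≤ (inc p q p≤q))))

excess-subsum : ∀ {m} (h t : Fin m → ℤ) → + excess h t + subsum (λ p → does (t p ℤₚ.<? h p)) t ≡ subsum (λ p → does (t p ℤₚ.<? h p)) h
excess-subsum {zero} h t = refl
excess-subsum {suc m} h t = trans (ring₁ (+ pos (h zero - t zero)) (+ excess (h ∘ suc) (t ∘ suc)) (if does (t zero ℤₚ.<? h zero) then t zero else 0ℤ)
    (subsum (λ p → does (t (suc p) ℤₚ.<? h (suc p))) (t ∘ suc)))
  (cong₂ _+_ (head (t zero ℤₚ.<? h zero)) (excess-subsum (h ∘ suc) (t ∘ suc)))
  where
  ring₁ : ∀ a b c d → a + b + (c + d) ≡ a + c + (b + d)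
  ring₁ = solve-∀
  ring₂ : ∀ h t → h - t + t ≡ h
  ring₂ = solve-∀
  head : (d : Dec (t zero < h zero)) → + pos (h zero - t zero) + (if does d then t zero else 0ℤ) ≡ (if does d then h zero else 0ℤ)
  head (yes t<h) = trans (cong (_+ t zero) (0≤⇒pos (h zero - t zero) (gap (ℤₚ.<⇒≤ t<h)))) (ring₂ (h zero) (t zero))
  head (no t≮h) = cong (λ k → + k + 0ℤ) (≤0⇒pos (h zero - t zero) (ℤₚ.i≤j⇒i-j≤0 (ℤₚ.≮⇒≥ t≮h)))

-- Vertices of alcoves and dominance

V : ∀ {n} → ℤ → Window n → Window n
V {n} j g p = fl n (g p + j)

-- Dominance of all vertices of the alcoves with windows gs and y.
record Dom {n : ℕ} (gs y : Window n) : Set where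
  constructor dom
  field dominates : ∀ j k → k ℕ.≤ suc n → psum k (V j gs) ≤ psum k (V j y)
open Dom

V-decreasing : ∀ {n} {g : Window n} → Decreasing g → ∀ j → Decreasing (V j g)
V-decreasing {n} dec j p q p≤q = fl-mono n (ℤₚ.+-monoˡ-≤ j (dec p q p≤q))

Φ-excess : ∀ {n} (g : Window n) j j' → Φ g j j' ≡ excess (V j g) (V j' (ι {n}))
Φ-excess g j j' = Φ≡ g j j'

excess-congʳ : ∀ {m} (h : Fin m → ℤ) {t t' : Fin m → ℤ} → (∀ p → t p ≡ t' p) → excess h t ≡ excess h t'
excess-congʳ h eq = ℕΣ.sum-cong-≗ λ p → cong (λ z → pos (h p - z)) (eq p)

-- To bound the sum of the first k entries, take as constant threshold T the k-th entry of the
-- vertex of `y`. That vertex is decreasing, so its excess over T equals its k-th partial sum minus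
-- kT, while for any rearrangement of `x` the excess is an upper bound for this difference.
⊑⇒Dom : ∀ {n} {x y : Window n} (π : Permutation (suc n) (suc n)) → Decreasing y → x ⊑ y → Dom (λ p → x (π ⟨$⟩ʳ p)) y
⊑⇒Dom {n} {x} {y} π dec x⊑y = dom go
  where
  gs : Window n
  gs p = x (π ⟨$⟩ʳ p)
  at : ∀ j (p : Fin (suc n)) → psum (suc (toℕ p)) (V j gs) ≤ psum (suc (toℕ p)) (V j y)
  at j p = ℤₚ.≤-trans (psum≤excess k (V j gs) (λ _ → T)) (ℤₚ.≤-trans (ℤₚ.+-monoˡ-≤ (psum {suc n} k (λ _ → T)) (ℤ.+≤+ le))
    (ℤₚ.≤-reflexive (excess-sorted k (V j y) (λ _ → T)
      (λ q q<k → V-decreasing {g = y} dec j q p (ℕₚ.≤-pred q<k)) (λ q k≤q → V-decreasing {g = y} dec j p q (ℕₚ.<⇒≤ k≤q)))))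
    where
    k : ℕ
    k = suc (toℕ p)
    T : ℤ
    T = V j y p
    flat : ∀ q → V {n} (T * N n) ι q ≡ T
    flat q = trans (fl-shift n (ι q) T) (trans (cong (_+ T) (fl-ι q)) (ℤₚ.+-identityˡ T))
    level : ∀ g → Φ g j (T * N n) ≡ excess (V j g) (λ _ → T)
    level g = trans (Φ-excess g j (T * N n)) (excess-congʳ (V j g) flat)
    le : excess (V j gs) (λ _ → T) ℕ.≤ excess (V j y) (λ _ → T)
    le = subst₂ ℕ._≤_ (trans (level x) (ℕΣ.sum-permute (λ p → pos (V j x p - T)) π)) (level y) (x⊑y j (T * N n))
  go : ∀ j k → k ℕ.≤ suc n → psum k (V j gs) ≤ psum k (V j y)
  go j zero _ = ℤₚ.≤-refl
  go j (suc k) k<N = subst (λ k → psum (suc k) (V j gs) ≤ psum (suc k) (V j y)) (Finₚ.toℕ-fromℕ< k<N) (at j (fromℕ< k<N))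

-- The excess of `x` over the threshold `t` is the sum of V_j(x) - t over the set P where it is
-- positive, with c elements. The sum of V_j(x) over P is at most the sum of its c largest entries,
-- which dominance compares with `y`; and as `t` increases, its first c entries have the smallest
-- sum.
Dom⇒⊑ : ∀ {n} {x y : Window n} (π : Permutation (suc n) (suc n)) → Decreasing (λ p → x (π ⟨$⟩ʳ p)) → Dom (λ p → x (π ⟨$⟩ʳ p)) y → x ⊑ y
Dom⇒⊑ {n} {x} {y} π dec d j j' = subst₂ ℕ._≤_ (sym (Φ-excess x j j')) (sym (Φ-excess y j j')) (ℤₚ.drop‿+≤+
  (lin≤ (gap≡ (excess-subsum (V j x) t) ⊕ gap sub ⊕ gap (dominates d j c (count≤ P)) ⊕ gap (psum≤excess c (V j y) t) ⊕ gap (psum≤subsum P t inc))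
    (ring (+ excess (V j y) t) (+ excess (V j x) t) (subsum P t) (subsum P (V j x)) (psum c (V j gs)) (psum c (V j y)) (psum c t))))
  where
  gs t : Window n
  gs p = x (π ⟨$⟩ʳ p)
  t = V j' ι
  P : Fin (suc n) → Bool
  P p = does (t p ℤₚ.<? V j x p)
  c : ℕ
  c = count P
  inc : ∀ p q → p Fin.≤ q → t p ≤ t q
  inc p q p≤q = fl-mono n (ℤₚ.+-monoˡ-≤ j' (ℤ.+≤+ p≤q))
  sub : subsum P (V j x) ≤ psum c (V j gs)
  sub = subst₂ (λ a b → a ≤ psum b (V j gs)) (sym (ℤΣ.sum-permute (λ p → if P p then V j x p else 0ℤ) π)) (sym (ℕΣ.sum-permute (λ p → if P p then 1 else 0) π))
    (subsum≤psum (λ p → P (π ⟨$⟩ʳ p)) (V j gs) (V-decreasing {g = gs} dec j))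
  ring : ∀ ey ex St Sx G Y T → ey - ex ≡ Sx - (ex + St) + (G - Sx) + (Y - G) + (ey + T - Y) + (St - T)
  ring = solve-∀

private
  bit≤ : ∀ b c → (b ≡ true → c ≡ true) → (if b then 1 else 0) ℕ.≤ (if c then 1 else 0)
  bit≤ false c h = z≤n
  bit≤ true c h = ℕₚ.≤-reflexive (cong (λ c → if c then 1 else 0) (sym (h refl)))

count-mono : ∀ {m} (P Q : Fin m → Bool) → (∀ p → P p ≡ true → Q p ≡ true) → count P ℕ.≤ count Q
count-mono {zero} P Q sub = z≤n
count-mono {suc m} P Q sub = ℕₚ.+-mono-≤ (bit≤ (P zero) (Q zero) (sub zero)) (count-mono (P ∘ suc) (Q ∘ suc) (sub ∘ suc))

count-< : ∀ {m} (P Q : Fin m → Bool) → (∀ p → P p ≡ true → Q p ≡ true) → ∀ q → P q ≡ false → Q q ≡ true → count P ℕ.< count Q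
count-< P Q sub zero Pq Qq = ℕₚ.+-mono-<-≤ (subst₂ (λ b c → (if b then 1 else 0) ℕ.< (if c then 1 else 0)) (sym Pq) (sym Qq) (s≤s z≤n))
  (count-mono (P ∘ suc) (Q ∘ suc) (sub ∘ suc))
count-< P Q sub (suc q) Pq Qq = ℕₚ.+-mono-≤-< (bit≤ (P zero) (Q zero) (sub zero)) (count-< (P ∘ suc) (Q ∘ suc) (sub ∘ suc) q Pq Qq)

count-true : ∀ m → count {m} (λ _ → true) ≡ m
count-true zero = refl
count-true (suc m) = cong suc (count-true m)

module Ranking {n : ℕ} (g : Window n) where

  above : Fin (suc n) → Fin (suc n) → Bool
  above p q = does (g p ℤₚ.<? g q)

  above-true : ∀ {p q} → above p q ≡ true → g p < g q
  above-true {p} {q} eq with g p ℤₚ.<? g q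
  ... | yes lt = lt
  ... | no _ = contradiction eq λ ()

  rank< : ∀ p → count (above p) ℕ.< suc n
  rank< p = subst (count (above p) ℕ.<_) (count-true (suc n))
    (count-< (above p) (λ _ → true) (λ _ _ → refl) p (dec-false (g p ℤₚ.<? g p) (ℤₚ.<-irrefl refl)) refl)

  -- Counting the larger entries gives the largest one rank 0. The ranks thus yield the decreasing
  -- rearrangement and record the W_f-chamber of the window.
  rank : Fin (suc n) → Fin (suc n)
  rank p = fromℕ< (rank< p)

  toℕ-rank : ∀ p → toℕ (rank p) ≡ count (above p)
  toℕ-rank p = Finₚ.toℕ-fromℕ< (rank< p)

  rank-anti : ∀ {p q} → g p < g q → rank q Fin.< rank p
  rank-anti {p} {q} lt = subst₂ ℕ._<_ (sym (toℕ-rank q)) (sym (toℕ-rank p))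
    (count-< (above q) (above p) (λ i e → dec-true (g p ℤₚ.<? g i) (ℤₚ.<-trans lt (above-true {q} {i} e))) q
      (dec-false (g q ℤₚ.<? g q) (ℤₚ.<-irrefl refl)) (dec-true (g p ℤₚ.<? g q) lt))

  module _ (inj : ∀ {p q} → g p ≡ g q → p ≡ q) where

    rank-injective : ∀ {p q} → rank p ≡ rank q → p ≡ q
    rank-injective {p} {q} eq with ℤₚ.<-cmp (g p) (g q)
    ... | tri< lt _ _ = ⊥-elim (ℕₚ.<⇒≢ (rank-anti lt) (cong toℕ (sym eq)))
    ... | tri≈ _ e _ = inj e
    ... | tri> _ _ gt = ⊥-elim (ℕₚ.<⇒≢ (rank-anti gt) (cong toℕ eq))

    opaque
      rankπ : Permutation (suc n) (suc n)
      rankπ = proj₁ (injective⇒permutation rank rank-injective)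

      rankπ≡ : ∀ p → rankπ ⟨$⟩ʳ p ≡ rank p
      rankπ≡ = proj₂ (injective⇒permutation rank rank-injective)

    sorted : Window n
    sorted s = g (rankπ ⟨$⟩ˡ s)

    sorted-rank : ∀ p → sorted (rank p) ≡ g p
    sorted-rank p = cong g (trans (cong (rankπ ⟨$⟩ˡ_) (sym (rankπ≡ p))) (Perm.inverseˡ rankπ))

    rank-unsorted : ∀ s → rank (rankπ ⟨$⟩ˡ s) ≡ s
    rank-unsorted s = trans (sym (rankπ≡ (rankπ ⟨$⟩ˡ s))) (Perm.inverseʳ rankπ)

    sorted-strict : ∀ {s s'} → s Fin.< s' → sorted s' < sorted s
    sorted-strict {s} {s'} s<s' with ℤₚ.<-cmp (sorted s') (sorted s)
    ... | tri< lt _ _ = lt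
    ... | tri≈ _ e _ = ⊥-elim (ℕₚ.<⇒≢ s<s' (cong toℕ (trans (sym (rank-unsorted s)) (trans (cong rank (sym (inj e))) (rank-unsorted s')))))
    ... | tri> _ _ gt = ⊥-elim (ℕₚ.<-asym s<s' (subst₂ Fin._<_ (rank-unsorted s') (rank-unsorted s) (rank-anti gt)))

open Ranking using (rank)

strict⇒decreasing : ∀ {m} {h : Fin m → ℤ} → (∀ {p q} → p Fin.< q → h q < h p) → Decreasing h
strict⇒decreasing strict p q p≤q with p Fin.≟ q
... | yes refl = ℤₚ.≤-refl
... | no p≢q = ℤₚ.<⇒≤ (strict (ℕₚ.≤∧≢⇒< p≤q (p≢q ∘ Finₚ.toℕ-injective)))

rank-cong : ∀ {n} (g g' : Window n) → (∀ p q → g p < g q → g' p < g' q) → (∀ p q → g' p < g' q → g p < g q) → ∀ p → rank g p ≡ rank g' p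
rank-cong g g' f b p = Finₚ.toℕ-injective (trans (Ranking.toℕ-rank g p) (trans (ℕΣ.sum-cong-≗ λ q → cong (λ b → if b then 1 else 0) (same q)) (sym (Ranking.toℕ-rank g' p))))
  where
  same : ∀ q → does (g p ℤₚ.<? g q) ≡ does (g' p ℤₚ.<? g' q)
  same q with g p ℤₚ.<? g q
  ... | yes lt = sym (dec-true (g' p ℤₚ.<? g' q) (f p q lt))
  ... | no nlt = sym (dec-false (g' p ℤₚ.<? g' q) (nlt ∘ b p q))

rank-sorted : ∀ {n} (g : Window n) → (∀ {p q} → p Fin.< q → g q < g p) → ∀ p → rank g p ≡ p
rank-sorted {n} g strict p = Finₚ.toℕ-injective (trans (Ranking.toℕ-rank g p) (trans (ℕΣ.sum-cong-≗ λ q → cong (λ b → if b then 1 else 0) (same q)) (count-below p)))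
  where
  same : ∀ (q : Fin (suc n)) → does (g p ℤₚ.<? g q) ≡ (toℕ q ℕ.<ᵇ toℕ p)
  same q with Finₚ.<-cmp q p
  ... | tri< lt _ _ = trans (dec-true (g p ℤₚ.<? g q) (strict lt)) (sym (dec-true (toℕ q ℕₚ.<? toℕ p) lt))
  ... | tri≈ nlt refl _ = trans (dec-false (g p ℤₚ.<? g q) (ℤₚ.<-irrefl refl)) (sym (dec-false (toℕ q ℕₚ.<? toℕ p) nlt))
  ... | tri> nlt _ gt = trans (dec-false (g p ℤₚ.<? g q) (ℤₚ.<-asym (strict gt))) (sym (dec-false (toℕ q ℕₚ.<? toℕ p) nlt))
  count-below : ∀ {m} (p : Fin m) → count (λ (q : Fin m) → toℕ q ℕ.<ᵇ toℕ p) ≡ toℕ p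
  count-below {suc m} zero = ℕΣ.sum-replicate-zero (suc m)
  count-below {suc m} (suc p) = cong suc (count-below {m} p)

-- Translating dominance between weights of one zone

adjacent⇒strict : ∀ {n} (h : Window n) → (∀ r → h (suc r) < h (inject₁ r)) → ∀ {p q} → p Fin.< q → h q < h p
adjacent⇒strict {n} h adj {p} {q} = <-weakInduction (λ q → ∀ p → p Fin.< q → h q < h p) (λ p ()) next q p
  where
  next : ∀ i → (∀ p → p Fin.< inject₁ i → h (inject₁ i) < h p) → ∀ p → p Fin.< suc i → h (suc i) < h p
  next i ih p (s≤s p≤i) with p Fin.≟ inject₁ i
  ... | yes refl = adj i
  ... | no p≢i = ℤₚ.<-trans (adj i) (ih p (ℕₚ.≤∧≢⇒< (subst (toℕ p ℕ.≤_) (sym (Finₚ.toℕ-inject₁ i)) p≤i) (p≢i ∘ Finₚ.toℕ-injective)))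

prev : (ℕ → ℕ) → ℕ → ℕ
prev e zero = 0
prev e (suc k) = e k

-- Coordinates of Σ_r e_r α_r.
rootsum : ∀ {m} → (ℕ → ℕ) → Fin m → ℤ
rootsum e p = + e (toℕ p) - + prev e (toℕ p)

telescope : ∀ {m} k (F : ℕ → ℤ) → k ℕ.≤ m → psum {m} k (λ p → F (suc (toℕ p)) - F (toℕ p)) ≡ F k - F 0
telescope zero F _ = sym (ℤₚ.+-inverseʳ (F 0))
telescope {suc m} (suc k) F (s≤s k≤m) = trans (cong (λ z → F 1 - F 0 + z) (telescope k (F ∘ suc) k≤m)) (ring (F 0) (F 1) (F (suc k)))
  where
  ring : ∀ a b c → b - a + (c - b) ≡ c - a
  ring = solve-∀

psum-rootsum : ∀ {m} e k → k ℕ.≤ m → psum {m} k (rootsum e) ≡ + prev e k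
psum-rootsum e k k≤m = trans (telescope k (λ l → + prev e l) k≤m) (ℤₚ.+-identityʳ (+ prev e k))

segment : ℕ → ℕ → ℕ → ℕ
segment i k l = if does ((i ℕₚ.≤? l) ×-dec (l ℕₚ.≤? k)) then 1 else 0

segment-in : ∀ {i k l} → i ℕ.≤ l → l ℕ.≤ k → segment i k l ≡ 1
segment-in {i} {k} {l} a b = cong (λ d → if d then 1 else 0) (dec-true ((i ℕₚ.≤? l) ×-dec (l ℕₚ.≤? k)) (a , b))

segment-out : ∀ {i k l} → ¬ (i ℕ.≤ l × l ℕ.≤ k) → segment i k l ≡ 0
segment-out {i} {k} {l} h = cong (λ d → if d then 1 else 0) (dec-false ((i ℕₚ.≤? l) ×-dec (l ℕₚ.≤? k)) h)

lowered : ∀ {n} → (ℕ → ℕ) → Window n → Window n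
lowered {n} e y p = y p - rootsum e p * N n

V-translate : ∀ {n} (g : Window n) (v : Window n) c j p → V j (λ p → g p + (v p * N n + c)) p ≡ V (c + j) g p + v p
V-translate {n} g v c j p = trans (cong (fl n) (ring (g p) (v p * N n) c j)) (fl-shift n (g p + (c + j)) (v p))
  where
  ring : ∀ g v c j → g + (v + c) + j ≡ g + (c + j) + v
  ring = solve-∀

Dom-cong : ∀ {n} {g g' y y' : Window n} → (∀ p → g p ≡ g' p) → (∀ p → y p ≡ y' p) → Dom g y → Dom g' y'
Dom-cong {n} hg hy d = dom λ j k k≤ → subst₂ _≤_ (psum-cong k (λ p → cong (λ z → fl n (z + j)) (hg p))) (psum-cong k (λ p → cong (λ z → fl n (z + j)) (hy p))) (dominates d j k k≤)

-- The constant `c` is the common residue of a multiple Nλ of a weight that need not have integral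
-- coordinates. It only renumbers the levels, and `Dom` ranges over all of them.
Dom-translate : ∀ {n} {g y : Window n} (v : Window n) c → Dom g y → Dom (λ p → g p + (v p * N n + c)) (λ p → y p + (v p * N n + c))
Dom-translate {n} {g} {y} v c d = dom λ j k k≤ → subst₂ _≤_ (sym (split g j k)) (sym (split y j k)) (ℤₚ.+-monoˡ-≤ (psum k v) (dominates d (c + j) k k≤))
  where
  split : ∀ (g : Window n) j k → psum k (V j (λ p → g p + (v p * N n + c))) ≡ psum k (V (c + j) g) + psum k v
  split g j k = trans (psum-cong k (V-translate g v c j)) (psum-+ k (V (c + j) g) v)

-- The partial sums of Σ e_r α_r telescope: the k-th one is the coefficient of the k-th simple root
-- alone, with `prev` absorbing the shift of indices.
psum-lowered : ∀ {n} e (y : Window n) j k → k ℕ.≤ suc n → psum k (V j (lowered e y)) ≡ psum k (V j y) - + prev e k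
psum-lowered {n} e y j k k≤ = trans (psum-cong k V-lowered) (trans (psum-+ k (V j y) (λ p → - rootsum e p))
  (cong (λ z → psum k (V j y) + z) (trans (psum-neg k (rootsum {suc n} e)) (cong -_ (psum-rootsum e k k≤)))))
  where
  ring₁ : ∀ y r N j → y - r * N + j ≡ y + j + - r * N
  ring₁ = solve-∀
  V-lowered : ∀ p → V j (lowered e y) p ≡ V j y p + - rootsum e p
  V-lowered p = trans (cong (fl n) (ring₁ (y p) (rootsum e p) (N n) j)) (fl-shift n (y p + j) (- rootsum e p))

record Pairing {n : ℕ} (z : Window n) (m : ℕ → ℕ) : Set where
  constructor pairing
  field paired : ∀ (r : Fin n) → z (inject₁ r) ≡ z (suc r) + + m (toℕ r) * N n
open Pairing

-- Either a single pairing ≥ 2, or pairings 1, 0, …, 0, 1 along i, …, k: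
-- the α_i + … + α_k by which λ exceeds the dominant weights it covers.
Pattern : (ℕ → ℕ) → ℕ → ℕ → Set
Pattern m i k = (i ≡ k × 2 ℕ.≤ m i) ⊎ (i ℕ.< k × m i ≡ 1 × m k ≡ 1 × (∀ l → i ℕ.< l → l ℕ.< k → m l ≡ 0))

SameZone : (ℕ → ℕ) → (ℕ → ℕ) → Set
SameZone m m' = ∀ l → m l ≡ m' l ⊎ (2 ℕ.≤ m l × 2 ℕ.≤ m' l)

SameZone-sym : ∀ {m m'} → SameZone m m' → SameZone m' m
SameZone-sym h l with h l
... | inj₁ e = inj₁ (sym e)
... | inj₂ (a , b) = inj₂ (b , a)

Pattern-zone : ∀ {m m'} → SameZone m m' → ∀ {i k} → Pattern m i k → Pattern m' i k
Pattern-zone {m} {m'} h {i} {k} (inj₁ (i≡k , 2≤)) with h i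
... | inj₁ e = inj₁ (i≡k , subst (2 ℕ.≤_) e 2≤)
... | inj₂ (_ , 2≤') = inj₁ (i≡k , 2≤')
Pattern-zone {m} {m'} h {i} {k} (inj₂ (i<k , mi , mk , mid)) =
  inj₂ (i<k , small i 1 (ℕₚ.≤-refl) mi , small k 1 (ℕₚ.≤-refl) mk , λ l il lk → small l 0 z≤n (mid l il lk))
  where
  small : ∀ l c → c ℕ.≤ 1 → m l ≡ c → m' l ≡ c
  small l c c≤1 ml with h l
  ... | inj₁ e = trans (sym e) ml
  ... | inj₂ (2≤ , _) = ⊥-elim (ℕₚ.1+n≰n (ℕₚ.≤-trans 2≤ (ℕₚ.≤-trans (ℕₚ.≤-reflexive ml) c≤1)))

record Boat {n : ℕ} (gs y : Window n) (m : ℕ → ℕ) : Set where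
  constructor boat
  field
    inside  : Dom gs y
    outside : ∀ i k → Pattern m i k → ¬ Dom gs (lowered (segment i k) y)
open Boat

-- If ⟨λ,α_r⟩ ≥ 2 and x lies below λ but not below λ - α_r, then some vertex of x is tight in the r-th
-- partial sum, which forces x far from the wall of α_r.
boat-gap : ∀ {n} {b z gs : Window n} {m} → Decreasing b → Pairing z m → Boat gs (λ p → b p + z p) m →
  ∀ r → 2 ℕ.≤ m (toℕ r) → gs (suc r) + (+ m (toℕ r) - 1ℤ) * N n < gs (inject₁ r)
boat-gap {n} {b} {z} {gs} {m} dec pair (boat ins out) r 2≤m = ℤₚ.≰⇒> λ small → out R R (inj₁ (refl , 2≤m)) (dom (below small))
  where
  R : ℕ
  R = toℕ r
  M : ℤ
  M = + m R
  y : Window n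
  y p = b p + z p
  e : ℕ → ℕ
  e = segment R R
  R<n : suc R ℕ.≤ n
  R<n = Finₚ.toℕ<n r
  suc₁ : ∀ (h : Window n) → psum (suc R) h ≡ psum R h + h (inject₁ r)
  suc₁ h = subst (λ k → psum (suc k) h ≡ psum k h + h (inject₁ r)) (Finₚ.toℕ-inject₁ r) (psum-suc h (inject₁ r))
  suc₂ : ∀ (h : Window n) → psum (suc (suc R)) h ≡ psum (suc R) h + h (suc r)
  suc₂ h = psum-suc h (suc r)
  ring₂ : ∀ b b' z M N j → b + (z + M * N) + j - (b' + z + j + M * N) ≡ b - b'
  ring₂ = solve-∀
  y-gap : ∀ j → V j y (suc r) + M ≤ V j y (inject₁ r)
  y-gap j = subst (_≤ V j y (inject₁ r)) (fl-shift n (y (suc r) + j) M) (fl-mono n (lin≤ (gap (dec (inject₁ r) (suc r) (subst (ℕ._≤ suc R) (sym (Finₚ.toℕ-inject₁ r)) (ℕₚ.n≤1+n R))))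
    (trans (cong (λ w → b (inject₁ r) + w + j - (y (suc r) + j + M * N n)) (paired pair r)) (ring₂ (b (inject₁ r)) (b (suc r)) (z (suc r)) M (N n) j))))
  module _ (small : gs (inject₁ r) ≤ gs (suc r) + (M - 1ℤ) * N n) where
    ring₁ : ∀ g x j → g + x + j ≡ g + j + x
    ring₁ = solve-∀
    gs-gap : ∀ j → V j gs (inject₁ r) ≤ V j gs (suc r) + (M - 1ℤ)
    gs-gap j = subst (V j gs (inject₁ r) ≤_) (trans (cong (fl n) (ring₁ (gs (suc r)) ((M - 1ℤ) * N n) j)) (fl-shift n (gs (suc r) + j) (M - 1ℤ))) (fl-mono n (ℤₚ.+-monoˡ-≤ j small))
    at : ∀ j → psum (suc R) (V j gs) ≤ psum (suc R) (V j y) - 1ℤ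
    at j = lin≤ (gap< (ℤₚ.≰⇒> contra)) (ring₃ (psum (suc R) (V j y)) (psum (suc R) (V j gs)))
      where
      ring₃ : ∀ a b → a - 1ℤ - b ≡ a - (1ℤ + b)
      ring₃ = solve-∀
      ring₄ : ∀ A a a' B β β' M → (A + a - (B + β)) + (A + a - (B + β)) + (B - A) + (B + β + β' - (A + a + a')) + (β - (β' + M)) + (a' + (M - 1ℤ) - a) ≡ -1ℤ
      ring₄ = solve-∀
      contra : ¬ psum (suc R) (V j y) ≤ psum (suc R) (V j gs)
      -- Tightness at R + 1, used twice as the middle term of a second difference, combines with A ≤
      -- B and A + a + a' ≤ B + β + β' to give a - a' ≥ β - β' ≥ M. But `gs-gap` says a - a' ≤ M -
      -- 1.
      contra h = lin⊥ (gap h' ⊕ gap h' ⊕ gap (dominates ins j R (ℕₚ.<⇒≤ (ℕₚ.m≤n⇒m≤1+n R<n)))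
          ⊕ gap (subst₂ _≤_ (trans (suc₂ (V j gs)) (cong (_+ V j gs (suc r)) (suc₁ (V j gs)))) (trans (suc₂ (V j y)) (cong (_+ V j y (suc r)) (suc₁ (V j y)))) (dominates ins j (suc (suc R)) (s≤s R<n)))
          ⊕ gap (y-gap j) ⊕ gap (gs-gap j))
        (ring₄ (psum R (V j gs)) (V j gs (inject₁ r)) (V j gs (suc r)) (psum R (V j y)) (V j y (inject₁ r)) (V j y (suc r)) M)
        where
        h' : psum R (V j y) + V j y (inject₁ r) ≤ psum R (V j gs) + V j gs (inject₁ r)
        h' = subst₂ _≤_ (suc₁ (V j y)) (suc₁ (V j gs)) h
    below : ∀ j k → k ℕ.≤ suc n → psum k (V j gs) ≤ psum k (V j (lowered e y))
    below j k k≤ = subst (psum k (V j gs) ≤_) (sym (psum-lowered e y j k k≤)) (split k k≤)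
      where
      zero-case : ∀ k → k ℕ.≤ suc n → prev e k ≡ 0 → psum k (V j gs) ≤ psum k (V j y) - + prev e k
      zero-case k k≤ eq = subst (λ c → psum k (V j gs) ≤ psum k (V j y) - + c) (sym eq)
        (subst (psum k (V j gs) ≤_) (sym (ℤₚ.+-identityʳ (psum k (V j y)))) (dominates ins j k k≤))
      split : ∀ k → k ℕ.≤ suc n → psum k (V j gs) ≤ psum k (V j y) - + prev e k
      split zero k≤ = zero-case zero k≤ refl
      split (suc k) k≤ with k ℕₚ.≟ R
      ... | yes refl = subst (λ c → psum (suc R) (V j gs) ≤ psum (suc R) (V j y) - + c) (sym (segment-in {R} {R} {R} ℕₚ.≤-refl ℕₚ.≤-refl)) (at j)
      ... | no k≢R = zero-case (suc k) k≤ (segment-out {R} {R} {k} λ (a , b) → k≢R (ℕₚ.≤-antisym b a))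

module _ {n : ℕ} {z z' : Window n} {m m' : ℕ → ℕ} (pair : Pairing z m) (pair' : Pairing z' m') where
  private
    v : Window n
    v p = z' p - z p
    c : ℤ
    c = v zero
    v-step : ∀ r → v (inject₁ r) ≡ v (suc r) + (+ m' (toℕ r) - + m (toℕ r)) * N n
    v-step r = trans (cong₂ _-_ (paired pair' r) (paired pair r)) (ring (z' (suc r)) (z (suc r)) (+ m' (toℕ r)) (+ m (toℕ r)) (N n))
      where
      ring : ∀ a b x y N → a + x * N - (b + y * N) ≡ a - b + (x - y) * N
      ring = solve-∀
    v-form : ∀ p → ∃ λ q → v p ≡ q * N n + c
    v-form = <-weakInduction (λ p → ∃ λ q → v p ≡ q * N n + c) (0ℤ , ring₀ (N n) c) next
      where
      ring₀ : ∀ N c → c ≡ 0ℤ * N + c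
      ring₀ = solve-∀
      ring₁ : ∀ a x → a ≡ a + x - x
      ring₁ = solve-∀
      ring₂ : ∀ q N c x → q * N + c - x * N ≡ (q - x) * N + c
      ring₂ = solve-∀
      next : ∀ r → (∃ λ q → v (inject₁ r) ≡ q * N n + c) → ∃ λ q → v (suc r) ≡ q * N n + c
      next r (q , eq) = q - x , trans (ring₁ (v (suc r)) (x * N n)) (trans (cong (_- x * N n) (trans (sym (v-step r)) eq)) (ring₂ q (N n) c x))
        where
        x : ℤ
        x = + m' (toℕ r) - + m (toℕ r)

  Dom-weight : ∀ {g y : Window n} → Dom g y → Dom (λ p → g p + (z' p - z p)) (λ p → y p + (z' p - z p))
  Dom-weight {g} {y} d = Dom-cong (λ p → cong (λ w → g p + w) (sym (proj₂ (v-form p)))) (λ p → cong (λ w → y p + w) (sym (proj₂ (v-form p)))) (Dom-translate (λ p → proj₁ (v-form p)) c d)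

module _ {n : ℕ} {b z z' gs : Window n} {m m' : ℕ → ℕ} (pair : Pairing z m) (pair' : Pairing z' m') (zone : SameZone m m')
         (dec : Decreasing b) (strict : ∀ {p q} → p Fin.< q → gs q < gs p) (bt : Boat gs (λ p → b p + z p) m) where

  translated-strict : ∀ {p q} → p Fin.< q → gs q + (z' q - z q) < gs p + (z' p - z p)
  translated-strict = adjacent⇒strict (λ p → gs p + (z' p - z p)) λ r → lin<-step r (zone (toℕ r))
    where
    ring₁ : ∀ g h a b x N → h + (a + x * N - (b + x * N)) - (1ℤ + (g + (a - b))) ≡ h - (1ℤ + g)
    ring₁ = solve-∀
    ring₂ : ∀ g h a b x y N → h + (a + x * N - (b + y * N)) - (1ℤ + (g + (a - b))) ≡ h - (1ℤ + (g + (y - 1ℤ) * N)) + (x - 1ℤ) * N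
    ring₂ = solve-∀
    0≤xN : ∀ k → 2 ℕ.≤ k → 0ℤ ≤ (+ k - 1ℤ) * N n
    0≤xN (suc k) _ = 0≤*N n k
    lin<-step : ∀ r → m (toℕ r) ≡ m' (toℕ r) ⊎ (2 ℕ.≤ m (toℕ r) × 2 ℕ.≤ m' (toℕ r)) → gs (suc r) + (z' (suc r) - z (suc r)) < gs (inject₁ r) + (z' (inject₁ r) - z (inject₁ r))
    lin<-step r (inj₁ eq) = lin< (gap< (strict {inject₁ r} {suc r} (s≤s (ℕₚ.≤-reflexive (Finₚ.toℕ-inject₁ r)))))
      (trans (cong₂ (λ a b → gs (inject₁ r) + (a - b) - (1ℤ + (gs (suc r) + (z' (suc r) - z (suc r))))) (paired pair' r) (trans (paired pair r) (cong (λ k → z (suc r) + + k * N n) eq)))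
        (ring₁ (gs (suc r)) (gs (inject₁ r)) (z' (suc r)) (z (suc r)) (+ m' (toℕ r)) (N n)))
    -- By `boat-gap` the gap exceeds (m - 1)N. The translation adds (m' - m)N, so more than (m' -
    -- 1)N ≥ 0 is left.
    lin<-step r (inj₂ (2≤ , 2≤')) = lin< (gap< (boat-gap dec pair bt r 2≤) ⊕ 0≤xN (m' (toℕ r)) 2≤')
      (trans (cong₂ (λ a b → gs (inject₁ r) + (a - b) - (1ℤ + (gs (suc r) + (z' (suc r) - z (suc r))))) (paired pair' r) (paired pair r))
        (ring₂ (gs (suc r)) (gs (inject₁ r)) (z' (suc r)) (z (suc r)) (+ m' (toℕ r)) (+ m (toℕ r)) (N n)))

  -- Both windows receive the same weight, so dominance holds before the translation exactly when it
  -- holds afterwards. The excluded lower weights match because the two zones have the same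
  -- patterns; non-dominance is obtained by translating back.
  translated-boat : Boat (λ p → gs p + (z' p - z p)) (λ p → b p + z' p) m'
  translated-boat = boat
    (Dom-cong (λ p → refl) (λ p → ring₁ (b p) (z p) (z' p)) (Dom-weight pair pair' (inside bt)))
    (λ i k pat d → outside bt i k (Pattern-zone (SameZone-sym zone) pat)
      (Dom-cong (λ p → ring₂ (gs p) (z p) (z' p)) (λ p → ring₃ (b p) (z p) (z' p) (rootsum (segment i k) p * N n)) (Dom-weight pair' pair d)))
    where
    ring₁ : ∀ b z z' → b + z + (z' - z) ≡ b + z'
    ring₁ = solve-∀
    ring₂ : ∀ g z z' → g + (z' - z) + (z - z') ≡ g
    ring₂ = solve-∀
    ring₃ : ∀ b z z' x → b + z' - x + (z - z') ≡ b + z - x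
    ring₃ = solve-∀

-- Rational arithmetic

ℚring : AlmostCommutativeRing 0ℓ 0ℓ
ℚring = fromCommutativeRing ℚₚ.+-*-commutativeRing isZero
  where
  isZero : ∀ x → Maybe (0ℚ ≡ x)
  isZero x with 0ℚ ℚₚ.≟ x
  ... | yes eq = just eq
  ... | no _ = nothing

opaque
  ⟦_⟧ : ℤ → ℚ
  ⟦ k ⟧ = ℤ→ℚ k

  ⟦⟧≡ : ∀ k → ⟦ k ⟧ ≡ ℤ→ℚ k
  ⟦⟧≡ k = refl

  private
    frac : ∀ k → ℚ.toℚᵘ ⟦ k ⟧ ℚᵘ.≃ ℚᵘ.mkℚᵘ k 0
    frac k = ℚₚ.toℚᵘ-fromℚᵘ (ℚᵘ.mkℚᵘ k 0)

  ⟦⟧-+ : ∀ a b → ⟦ a + b ⟧ ≡ ⟦ a ⟧ ℚ.+ ⟦ b ⟧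
  ⟦⟧-+ a b = ℚₚ.toℚᵘ-injective (ℚᵘₚ.≃-trans (frac (a + b)) (ℚᵘₚ.≃-sym (ℚᵘₚ.≃-trans (ℚₚ.toℚᵘ-homo-+ ⟦ a ⟧ ⟦ b ⟧)
    (ℚᵘₚ.≃-trans (ℚᵘₚ.+-cong (frac a) (frac b)) (ℚᵘ.*≡* (ring a b))))))
    where
    ring : ∀ a b → (a * 1ℤ + b * 1ℤ) * 1ℤ ≡ (a + b) * (1ℤ * 1ℤ)
    ring = solve-∀

  ⟦⟧-neg : ∀ a → ⟦ - a ⟧ ≡ ℚ.- ⟦ a ⟧
  ⟦⟧-neg a = ℚₚ.toℚᵘ-injective (ℚᵘₚ.≃-trans (frac (- a)) (ℚᵘₚ.≃-sym (ℚᵘₚ.≃-trans (ℚₚ.toℚᵘ-homo‿- ⟦ a ⟧)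
    (ℚᵘₚ.-‿cong (frac a)))))

  ⟦⟧-mono-< : ∀ {a b} → a < b → ⟦ a ⟧ ℚ.< ⟦ b ⟧
  ⟦⟧-mono-< {a} {b} a<b = ℚₚ.toℚᵘ-cancel-< (ℚᵘₚ.<-respˡ-≃ (ℚᵘₚ.≃-sym (frac a)) (ℚᵘₚ.<-respʳ-≃ (ℚᵘₚ.≃-sym (frac b))
    (ℚᵘ.*<* (subst₂ _<_ (sym (ℤₚ.*-identityʳ a)) (sym (ℤₚ.*-identityʳ b)) a<b))))

  ⟦⟧-0 : ⟦ 0ℤ ⟧ ≡ 0ℚ
  ⟦⟧-0 = refl

  ⟦⟧-1 : ⟦ 1ℤ ⟧ ≡ 1ℚ
  ⟦⟧-1 = refl

⟦⟧-minus : ∀ a b → ⟦ a - b ⟧ ≡ ⟦ a ⟧ ℚ.- ⟦ b ⟧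
⟦⟧-minus a b = trans (⟦⟧-+ a (- b)) (cong (λ z → ⟦ a ⟧ ℚ.+ z) (⟦⟧-neg b))

⟦⟧-mono-≤ : ∀ {a b} → a ≤ b → ⟦ a ⟧ ℚ.≤ ⟦ b ⟧
⟦⟧-mono-≤ {a} {b} a≤b with ℤₚ.<-cmp a b
... | tri< lt _ _ = ℚₚ.<⇒≤ (⟦⟧-mono-< lt)
... | tri≈ _ refl _ = ℚₚ.≤-refl
... | tri> _ _ gt = ⊥-elim (ℤₚ.<⇒≱ gt a≤b)

⟦⟧-injective : ∀ {a b} → ⟦ a ⟧ ≡ ⟦ b ⟧ → a ≡ b
⟦⟧-injective {a} {b} eq with ℤₚ.<-cmp a b
... | tri< lt _ _ = ⊥-elim (ℚₚ.<-irrefl eq (⟦⟧-mono-< lt))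
... | tri≈ _ e _ = e
... | tri> _ _ gt = ⊥-elim (ℚₚ.<-irrefl (sym eq) (⟦⟧-mono-< gt))

qgap : ∀ {x y} → x ℚ.< y → 0ℚ ℚ.< y ℚ.- x
qgap {x} {y} h = subst (ℚ._< y ℚ.- x) (ℚₚ.+-inverseʳ x) (ℚₚ.+-monoˡ-< (ℚ.- x) h)

qlin : ∀ {x y e} → 0ℚ ℚ.< e → y ℚ.- x ≡ e → x ℚ.< y
qlin {x} {y} {e} h eq = subst₂ ℚ._<_ (ℚₚ.+-identityˡ x) (ring x y) (ℚₚ.+-monoˡ-< x (subst (0ℚ ℚ.<_) (sym eq) h))
  where
  ring : ∀ x y → y ℚ.- x ℚ.+ x ≡ y
  ring = RS.solve-∀ ℚring

sumℚ≡ : ∀ {m} (f : Fin m → ℚ) → sumℚ f ≡ ℚΣ.sum f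
sumℚ≡ {zero} f = refl
sumℚ≡ {suc m} f = cong (λ z → f zero ℚ.+ z) (sumℚ≡ (f ∘ suc))

sumℚ-cong : ∀ {m} {f f' : Fin m → ℚ} → (∀ p → f p ≡ f' p) → sumℚ f ≡ sumℚ f'
sumℚ-cong {zero} h = refl
sumℚ-cong {suc m} h = cong₂ ℚ._+_ (h zero) (sumℚ-cong (h ∘ suc))

sumℚ-+ : ∀ {m} (f f' : Fin m → ℚ) → sumℚ (λ p → f p ℚ.+ f' p) ≡ sumℚ f ℚ.+ sumℚ f'
sumℚ-+ f f' = trans (sumℚ≡ (λ p → f p ℚ.+ f' p)) (trans (ℚΣ.∑-distrib-+ f f') (cong₂ ℚ._+_ (sym (sumℚ≡ f)) (sym (sumℚ≡ f'))))

sumℚ-⟦⟧ : ∀ {m} (f : Fin m → ℤ) → sumℚ (λ p → ⟦ f p ⟧) ≡ ⟦ ℤΣ.sum f ⟧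
sumℚ-⟦⟧ {zero} f = sym ⟦⟧-0
sumℚ-⟦⟧ {suc m} f = trans (cong (λ z → ⟦ f zero ⟧ ℚ.+ z) (sumℚ-⟦⟧ (f ∘ suc))) (sym (⟦⟧-+ (f zero) (ℤΣ.sum (f ∘ suc))))

sumℚ-permute : ∀ {m} (f : Fin m → ℚ) (π : Permutation m m) → sumℚ (λ p → f (π ⟨$⟩ʳ p)) ≡ sumℚ f
sumℚ-permute f π = trans (sumℚ≡ (λ p → f (π ⟨$⟩ʳ p))) (trans (sym (ℚΣ.sum-permute f π)) (sym (sumℚ≡ f)))

sumℚ-scale : ∀ {m} (f : Fin m → ℚ) c → sumℚ (λ p → f p ℚ.* c) ≡ sumℚ f ℚ.* c
sumℚ-scale {zero} f c = sym (ℚₚ.*-zeroˡ c)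
sumℚ-scale {suc m} f c = trans (cong (λ z → f zero ℚ.* c ℚ.+ z) (sumℚ-scale (f ∘ suc) c)) (sym (ℚₚ.*-distribʳ-+ c (f zero) (sumℚ (f ∘ suc))))

sumℚ-const : ∀ m c → sumℚ {m} (λ _ → c) ≡ ⟦ + m ⟧ ℚ.* c
sumℚ-const zero c = trans (sym (ℚₚ.*-zeroˡ c)) (cong (ℚ._* c) (sym ⟦⟧-0))
sumℚ-const (suc m) c = trans (cong (λ z → c ℚ.+ z) (sumℚ-const m c)) (trans (ring c ⟦ + m ⟧)
  (cong (ℚ._* c) (trans (cong (ℚ._+ ⟦ + m ⟧) (sym ⟦⟧-1)) (sym (⟦⟧-+ 1ℤ (+ m))))))
  where
  ring : ∀ c m → c ℚ.+ m ℚ.* c ≡ (1ℚ ℚ.+ m) ℚ.* c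
  ring = RS.solve-∀ ℚring

-- Alcoves through windows

-- The point lies on the same side of every hyperplane as g/N. This describes the alcove by its
-- window alone, also when `g` is a translate by a weight.
record Alc {n : ℕ} (g : Window n) (x : Pt n) : Set where
  constructor alc
  field
    on-E    : InE x
    ordered : ∀ p q m → g p < g q + m * N n → x p ℚ.< x q ℚ.+ ⟦ m ⟧
open Alc

barycentre : ∀ n → ∃ λ (y : Pt n) → InAid y
barycentre n = y , sum0 , λ i j i<j → lo i j i<j , hi i j i<j
  where
  Nq : ℚ
  Nq = ⟦ + suc n ⟧
  Nq>0 : 0ℚ ℚ.< Nq
  Nq>0 = subst (ℚ._< Nq) ⟦⟧-0 (⟦⟧-mono-< (ℤ.+<+ (s≤s z≤n)))
  instance
    posN : ℚ.Positive Nq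
    posN = ℚ.positive Nq>0
    nzN : ℚ.NonZero Nq
    nzN = ℚₚ.pos⇒nonZero Nq
  u : ℚ
  u = ℚ.1/ Nq
  u>0 : 0ℚ ℚ.< u
  u>0 = ℚₚ.positive⁻¹ u {{ℚₚ.1/pos⇒pos Nq}}
  instance
    posU : ℚ.Positive u
    posU = ℚ.positive u>0
  -- The coordinates i/N, moved into E by subtracting their mean `s`. For i < j the differences (i -
  -- j)/N lie strictly between -1 and 0.
  c : Fin (suc n) → ℚ
  c i = ⟦ ι i ⟧ ℚ.* u
  s : ℚ
  s = sumℚ c ℚ.* u
  y : Pt n
  y i = c i ℚ.+ ℚ.- s
  ring₀ : ∀ S N u → S ℚ.+ N ℚ.* (ℚ.- (S ℚ.* u)) ≡ S ℚ.+ ℚ.- (S ℚ.* (N ℚ.* u))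
  ring₀ = RS.solve-∀ ℚring
  ring₁ : ∀ S → S ℚ.+ ℚ.- (S ℚ.* 1ℚ) ≡ 0ℚ
  ring₁ = RS.solve-∀ ℚring
  sum0 : sumℚ y ≡ 0ℚ
  sum0 = trans (sumℚ-+ c (λ _ → ℚ.- s)) (trans (cong (λ z → sumℚ c ℚ.+ z) (sumℚ-const (suc n) (ℚ.- s)))
    (trans (ring₀ (sumℚ c) Nq u) (trans (cong (λ z → sumℚ c ℚ.+ ℚ.- (sumℚ c ℚ.* z)) (ℚₚ.*-inverseʳ Nq)) (ring₁ (sumℚ c)))))
  ring₂ : ∀ a b u s → 0ℚ ℚ.- (a ℚ.* u ℚ.+ ℚ.- s ℚ.- (b ℚ.* u ℚ.+ ℚ.- s)) ≡ (b ℚ.- a) ℚ.* u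
  ring₂ = RS.solve-∀ ℚring
  hi : ∀ i j → i Fin.< j → pairRoot y i j ℚ.< 0ℚ
  hi i j i<j = qlin (subst (ℚ._< (⟦ ι j ⟧ ℚ.- ⟦ ι i ⟧) ℚ.* u) (ℚₚ.*-zeroˡ u) (ℚₚ.*-monoˡ-<-pos u (qgap (⟦⟧-mono-< (ℤ.+<+ i<j))))) (ring₂ ⟦ ι i ⟧ ⟦ ι j ⟧ u s)
  ring₃ : ∀ a b u s N → a ℚ.* u ℚ.+ ℚ.- s ℚ.- (b ℚ.* u ℚ.+ ℚ.- s) ℚ.- ℚ.- (N ℚ.* u) ≡ (a ℚ.+ N ℚ.- b) ℚ.* u
  ring₃ = RS.solve-∀ ℚring
  lo : ∀ i j → i Fin.< j → ℚ.- 1ℚ ℚ.< pairRoot y i j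
  lo i j i<j = qlin (subst (ℚ._< (⟦ ι i ⟧ ℚ.+ Nq ℚ.- ⟦ ι j ⟧) ℚ.* u) (ℚₚ.*-zeroˡ u) (ℚₚ.*-monoˡ-<-pos u (qgap (subst (⟦ ι j ⟧ ℚ.<_) (⟦⟧-+ (ι i) (+ suc n)) (⟦⟧-mono-< lt)))))
    (trans (cong (λ z → pairRoot y i j ℚ.- ℚ.- z) (sym (ℚₚ.*-inverseʳ Nq))) (ring₃ ⟦ ι i ⟧ ⟦ ι j ⟧ u s Nq))
    where
    lt : ι j < ι i + + suc n
    lt = ℤ.+<+ (ℕₚ.<-≤-trans (Finₚ.toℕ<n j) (ℕₚ.m≤n+m (suc n) (toℕ i)))

-- The sign of M decides. M = 0 leaves i < j; for M ≥ 1 all coordinate differences in the alcove are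
-- below 1; M < 0 is excluded since indices differ by less than N.
Aid-ordered : ∀ {n} {y : Pt n} → InAid y → ∀ i j M → ι i < ι j + M * N n → y i ℚ.< y j ℚ.+ ⟦ M ⟧
Aid-ordered {n} {y} (_ , ineq) i j (+ zero) h = subst (y i ℚ.<_) (trans (sym (ℚₚ.+-identityʳ (y j))) (cong (λ z → y j ℚ.+ z) (sym ⟦⟧-0)))
  (qlin (qgap (proj₂ (ineq i j i<j))) (ring (y i) (y j)))
  where
  ring : ∀ x y → y ℚ.- x ≡ 0ℚ ℚ.- (x ℚ.- y)
  ring = RS.solve-∀ ℚring
  i<j : i Fin.< j
  i<j = ℤₚ.drop‿+<+ (subst (ι i <_) (trans (cong (λ z → ι j + z) (ℤₚ.*-zeroˡ (N n))) (ℤₚ.+-identityʳ (ι j))) h)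
Aid-ordered {n} {y} (_ , ineq) i j (+ suc k) h = ℚₚ.<-≤-trans within (ℚₚ.+-monoʳ-≤ (y j) (subst (ℚ._≤ ⟦ + suc k ⟧) ⟦⟧-1 (⟦⟧-mono-≤ (ℤ.+≤+ (s≤s z≤n)))))
  where
  ring₁ : ∀ x y → y ℚ.+ 1ℚ ℚ.- x ≡ 0ℚ ℚ.- (x ℚ.- y) ℚ.+ 1ℚ
  ring₁ = RS.solve-∀ ℚring
  ring₂ : ∀ x → x ℚ.+ 1ℚ ℚ.- x ≡ 1ℚ
  ring₂ = RS.solve-∀ ℚring
  ring₃ : ∀ x y → y ℚ.+ 1ℚ ℚ.- x ≡ y ℚ.- x ℚ.- (ℚ.- 1ℚ)
  ring₃ = RS.solve-∀ ℚring
  0<1 : 0ℚ ℚ.< 1ℚ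
  0<1 = subst₂ ℚ._<_ ⟦⟧-0 ⟦⟧-1 (⟦⟧-mono-< (ℤ.+<+ (s≤s z≤n)))
  within : y i ℚ.< y j ℚ.+ 1ℚ
  within with Finₚ.<-cmp i j
  ... | tri< i<j _ _ = qlin (subst (ℚ._< 0ℚ ℚ.- pairRoot y i j ℚ.+ 1ℚ) (ℚₚ.+-identityˡ 0ℚ) (ℚₚ.+-mono-< (qgap (proj₂ (ineq i j i<j))) 0<1)) (ring₁ (y i) (y j))
  ... | tri≈ _ refl _ = qlin 0<1 (ring₂ (y i))
  ... | tri> _ _ j<i = qlin (qgap (proj₁ (ineq j i j<i))) (ring₃ (y i) (y j))
Aid-ordered {n} {y} _ i j -[1+ k ] h = ⊥-elim (ℤₚ.<⇒≱ h (lin≤ (gap< (ι<N j) ⊕ 0≤ι i ⊕ 0≤*N n k ⊕ ℤ.+≤+ (z≤n {1}))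
    (trans (cong (λ z → ι i - (ι j + z * N n)) (ring₀ k)) (ring (ι i) (ι j) (+ k) (N n)))))
  where
  ring₀ : ∀ k → -[1+ k ] ≡ - (1ℤ + + k)
  ring₀ k = refl
  ring : ∀ i j k N → i - (j + - (1ℤ + k) * N) ≡ N - (1ℤ + j) + i + k * N + 1ℤ
  ring = solve-∀

InAlc⇒Alc : ∀ {n} {w : Aff n} → Good w → ∀ {x} → InAlc w x → Alc (window w) x
InAlc⇒Alc {n} {w} gw {x} (y , yA , eq) = alc
  (trans (sumℚ-cong at) (trans (sumℚ-+ (λ p → y (σ w p)) (λ p → ⟦ τ w p ⟧)) (trans (cong₂ ℚ._+_
    (trans (sumℚ-cong λ p → cong y (sym (proj₂ π p))) (trans (sumℚ-permute y (proj₁ π)) (proj₁ yA)))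
    (trans (sumℚ-⟦⟧ (τ w)) (trans (cong ⟦_⟧ (τ-sum gw)) ⟦⟧-0))) (ℚₚ.+-identityˡ 0ℚ))))
  λ p q m h → subst₂ (λ a b → a ℚ.< b ℚ.+ ⟦ m ⟧) (sym (at p)) (sym (at q))
    (qlin (qgap (Aid-ordered {y = y} yA (σ w p) (σ w q) (m + τ w q - τ w p) (lin< (gap< h) (ring₁ (ι (σ w p)) (ι (σ w q)) (τ w p) (τ w q) m (N n)))))
      (trans (ring₂ (y (σ w p)) (y (σ w q)) ⟦ τ w p ⟧ ⟦ τ w q ⟧ ⟦ m ⟧) (cong (λ z → y (σ w q) ℚ.+ z ℚ.- y (σ w p))
        (sym (trans (⟦⟧-minus (m + τ w q) (τ w p)) (cong (ℚ._- ⟦ τ w p ⟧) (⟦⟧-+ m (τ w q))))))))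
  where
  π : Σ (Permutation (suc n) (suc n)) λ π → ∀ p → π ⟨$⟩ʳ p ≡ σ w p
  π = injective⇒permutation (σ w) (σ-injective gw)
  at : ∀ p → x p ≡ y (σ w p) ℚ.+ ⟦ τ w p ⟧
  at p = trans (sym (eq p)) (cong (λ z → y (σ w p) ℚ.+ z) (sym (⟦⟧≡ (τ w p))))
  ring₁ : ∀ i j s t m N → j + (m + t - s) * N - (1ℤ + i) ≡ j + t * N + m * N - (1ℤ + (i + s * N))
  ring₁ = solve-∀
  ring₂ : ∀ a b s t m → b ℚ.+ t ℚ.+ m ℚ.- (a ℚ.+ s) ≡ b ℚ.+ (m ℚ.+ t ℚ.- s) ℚ.- a
  ring₂ = RS.solve-∀ ℚring

Alc⇒InAlc : ∀ {n} {w : Aff n} → Good w → ∀ {x} → Alc (window w) x → InAlc w x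
Alc⇒InAlc {n} {w} gw {x} (alc xE ord) = y , (sum0 , λ i j i<j → lo i j i<j , hi i j i<j) , same
  where
  inverse : ∀ u → ∃ λ p → σ w p ≡ u
  inverse = injective⇒surjective (σ w) (σ-injective gw)
  back : Fin (suc n) → Fin (suc n)
  back u = proj₁ (inverse u)
  y′ : Pt n
  y′ p = x p ℚ.+ ℚ.- ⟦ τ w p ⟧
  y : Pt n
  y u = y′ (back u)
  back-σ : ∀ p → back (σ w p) ≡ p
  back-σ p = σ-injective gw (proj₂ (inverse (σ w p)))
  ring₀ : ∀ x t → x ℚ.+ ℚ.- t ℚ.+ t ≡ x
  ring₀ = RS.solve-∀ ℚring
  same : act w y ≗ₚ x
  same p = trans (cong₂ ℚ._+_ (cong y′ (back-σ p)) (sym (⟦⟧≡ (τ w p)))) (ring₀ (x p) ⟦ τ w p ⟧)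
  π : Σ (Permutation (suc n) (suc n)) λ π → ∀ p → π ⟨$⟩ʳ p ≡ σ w p
  π = injective⇒permutation (σ w) (σ-injective gw)
  neg0 : ℤΣ.sum (λ p → - τ w p) ≡ 0ℤ
  neg0 = trans (ring₁ (ℤΣ.sum (λ p → - τ w p)) (ℤΣ.sum (τ w))) (trans (cong₂ _-_ (trans (sym (ℤΣ.∑-distrib-+ (λ p → - τ w p) (τ w)))
      (trans (ℤΣ.sum-cong-≗ {suc n} {_} {λ _ → 0ℤ} (λ p → ℤₚ.+-inverseˡ (τ w p))) (ℤΣ.sum-replicate-zero (suc n)))) (τ-sum gw)) refl)
    where
    ring₁ : ∀ a b → a ≡ a + b - b
    ring₁ = solve-∀
  sum0 : sumℚ y ≡ 0ℚ
  sum0 = trans (sym (sumℚ-permute y (proj₁ π))) (trans (sumℚ-cong (λ p → trans (cong y (proj₂ π p)) (trans (cong y′ (back-σ p)) (cong (λ z → x p ℚ.+ z) (sym (⟦⟧-neg (τ w p)))))))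
    (trans (sumℚ-+ x (λ p → ⟦ - τ w p ⟧)) (trans (cong₂ ℚ._+_ xE (trans (sumℚ-⟦⟧ (λ p → - τ w p)) (trans (cong ⟦_⟧ neg0) ⟦⟧-0))) (ℚₚ.+-identityˡ 0ℚ))))
  win : ∀ u → window w (back u) ≡ ι u + τ w (back u) * N n
  win u = cong (λ v → ι v + τ w (back u) * N n) (proj₂ (inverse u))
  hi : ∀ i j → i Fin.< j → pairRoot y i j ℚ.< 0ℚ
  hi i j i<j = qlin (qgap (ord p q (τ w p - τ w q) (subst₂ (λ a b → a < b + (τ w p - τ w q) * N n) (sym (win i)) (sym (win j))
      (lin< (gap< (ℤ.+<+ i<j)) (ring₂ (ι i) (ι j) (τ w p) (τ w q) (N n))))))
      (trans (ring₃ (x p) (x q) ⟦ τ w p ⟧ ⟦ τ w q ⟧) (cong (λ z → x q ℚ.+ z ℚ.- x p) (sym (⟦⟧-minus (τ w p) (τ w q)))))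
    where
    p q : Fin (suc n)
    p = back i
    q = back j
    ring₂ : ∀ i j s t N → j + t * N + (s - t) * N - (1ℤ + (i + s * N)) ≡ j - (1ℤ + i)
    ring₂ = solve-∀
    ring₃ : ∀ x y s t → 0ℚ ℚ.- (x ℚ.+ ℚ.- s ℚ.- (y ℚ.+ ℚ.- t)) ≡ y ℚ.+ (s ℚ.- t) ℚ.- x
    ring₃ = RS.solve-∀ ℚring
  lo : ∀ i j → i Fin.< j → ℚ.- 1ℚ ℚ.< pairRoot y i j
  lo i j i<j = qlin (qgap (ord q p (1ℤ + (τ w q - τ w p)) (subst₂ (λ a b → a < b + (1ℤ + (τ w q - τ w p)) * N n) (sym (win j)) (sym (win i))
      (lin< (gap< (ι<N j) ⊕ 0≤ι i) (ring₂ (ι i) (ι j) (τ w p) (τ w q) (N n))))))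
      (trans (ring₃ (x p) (x q) ⟦ τ w p ⟧ ⟦ τ w q ⟧) (cong (λ z → x p ℚ.+ z ℚ.- x q)
        (sym (trans (⟦⟧-+ 1ℤ (τ w q - τ w p)) (cong₂ ℚ._+_ ⟦⟧-1 (⟦⟧-minus (τ w q) (τ w p)))))))
    where
    p q : Fin (suc n)
    p = back i
    q = back j
    ring₂ : ∀ i j s t N → i + s * N + (1ℤ + (t - s)) * N - (1ℤ + (j + t * N)) ≡ N - (1ℤ + j) + i
    ring₂ = solve-∀
    ring₃ : ∀ x y s t → x ℚ.+ ℚ.- s ℚ.- (y ℚ.+ ℚ.- t) ℚ.- (ℚ.- 1ℚ) ≡ x ℚ.+ (1ℚ ℚ.+ (t ℚ.- s)) ℚ.- y
    ring₃ = RS.solve-∀ ℚring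

alcove-point : ∀ {n} (w : Aff n) → ∃ (InAlc w)
alcove-point {n} w = act w (proj₁ (barycentre n)) , proj₁ (barycentre n) , proj₂ (barycentre n) , λ _ → refl

Alc-reflects : ∀ {n} {g : Window n} → Distinct g → ∀ {x} → Alc g x → ∀ p q m → x p ℚ.< x q ℚ.+ ⟦ m ⟧ → g p < g q + m * N n
Alc-reflects {n} {g} dist {x} (alc _ ord) p q m h = ℤₚ.≰⇒> λ le → impossible (ℤₚ.<-cmp (g q + m * N n) (g p)) le
  where
  ring₁ : ∀ a b m N → a + - m * N - (1ℤ + b) ≡ a - (1ℤ + (b + m * N))
  ring₁ = solve-∀
  ring₂ : ∀ x y m → x ℚ.- (y ℚ.+ m) ≡ x ℚ.+ ℚ.- m ℚ.- y
  ring₂ = RS.solve-∀ ℚring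
  ring₃ : ∀ a b → b + a - b ≡ a
  ring₃ = solve-∀
  impossible : _ → ¬ g q + m * N n ≤ g p
  impossible (tri< lt _ _) _ = ℚₚ.<-asym h (qlin (qgap (ord q p (- m) (lin< (gap< lt) (ring₁ (g p) (g q) m (N n)))))
    (trans (ring₂ (x p) (x q) ⟦ m ⟧) (cong (λ z → x p ℚ.+ z ℚ.- x q) (sym (⟦⟧-neg m)))))
  impossible (tri≈ _ eq _) _ = ℚₚ.<-irrefl refl (subst₂ (λ a b → x a ℚ.< b) (sym q≡p) xq h)
    where
    q≡p : q ≡ p
    q≡p = sym (separate dist p q (divides m (trans (cong (_- g q) (sym eq)) (ring₃ (m * N n) (g q)))))
    m≡0 : m ≡ 0ℤ
    m≡0 = *N-cancel-≡ n m 0ℤ (trans (sym (ring₃ (m * N n) (g q))) (trans (cong (_- g q) (trans eq (cong g (sym q≡p)))) (trans (ℤₚ.+-inverseʳ (g q)) (sym (ℤₚ.*-zeroˡ (N n))))))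
    xq : x q ℚ.+ ⟦ m ⟧ ≡ x q
    xq = trans (cong (λ z → x q ℚ.+ z) (trans (cong ⟦_⟧ m≡0) ⟦⟧-0)) (ℚₚ.+-identityʳ (x q))
  impossible (tri> _ _ gt) le = ℤₚ.<⇒≱ gt le

-- A common point makes both windows lie on the same side of every hyperplane. If g_b = g_a + 1 +
-- kN, then g_a + kN < g_b carries over to g', so g' - g does not fall from `a` to `b`. Around the
-- cycle of residues it is constant, and equal sums make it 0.
Alc-unique : ∀ {n} {g g' : Window n} → Distinct g → Distinct g' → ℤΣ.sum g ≡ ℤΣ.sum g' → ∀ {x} → Alc g x → Alc g' x → ∀ p → g p ≡ g' p
Alc-unique {n} {g} {g'} dist dist' Σ≡ {x} A A' p = sym (ℤₚ.i-j≡0⇒i≡j (g' p) (g p)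
    (constant-zero (λ p → g' p - g p) (cyclic-constant dist (λ p → g' p - g p) weak) Σ0 p))
  where
  e : Window n
  e p = g' p - g p
  weak : ∀ a b → N n ∣ g b - g a - 1ℤ → e a ≤ e b
  weak a b (divides k eq) = lin≤ (gap< (Alc-reflects dist' A' a b (- k) (ordered A a b (- k) (lin< (gap≡ (sym eq)) (ring₁ (g a) (g b) k (N n)))))
      ⊕ gap≡ eq) (ring₂ (g a) (g b) (g' a) (g' b) k (N n))
    where
    ring₁ : ∀ a b k N → b + - k * N - (1ℤ + a) ≡ b - a - 1ℤ - k * N
    ring₁ = solve-∀
    ring₂ : ∀ a b a' b' k N → b' - b - (a' - a) ≡ b' + - k * N - (1ℤ + a') + (k * N - (b - a - 1ℤ))
    ring₂ = solve-∀
  ring₃ : ∀ a b → a ≡ b + a - b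
  ring₃ = solve-∀
  ring₄ : ∀ a b → a + (b - a) ≡ b
  ring₄ = solve-∀
  Σ0 : ℤΣ.sum e ≡ 0ℤ
  Σ0 = trans (ring₃ (ℤΣ.sum e) (ℤΣ.sum g)) (trans (cong (_- ℤΣ.sum g) (trans (sym (ℤΣ.∑-distrib-+ g e))
    (trans (ℤΣ.sum-cong-≗ {suc n} {λ p → g p + e p} {g'} (λ p → ring₄ (g p) (g' p))) (sym Σ≡)))) (ℤₚ.+-inverseʳ (ℤΣ.sum g)))

-- z represents N times the weight x.
record Weight {n : ℕ} (x : Pt n) (z : Window n) : Set where
  constructor weight
  field
    in-E  : InE x
    zsum  : ℤΣ.sum z ≡ 0ℤ
    zdiff : ∀ p q → ∃ λ d → z p - z q ≡ d * N n × x p ℚ.- x q ≡ ⟦ d ⟧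
open Weight

Weight-neg : ∀ {n} {x : Pt n} {z} → Weight x z → Weight (λ p → ℚ.- x p) (λ p → - z p)
Weight-neg {n} {x} {z} (weight xE z0 df) = weight
  (trans (trans (ring₁ (sumℚ (λ p → ℚ.- x p)) (sumℚ x)) (cong₂ ℚ._-_ (trans (sym (sumℚ-+ (λ p → ℚ.- x p) x)) (trans (sumℚ-cong (λ p → ℚₚ.+-inverseˡ (x p))) (trans (sumℚ-const (suc n) 0ℚ) (ℚₚ.*-zeroʳ ⟦ + suc n ⟧)))) xE)) refl)
  (trans (trans (ring₂ (ℤΣ.sum (λ p → - z p)) (ℤΣ.sum z)) (cong₂ _-_ (trans (sym (ℤΣ.∑-distrib-+ (λ p → - z p) z)) (trans (ℤΣ.sum-cong-≗ {suc n} {_} {λ _ → 0ℤ} (λ p → ℤₚ.+-inverseˡ (z p))) (ℤΣ.sum-replicate-zero (suc n)))) z0)) refl)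
  λ p q → let d , ez , ex = df p q in - d , trans (ring₃ (z p) (z q)) (trans (cong -_ ez) (ℤₚ.neg-distribˡ-* d (N n)))
    , trans (ring₄ (x p) (x q)) (trans (cong ℚ.-_ ex) (sym (⟦⟧-neg d)))
  where
  ring₁ : ∀ a b → a ≡ a ℚ.+ b ℚ.- b
  ring₁ = RS.solve-∀ ℚring
  ring₂ : ∀ a b → a ≡ a + b - b
  ring₂ = solve-∀
  ring₃ : ∀ a b → - a - - b ≡ - (a - b)
  ring₃ = solve-∀
  ring₄ : ∀ a b → ℚ.- a ℚ.- ℚ.- b ≡ ℚ.- (a ℚ.- b)
  ring₄ = RS.solve-∀ ℚring

Weight-+ : ∀ {n} {x x' : Pt n} {z z'} → Weight x z → Weight x' z' → Weight (λ p → x p ℚ.+ x' p) (λ p → z p + z' p)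
Weight-+ {n} {x} {x'} {z} {z'} (weight xE z0 df) (weight xE' z0' df') = weight
  (trans (sumℚ-+ x x') (trans (cong₂ ℚ._+_ xE xE') (ℚₚ.+-identityˡ 0ℚ)))
  (trans (ℤΣ.∑-distrib-+ z z') (cong₂ _+_ z0 z0'))
  λ p q → let d , ez , ex = df p q ; d' , ez' , ex' = df' p q in d + d'
    , trans (ring₃ (z p) (z' p) (z q) (z' q)) (trans (cong₂ _+_ ez ez') (sym (ℤₚ.*-distribʳ-+ (N n) d d')))
    , trans (ring₄ (x p) (x' p) (x q) (x' q)) (trans (cong₂ ℚ._+_ ex ex') (sym (⟦⟧-+ d d')))
  where
  ring₃ : ∀ a a' b b' → a + a' - (b + b') ≡ a - b + (a' - b')
  ring₃ = solve-∀
  ring₄ : ∀ a a' b b' → a ℚ.+ a' ℚ.- (b ℚ.+ b') ≡ a ℚ.- b ℚ.+ (a' ℚ.- b')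
  ring₄ = RS.solve-∀ ℚring

Alc-translate : ∀ {n} {g : Window n} {x v : Pt n} {z : Window n} → Weight v z → Alc g x → Alc (λ p → g p + z p) (λ p → x p ℚ.+ v p)
Alc-translate {n} {g} {x} {v} {z} W (alc xE ord) = alc
  (trans (sumℚ-+ x v) (trans (cong₂ ℚ._+_ xE (in-E W)) (ℚₚ.+-identityˡ 0ℚ)))
  λ p q m h → let d , ez , ev = zdiff W q p in
    qlin (qgap (ord p q (m + d) (lin< (gap< h ⊕ gap≡ ez) (ring₁ (g p) (g q) (z p) (z q) m d (N n)))))
      (trans (ring₂ (x p) (x q) (v p) (v q) ⟦ m ⟧) (trans (cong (λ w → x q ℚ.+ (⟦ m ⟧ ℚ.+ w) ℚ.- x p) ev) (cong (λ w → x q ℚ.+ w ℚ.- x p) (sym (⟦⟧-+ m d)))))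
  where
  ring₁ : ∀ a b s t m d N → b + (m + d) * N - (1ℤ + a) ≡ b + t + m * N - (1ℤ + (a + s)) + (d * N - (t - s))
  ring₁ = solve-∀
  ring₂ : ∀ x y s t m → y ℚ.+ t ℚ.+ m ℚ.- (x ℚ.+ s) ≡ y ℚ.+ (m ℚ.+ (t ℚ.- s)) ℚ.- x
  ring₂ = RS.solve-∀ ℚring

Alc-cong : ∀ {n} {g g' : Window n} {x x' : Pt n} → (∀ p → g p ≡ g' p) → (∀ p → x p ≡ x' p) → Alc g x → Alc g' x'
Alc-cong {n} hg hx (alc xE ord) = alc (trans (sumℚ-cong (λ p → sym (hx p))) xE)
  λ p q m h → subst₂ (λ a b → a ℚ.< b ℚ.+ ⟦ m ⟧) (hx p) (hx q) (ord p q m (subst₂ (λ a b → a < b + m * N n) (sym (hg p)) (sym (hg q)) h))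

translate-SameSet : ∀ {n} {w w' : Aff n} {v : Pt n} {z : Window n} → Good w → Good w' → Weight v z →
  (∀ p → window w p ≡ window w' p + z p) → SameSet (InAlc w) (InTrans (InAlc w') v)
translate-SameSet {n} {w} {w'} {v} {z} gw gw' W eq x =
  (λ A → (λ p → x p ℚ.+ ℚ.- v p) , Alc⇒InAlc gw' (Alc-cong (λ p → trans (cong (_+ - z p) (eq p)) (ring₁ (window w' p) (z p))) (λ p → refl)
      (Alc-translate (Weight-neg W) (InAlc⇒Alc gw A))) , λ p → ring₂ (x p) (v p))
  , λ (y , A , ex) → Alc⇒InAlc gw (Alc-cong (λ p → sym (eq p)) (λ p → sym (ex p)) (Alc-translate W (InAlc⇒Alc gw' A)))
  where
  ring₁ : ∀ g z → g + z + - z ≡ g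
  ring₁ = solve-∀
  ring₂ : ∀ x v → x ≡ x ℚ.+ ℚ.- v ℚ.+ v
  ring₂ = RS.solve-∀ ℚring

translate-distinct : ∀ {n} {g : Window n} {x : Pt n} {z} → Weight x z → Distinct g → Distinct (λ p → g p + z p)
translate-distinct {n} {g} {x} {z} W dist = distinct λ p q d → let c , ez , _ = zdiff W p q in
  separate dist p q (dvd (∣m∣n⇒∣m-n d (divides c ez)) (ring (g p) (g q) (z p) (z q)))
  where
  ring : ∀ a b s t → a - b ≡ a + s - (b + t) - (s - t)
  ring = solve-∀

translate-sum : ∀ {n} {g : Window n} {x : Pt n} {z} → Weight x z → ℤΣ.sum (λ p → g p + z p) ≡ ℤΣ.sum g
translate-sum {n} {g} {x} {z} W = trans (ℤΣ.∑-distrib-+ g z) (trans (cong (λ s → ℤΣ.sum g + s) (zsum W)) (ℤₚ.+-identityʳ (ℤΣ.sum g)))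

-- A single point of the alcove determines the window, by `Alc-unique`; here it is the image of the
-- barycentre.
SameSet⇒window : ∀ {n} {w w' : Aff n} {v : Pt n} {z : Window n} → Good w → Good w' → Weight v z →
  SameSet (InAlc w) (InTrans (InAlc w') v) → ∀ p → window w p ≡ window w' p + z p
SameSet⇒window {n} {w} {w'} {v} {z} gw gw' W S = fromPoint (proj₁ (S x) xA)
  where
  x : Pt n
  x = proj₁ (alcove-point w)
  xA : InAlc w x
  xA = proj₂ (alcove-point w)
  fromPoint : InTrans (InAlc w') v x → ∀ p → window w p ≡ window w' p + z p
  fromPoint (y , A , ex) = Alc-unique (window-distinct gw) (translate-distinct W (window-distinct gw'))
    (trans (window-sum gw) (sym (trans (translate-sum {g = window w'} W) (window-sum gw'))))
    (InAlc⇒Alc gw xA) (Alc-cong (λ p → refl) (λ p → sym (ex p)) (Alc-translate W (InAlc⇒Alc gw' A)))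

dominant-strict : ∀ {n} {g : Window n} {x : Pt n} → Distinct g → Alc g x → (∀ r → 0ℚ ℚ.≤ pairα x r) → ∀ {p q} → p Fin.< q → g q < g p
dominant-strict {n} {g} {x} dist (alc _ ord) dom≥0 = adjacent⇒strict g λ r → step r (ℤₚ.<-cmp (g (inject₁ r)) (g (suc r)))
  where
  ring : ∀ a N → a ≡ a + 0ℤ * N
  ring = solve-∀
  step : ∀ r → _ → g (suc r) < g (inject₁ r)
  step r (tri> _ _ gt) = gt
  step r (tri≈ _ eq _) = ⊥-elim (inject₁≢suc r (separate dist (inject₁ r) (suc r) (divides 0ℤ (trans (ℤₚ.i≡j⇒i-j≡0 eq) (sym (ℤₚ.*-zeroˡ (N n)))))))
  step r (tri< lt _ _) = ⊥-elim (ℚₚ.<-irrefl refl (ℚₚ.<-≤-trans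
    (qneg (subst (x (inject₁ r) ℚ.<_) (trans (cong (λ z → x (suc r) ℚ.+ z) ⟦⟧-0) (ℚₚ.+-identityʳ (x (suc r)))) (ord (inject₁ r) (suc r) 0ℤ (subst (g (inject₁ r) <_) (ring (g (suc r)) (N n)) lt)))) (dom≥0 r)))
    where
    qneg : ∀ {a b} → a ℚ.< b → a ℚ.- b ℚ.< 0ℚ
    qneg {a} {b} h = subst (a ℚ.- b ℚ.<_) (ℚₚ.+-inverseʳ b) (ℚₚ.+-monoˡ-< (ℚ.- b) h)

InWplus⇒strict : ∀ {n} {w : Aff n} → InWplus w → ∀ {p q} → p Fin.< q → window w q < window w p
InWplus⇒strict {n} {w} (wW , sub) = dominant-strict (window-distinct gw) (InAlc⇒Alc gw xA) (proj₂ (sub (proj₁ (alcove-point w)) xA))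
  where
  gw : Good w
  gw = InWaff⇒Good wW
  xA : InAlc w (proj₁ (alcove-point w))
  xA = proj₂ (alcove-point w)

strict⇒InWplus : ∀ {n} → 1 ℕ.≤ n → {w : Aff n} → Good w → (∀ {p q} → p Fin.< q → window w q < window w p) → InWplus w
strict⇒InWplus {n} 1≤n {w} gw strict = Good⇒InWaff 1≤n gw , λ x A → cone (InAlc⇒Alc gw A)
  where
  ring : ∀ a N → a ≡ a + 0ℤ * N
  ring = solve-∀
  cone : ∀ {x} → Alc (window w) x → InCplus x
  cone {x} (alc xE ord) = xE , λ r → ℚₚ.<⇒≤ (qgap (subst (x (suc r) ℚ.<_) (trans (cong (λ z → x (inject₁ r) ℚ.+ z) ⟦⟧-0) (ℚₚ.+-identityʳ (x (inject₁ r))))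
    (ord (suc r) (inject₁ r) 0ℤ (subst (window w (suc r) <_) (ring (window w (inject₁ r)) (N n)) (strict {inject₁ r} {suc r} (s≤s (ℕₚ.≤-reflexive (Finₚ.toℕ-inject₁ r))))))))

σ-w₀ : ∀ {n} (p : Fin (suc n)) → σ (w₀ {n}) p ≡ opposite p
σ-w₀ p = Vecₚ.lookup∘tabulate opposite p

τ-w₀ : ∀ {n} (p : Fin (suc n)) → τ (w₀ {n}) p ≡ 0ℤ
τ-w₀ p = Vecₚ.lookup-replicate p (+ 0)

good-w₀ : ∀ {n} → Good (w₀ {n})
good-w₀ {n} = good (λ {p} {q} eq → trans (sym (Finₚ.opposite-involutive p)) (trans (cong opposite (trans (sym (σ-w₀ p)) (trans eq (σ-w₀ q)))) (Finₚ.opposite-involutive q)))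
  (trans (ℤΣ.sum-cong-≗ {suc n} {τ (w₀ {n})} {λ _ → 0ℤ} τ-w₀) (ℤΣ.sum-replicate-zero (suc n)))

-- The image of Π^- under w₀ is Π^+, which lies in the dominant cone. The image of the barycentre is
-- enough to read off the order of the entries.
InF⇒strict : ∀ {n} {a : Aff n} → InF a → ∀ {p q} → p Fin.< q → window (w₀ ∘ₐ a) q < window (w₀ ∘ₐ a) p
InF⇒strict {n} {a} (aW , sub) = fromPoint (sub (proj₁ (alcove-point a)) (proj₂ (alcove-point a)))
  where
  u : Pt n
  u = proj₁ (barycentre n)
  ga : Good (w₀ ∘ₐ a)
  ga = good-∘ good-w₀ (InWaff⇒Good aW)
  fromPoint : InΠminus (act a u) → ∀ {p q} → p Fin.< q → window (w₀ ∘ₐ a) q < window (w₀ ∘ₐ a) p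
  fromPoint (y , (yE , box) , eq) = dominant-strict (window-distinct ga) (InAlc⇒Alc ga (u , proj₂ (barycentre n) , same)) (λ r → proj₁ (box r))
    where
    y-opp : ∀ p → y (opposite p) ≡ act a u p
    y-opp p = trans (sym (trans (cong₂ (λ i t → y i ℚ.+ t) (σ-w₀ p) (trans (cong ℤ→ℚ (τ-w₀ p)) (trans (sym (⟦⟧≡ 0ℤ)) ⟦⟧-0))) (ℚₚ.+-identityʳ (y (opposite p))))) (eq p)
    same : act (w₀ ∘ₐ a) u ≗ₚ y
    same p = trans (cong₂ (λ i t → u i ℚ.+ ℤ→ℚ t) (trans (σ-∘ w₀ a p) (cong (σ a) (σ-w₀ p)))
        (trans (τ-∘ w₀ a p) (trans (cong₂ _+_ (cong (τ a) (σ-w₀ p)) (τ-w₀ p)) (ℤₚ.+-identityʳ (τ a (opposite p))))))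
      (trans (sym (y-opp (opposite p))) (cong y (Finₚ.opposite-involutive p)))

-- Dominant weights and the covering relation

-- Extension by zero gives every simple root two neighbours, so that concavity can be written
-- without boundary cases.
ext : ∀ {n} → (Fin n → ℕ) → ℕ → ℕ
ext {zero} d l = 0
ext {suc n} d zero = d zero
ext {suc n} d (suc l) = ext (d ∘ suc) l

ext-toℕ : ∀ {n} (d : Fin n → ℕ) r → ext d (toℕ r) ≡ d r
ext-toℕ d zero = refl
ext-toℕ d (suc r) = ext-toℕ (d ∘ suc) r

ext-out : ∀ {n} (d : Fin n → ℕ) l → n ℕ.≤ l → ext d l ≡ 0
ext-out {zero} d l _ = refl
ext-out {suc n} d (suc l) (s≤s n≤l) = ext-out (d ∘ suc) l n≤l

ext-restrict : ∀ {n} (e : ℕ → ℕ) → (∀ l → n ℕ.≤ l → e l ≡ 0) → ∀ l → ext {n} (e ∘ toℕ) l ≡ e l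
ext-restrict {zero} e out l = sym (out l z≤n)
ext-restrict {suc n} e out zero = refl
ext-restrict {suc n} e out (suc l) = ext-restrict (e ∘ suc) (λ l n≤l → out (suc l) (s≤s n≤l)) l

ext-pos⇒< : ∀ {n} (d : Fin n → ℕ) l → 1 ℕ.≤ ext d l → l ℕ.< n
ext-pos⇒< {n} d l h = ℕₚ.≰⇒> λ n≤l → ℕₚ.1+n≰n (ℕₚ.≤-trans h (ℕₚ.≤-reflexive (ext-out d l n≤l)))

rootsum-cong : ∀ {m} {e e' : ℕ → ℕ} → (∀ l → e l ≡ e' l) → ∀ (p : Fin m) → rootsum e p ≡ rootsum e' p
rootsum-cong {e = e} {e'} h p = cong₂ (λ a b → + a - + b) (h (toℕ p)) (prev-cong (toℕ p))
  where
  prev-cong : ∀ l → prev e l ≡ prev e' l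
  prev-cong zero = refl
  prev-cong (suc l) = h l

αsum : ∀ {n} (d : Fin n → ℕ) (p : Fin (suc n)) → sumℚ (λ r → ℕ→ℚ (d r) ℚ.* αvec r p) ≡ ⟦ rootsum (ext d) p ⟧
αsum {zero} d zero = sym ⟦⟧-0
αsum {suc n} d zero = trans (cong₂ ℚ._+_ (trans (ring₁ (ℕ→ℚ (d zero))) (sym (⟦⟧≡ (+ d zero)))) rest)
    (trans (ℚₚ.+-identityʳ ⟦ + d zero ⟧) (cong ⟦_⟧ (sym (ℤₚ.+-identityʳ (+ d zero)))))
  where
  ring₁ : ∀ k → k ℚ.* (1ℚ ℚ.- 0ℚ) ≡ k
  ring₁ = RS.solve-∀ ℚring
  ring₂ : ∀ k → k ℚ.* (0ℚ ℚ.- 0ℚ) ≡ 0ℚ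
  ring₂ = RS.solve-∀ ℚring
  rest : sumℚ (λ r → ℕ→ℚ (d (suc r)) ℚ.* αvec (suc r) zero) ≡ 0ℚ
  rest = trans (sumℚ-cong (λ r → ring₂ (ℕ→ℚ (d (suc r))))) (trans (sumℚ-const n 0ℚ) (ℚₚ.*-zeroʳ ⟦ + n ⟧))
αsum {suc n} d (suc zero) = trans (cong₂ ℚ._+_ (cong (λ k → k ℚ.* (0ℚ ℚ.- 1ℚ)) (sym (⟦⟧≡ (+ d zero)))) (αsum (d ∘ suc) zero))
    (trans (cong (λ w → ⟦ + d zero ⟧ ℚ.* (0ℚ ℚ.- 1ℚ) ℚ.+ w) (trans (⟦⟧-minus (+ ext (d ∘ suc) 0) (+ 0)) (cong (λ w → ⟦ + ext (d ∘ suc) 0 ⟧ ℚ.- w) ⟦⟧-0)))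
      (trans (ring ⟦ + d zero ⟧ ⟦ + ext (d ∘ suc) 0 ⟧) (sym (⟦⟧-minus (+ ext (d ∘ suc) 0) (+ d zero)))))
  where
  ring : ∀ a b → a ℚ.* (0ℚ ℚ.- 1ℚ) ℚ.+ (b ℚ.- 0ℚ) ≡ b ℚ.- a
  ring = RS.solve-∀ ℚring
αsum {suc n} d (suc (suc p)) = trans (cong₂ ℚ._+_ (ring (ℕ→ℚ (d zero))) (αsum (d ∘ suc) (suc p))) (ℚₚ.+-identityˡ ⟦ rootsum (ext (d ∘ suc)) (suc p) ⟧)
  where
  ring : ∀ k → k ℚ.* (0ℚ ℚ.- 0ℚ) ≡ 0ℚ
  ring = RS.solve-∀ ℚring

psum-full : ∀ {m} (h : Fin m → ℤ) → psum m h ≡ ℤΣ.sum h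
psum-full {zero} h = refl
psum-full {suc m} h = cong (λ z → h zero + z) (psum-full (h ∘ suc))

Weight-cong : ∀ {n} {x x' : Pt n} {z z' : Window n} → (∀ p → x p ≡ x' p) → (∀ p → z p ≡ z' p) → Weight x z → Weight x' z'
Weight-cong {n} hx hz (weight xE z0 df) = weight (trans (sumℚ-cong (λ p → sym (hx p))) xE)
  (trans (ℤΣ.sum-cong-≗ {suc n} (λ p → sym (hz p))) z0)
  λ p q → let d , ez , ex = df p q in d , trans (cong₂ _-_ (sym (hz p)) (sym (hz q))) ez , trans (cong₂ ℚ._-_ (sym (hx p)) (sym (hx q))) ex

Weight-root : ∀ {n} (e : ℕ → ℕ) → e n ≡ 0 → Weight {n} (λ p → ⟦ rootsum e p ⟧) (λ p → rootsum e p * N n)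
Weight-root {n} e en≡0 = weight (trans (sumℚ-⟦⟧ (rootsum {suc n} e)) (trans (cong ⟦_⟧ sum0) ⟦⟧-0))
  (trans (sumℤ-scale (rootsum {suc n} e) (N n)) (trans (cong (_* N n) sum0) (ℤₚ.*-zeroˡ (N n))))
  λ p q → rootsum e p - rootsum e q , ring (rootsum e p) (rootsum e q) (N n) , sym (⟦⟧-minus (rootsum e p) (rootsum e q))
  where
  ring : ∀ a b N → a * N - b * N ≡ (a - b) * N
  ring = solve-∀
  sum0 : ℤΣ.sum (rootsum {suc n} e) ≡ 0ℤ
  sum0 = trans (sym (psum-full (rootsum {suc n} e))) (trans (psum-rootsum {suc n} e (suc n) ℕₚ.≤-refl) (cong +_ en≡0))

below : ∀ {n} → (ℕ → ℕ) → Pt n → Pt n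
below e x p = x p ℚ.- ⟦ rootsum e p ⟧

Weight-below : ∀ {n} {x : Pt n} {z} (e : ℕ → ℕ) → e n ≡ 0 → Weight x z → Weight (below e x) (lowered e z)
Weight-below e en≡0 W = Weight-+ W (Weight-neg (Weight-root e en≡0))

Weight⇒Pairing : ∀ {n} {x : Pt n} {z} {m : ℕ → ℕ} → Weight x z → (∀ r → pairα x r ≡ ⟦ + m (toℕ r) ⟧) → Pairing z m
Weight⇒Pairing {n} {x} {z} {m} W h = pairing λ r → let d , ez , ex = zdiff W (inject₁ r) (suc r) in
  trans (ring (z (inject₁ r)) (z (suc r))) (trans (cong (λ w → z (suc r) + w) ez) (cong (λ k → z (suc r) + k * N n) (⟦⟧-injective (trans (sym ex) (h r)))))
  where
  ring : ∀ a b → a ≡ b + (a - b)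
  ring = solve-∀

pairings : ∀ {n} (x : Pt n) → InΛplus x → ℕ → ℕ
pairings x (_ , k) = ext (λ r → proj₁ (k r))

pairings-correct : ∀ {n} (x : Pt n) (xΛ : InΛplus x) r → pairα x r ≡ ⟦ + pairings x xΛ (toℕ r) ⟧
pairings-correct x (_ , k) r = trans (proj₂ (k r)) (trans (sym (⟦⟧≡ (+ proj₁ (k r)))) (cong (λ c → ⟦ + c ⟧) (sym (ext-toℕ (λ r → proj₁ (k r)) r))))

csum : (ℕ → ℕ) → ℕ → ℤ
csum m zero = 0ℤ
csum m (suc l) = csum m l + + m l

-- The pairings give x_p = x_0 - c_p with c_p an integral partial sum of pairings. Since x has sum
-- 0, N x_0 = Σ c = S, so N x_p = S - c_p N is an integer.
Λ-weight : ∀ {n} (x : Pt n) → InΛplus x → ∃ (Weight x)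
Λ-weight {n} x xΛ@(xE , _) = z , weight xE sum0 (λ p q → c q - c p , ring₁ S (c p) (c q) (N n) ,
    trans (cong₂ ℚ._-_ (coord p) (coord q)) (trans (ring₂ (x zero) ⟦ c p ⟧ ⟦ c q ⟧) (sym (⟦⟧-minus (c q) (c p)))))
  where
  m : ℕ → ℕ
  m = pairings x xΛ
  c z : Window n
  S : ℤ
  c p = csum m (toℕ p)
  S = ℤΣ.sum c
  z p = S + - c p * N n
  ring₁ : ∀ S c c' N → S + - c * N - (S + - c' * N) ≡ (c' - c) * N
  ring₁ = solve-∀
  ring₂ : ∀ x c c' → x ℚ.- c ℚ.- (x ℚ.- c') ≡ c' ℚ.- c
  ring₂ = RS.solve-∀ ℚring
  ring₃ : ∀ a b → b ≡ a ℚ.- (a ℚ.- b)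
  ring₃ = RS.solve-∀ ℚring
  ring₄ : ∀ x c k → x ℚ.- c ℚ.- k ≡ x ℚ.- (c ℚ.+ k)
  ring₄ = RS.solve-∀ ℚring
  coord : ∀ p → x p ≡ x zero ℚ.- ⟦ c p ⟧
  coord = <-weakInduction (λ p → x p ≡ x zero ℚ.- ⟦ c p ⟧)
    (trans (ring₃′ (x zero)) (cong (λ w → x zero ℚ.- w) (sym ⟦⟧-0)))
    λ r ih → trans (ring₃ (x (inject₁ r)) (x (suc r))) (trans (cong₂ ℚ._-_ ih (pairings-correct x xΛ r))
      (trans (ring₄ (x zero) ⟦ c (inject₁ r) ⟧ ⟦ + m (toℕ r) ⟧) (cong (λ w → x zero ℚ.- w)
        (trans (sym (⟦⟧-+ (c (inject₁ r)) (+ m (toℕ r)))) (cong (λ l → ⟦ csum m l + + m (toℕ r) ⟧) (Finₚ.toℕ-inject₁ r))))))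
    where
    ring₃′ : ∀ a → a ≡ a ℚ.- 0ℚ
    ring₃′ = RS.solve-∀ ℚring
  ringΣ : ∀ S N N' → N' ≡ N → N * S + - (S * N') ≡ 0ℤ
  ringΣ S N .N refl = trans (cong (λ w → N * S + - w) (ℤₚ.*-comm S N)) (ℤₚ.+-inverseʳ (N * S))
  negsum : ∀ {m} (f : Fin m → ℤ) → ℤΣ.sum (λ p → - f p) ≡ - ℤΣ.sum f
  negsum {zero} f = refl
  negsum {suc m} f = trans (cong (λ w → - f zero + w) (negsum (f ∘ suc))) (sym (ℤₚ.neg-distrib-+ (f zero) (ℤΣ.sum (f ∘ suc))))
  sum0 : ℤΣ.sum z ≡ 0ℤ
  sum0 = trans (ℤΣ.∑-distrib-+ (λ _ → S) (λ p → - c p * N n)) (trans (cong₂ _+_ (sumℤ-const (suc n) S)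
    (trans (sumℤ-scale (λ p → - c p) (N n)) (trans (cong (_* N n) (negsum c)) (sym (ℤₚ.neg-distribˡ-* S (N n)))))) (ringΣ S (+ suc n) (N n) (N≡ n)))

-- Walk right from the first index with d > 0: concavity of d up to m keeps d positive
-- until the pairings met so far add up to 2.
module _ (n : ℕ) (m d : ℕ → ℕ) (out : ∀ l → n ℕ.≤ l → d l ≡ 0) (conc : ∀ l → d l ℕ.+ d l ℕ.≤ m l ℕ.+ prev d l ℕ.+ d (suc l)) where
  private
    Found : Set
    Found = Σ ℕ λ i → Σ ℕ λ k → Pattern m i k × (∀ l → segment i k l ℕ.≤ d l)

    segment≤ : ∀ i k → (∀ t → i ℕ.≤ t → t ℕ.≤ k → 1 ℕ.≤ d t) → ∀ l → segment i k l ℕ.≤ d l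
    segment≤ i k h l with i ℕₚ.≤? l | l ℕₚ.≤? k
    ... | yes a | yes b = subst (ℕ._≤ d l) (sym (segment-in a b)) (h l a b)
    ... | no a | _ = subst (ℕ._≤ d l) (sym (segment-out {i} {k} {l} (a ∘ proj₁))) z≤n
    ... | yes _ | no b = subst (ℕ._≤ d l) (sym (segment-out {i} {k} {l} (b ∘ proj₂))) z≤n

    single : ∀ l → 2 ℕ.≤ m l → 1 ℕ.≤ d l → Found
    single l 2≤ 1≤ = l , l , inj₁ (refl , 2≤) , segment≤ l l λ t a b → subst (λ t → 1 ℕ.≤ d t) (ℕₚ.≤-antisym a b) 1≤

    slide : ∀ l → prev d l ℕ.+ m l ℕ.≤ d l → d l ℕ.≤ d (suc l)
    slide l h = ℕₚ.+-cancelˡ-≤ (d l) (d l) (d (suc l)) (ℕₚ.≤-trans (conc l)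
      (ℕₚ.+-monoˡ-≤ (d (suc l)) (ℕₚ.≤-trans (ℕₚ.≤-reflexive (ℕₚ.+-comm (m l) (prev d l))) h)))

    beyond : ∀ {A : Set} l → n ℕ.≤ l → 1 ℕ.≤ d l → A
    beyond l n≤l h = ⊥-elim (ℕₚ.1+n≰n (ℕₚ.≤-trans h (ℕₚ.≤-reflexive (out l n≤l))))

    -- One pairing 1 has been met, at i, and d is still weakly rising. A pairing 0 preserves this, a
    -- second 1 closes the pattern. The search ends because d is positive up to l but vanishes from
    -- n on.
    scanB : ∀ fuel i l → n ℕ.≤ l ℕ.+ fuel → i ℕ.< l → m i ≡ 1 → (∀ t → i ℕ.< t → t ℕ.< l → m t ≡ 0) →
      (∀ t → i ℕ.≤ t → t ℕ.≤ l → 1 ℕ.≤ d t) → prev d l ℕ.≤ d l → Found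
    scanB zero i l n≤ i<l mi mid sup _ = beyond l (subst (n ℕ.≤_) (ℕₚ.+-identityʳ l) n≤) (sup l (ℕₚ.<⇒≤ i<l) ℕₚ.≤-refl)
    scanB (suc fuel) i l n≤ i<l mi mid sup mono with m l in eq
    ... | suc (suc c) = single l (subst (2 ℕ.≤_) (sym eq) (s≤s (s≤s z≤n))) (sup l (ℕₚ.<⇒≤ i<l) ℕₚ.≤-refl)
    ... | suc zero = i , l , inj₂ (i<l , mi , eq , mid) , segment≤ i l sup
    ... | zero = scanB fuel i (suc l) (subst (n ℕ.≤_) (ℕₚ.+-suc l fuel) n≤) (ℕₚ.m≤n⇒m≤1+n i<l) mi mid' sup' next
      where
      next : d l ℕ.≤ d (suc l)
      next = slide l (subst (λ c → prev d l ℕ.+ c ℕ.≤ d l) (sym eq) (subst (ℕ._≤ d l) (sym (ℕₚ.+-identityʳ (prev d l))) mono))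
      mid' : ∀ t → i ℕ.< t → t ℕ.< suc l → m t ≡ 0
      mid' t it (s≤s t≤l) with t ℕₚ.≟ l
      ... | yes refl = eq
      ... | no t≢l = mid t it (ℕₚ.≤∧≢⇒< t≤l t≢l)
      sup' : ∀ t → i ℕ.≤ t → t ℕ.≤ suc l → 1 ℕ.≤ d t
      sup' t it t≤ with t ℕₚ.≟ suc l
      ... | yes refl = ℕₚ.≤-trans (sup l (ℕₚ.<⇒≤ i<l) ℕₚ.≤-refl) next
      ... | no t≢ = sup t it (ℕₚ.≤-pred (ℕₚ.≤∧≢⇒< t≤ t≢))

    -- Here d rises strictly into l. By concavity a pairing 0 keeps the rise strict, and a pairing 1
    -- costs at most one unit, leaving the weak rise of `scanB`.
    scanA : ∀ fuel l → n ℕ.≤ l ℕ.+ fuel → prev d l ℕ.< d l → Found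
    scanA zero l n≤ lt = beyond l (subst (n ℕ.≤_) (ℕₚ.+-identityʳ l) n≤) (ℕₚ.≤-trans (s≤s z≤n) lt)
    scanA (suc fuel) l n≤ lt with m l in eq
    ... | suc (suc c) = single l (subst (2 ℕ.≤_) (sym eq) (s≤s (s≤s z≤n))) (ℕₚ.≤-trans (s≤s z≤n) lt)
    ... | zero = scanA fuel (suc l) (subst (n ℕ.≤_) (ℕₚ.+-suc l fuel) n≤) strict
      where
      strict : d l ℕ.< d (suc l)
      strict = ℕₚ.+-cancelˡ-≤ (d l) (suc (d l)) (d (suc l)) (ℕₚ.≤-trans (ℕₚ.≤-reflexive (ℕₚ.+-suc (d l) (d l)))
        (ℕₚ.≤-trans (s≤s (conc l)) (subst (λ c → suc (c ℕ.+ prev d l ℕ.+ d (suc l)) ℕ.≤ d l ℕ.+ d (suc l)) (sym eq) (ℕₚ.+-monoˡ-≤ (d (suc l)) lt))))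
    ... | suc zero = scanB fuel l (suc l) (subst (n ℕ.≤_) (ℕₚ.+-suc l fuel) n≤) ℕₚ.≤-refl eq (λ t a b → ⊥-elim (ℕₚ.<⇒≱ a (ℕₚ.≤-pred b))) sup next
      where
      1≤dl : 1 ℕ.≤ d l
      1≤dl = ℕₚ.≤-trans (s≤s z≤n) lt
      next : d l ℕ.≤ d (suc l)
      next = slide l (subst (λ c → prev d l ℕ.+ c ℕ.≤ d l) (sym eq) (subst (ℕ._≤ d l) (ℕₚ.+-comm 1 (prev d l)) lt))
      sup : ∀ t → l ℕ.≤ t → t ℕ.≤ suc l → 1 ℕ.≤ d t
      sup t a b with t ℕₚ.≟ suc l
      ... | yes refl = ℕₚ.≤-trans 1≤dl next
      ... | no t≢ = subst (λ t → 1 ℕ.≤ d t) (ℕₚ.≤-antisym a (ℕₚ.≤-pred (ℕₚ.≤∧≢⇒< b t≢))) 1≤dl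

    start : ∀ l → 1 ℕ.≤ d l → ∃ λ l' → prev d l' ℕ.< d l'
    start zero h = zero , h
    start (suc l) h with d l in eq
    ... | zero = suc l , subst (ℕ._< d (suc l)) (sym eq) h
    ... | suc k = start l (subst (1 ℕ.≤_) (sym eq) (s≤s z≤n))

  find-pattern : ∀ l → 1 ℕ.≤ d l → Σ ℕ λ i → Σ ℕ λ k → Pattern m i k × (∀ l → segment i k l ℕ.≤ d l)
  find-pattern l h = let l' , lt = start l h in scanA n l' (ℕₚ.m≤n+m n l') lt

Pattern-≤ : ∀ {m i k} → Pattern m i k → i ℕ.≤ k
Pattern-≤ (inj₁ (refl , _)) = ℕₚ.≤-refl
Pattern-≤ (inj₂ (i<k , _)) = ℕₚ.<⇒≤ i<k

segment-1⇒in : ∀ {i k l} → 1 ℕ.≤ segment i k l → i ℕ.≤ l × l ℕ.≤ k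
segment-1⇒in {i} {k} {l} h with i ℕₚ.≤? l | l ℕₚ.≤? k
... | yes a | yes b = a , b
... | no a | _ = ⊥-elim (ℕₚ.1+n≰n (ℕₚ.≤-trans h (ℕₚ.≤-reflexive (segment-out {i} {k} {l} (a ∘ proj₁)))))
... | yes _ | no b = ⊥-elim (ℕₚ.1+n≰n (ℕₚ.≤-trans h (ℕₚ.≤-reflexive (segment-out {i} {k} {l} (b ∘ proj₂)))))

-- Inside 1, 0, ..., 0, 1 no pairing reaches 2, and the only nonzero pairings sit at the two ends. A
-- one-element segment has no proper nonempty part.
Pattern-antichain : ∀ {m i k i' k'} → Pattern m i k → Pattern m i' k' → (∀ l → segment i' k' l ℕ.≤ segment i k l) → i ≡ i' × k ≡ k'
Pattern-antichain {m} {i} {k} {i'} {k'} P P' sub = go P P' (inside′ i' ℕₚ.≤-refl (Pattern-≤ P')) (inside′ k' (Pattern-≤ P') ℕₚ.≤-refl)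
  where
  inside′ : ∀ l → i' ℕ.≤ l → l ℕ.≤ k' → i ℕ.≤ l × l ℕ.≤ k
  inside′ l a b = segment-1⇒in (ℕₚ.≤-trans (ℕₚ.≤-reflexive (sym (segment-in a b))) (sub l))
  place : m i ≡ 1 → m k ≡ 1 → (∀ l → i ℕ.< l → l ℕ.< k → m l ≡ 0) → ∀ l → i ℕ.≤ l × l ℕ.≤ k → (l ≡ i × m l ≡ 1) ⊎ (l ≡ k × m l ≡ 1) ⊎ m l ≡ 0
  place mi mk mid l (a , b) with l ℕₚ.≟ i | l ℕₚ.≟ k
  ... | yes refl | _ = inj₁ (refl , mi)
  ... | no _ | yes refl = inj₂ (inj₁ (refl , mk))
  ... | no l≢i | no l≢k = inj₂ (inj₂ (mid l (ℕₚ.≤∧≢⇒< a (l≢i ∘ sym)) (ℕₚ.≤∧≢⇒< b l≢k)))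
  small : ∀ {c} → m i' ≡ c → c ℕ.≤ 1 → 2 ℕ.≤ m i' → ⊥
  small e c≤1 2≤ = ℕₚ.1+n≰n (ℕₚ.≤-trans 2≤ (ℕₚ.≤-trans (ℕₚ.≤-reflexive e) c≤1))
  go : Pattern m i k → Pattern m i' k' → i ℕ.≤ i' × i' ℕ.≤ k → i ℕ.≤ k' × k' ℕ.≤ k → i ≡ i' × k ≡ k'
  go (inj₁ (refl , _)) _ (a , b) (c , e) = ℕₚ.≤-antisym a b , ℕₚ.≤-antisym c e
  go (inj₂ (_ , mi , mk , mid)) (inj₁ (refl , 2≤)) in₁ in₂ with place mi mk mid i' in₁
  ... | inj₁ (_ , e) = ⊥-elim (small e ℕₚ.≤-refl 2≤)
  ... | inj₂ (inj₁ (_ , e)) = ⊥-elim (small e ℕₚ.≤-refl 2≤)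
  ... | inj₂ (inj₂ e) = ⊥-elim (small e z≤n 2≤)
  go (inj₂ (_ , mi , mk , mid)) (inj₂ (i'<k' , mi' , mk' , _)) in₁ in₂ with place mi mk mid i' in₁ | place mi mk mid k' in₂
  ... | inj₁ (refl , _) | inj₂ (inj₁ (refl , _)) = refl , refl
  ... | inj₁ (refl , _) | inj₁ (refl , _) = ⊥-elim (ℕₚ.<-irrefl refl i'<k')
  ... | inj₁ (refl , _) | inj₂ (inj₂ e) = ⊥-elim (ℕₚ.0≢1+n (trans (sym e) mk'))
  ... | inj₂ (inj₁ (refl , _)) | _ = ⊥-elim (ℕₚ.<⇒≱ i'<k' (proj₂ in₂))
  ... | inj₂ (inj₂ e) | _ = ⊥-elim (ℕₚ.0≢1+n (trans (sym e) mi'))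

-- On the segment the left side is 2. It is covered by the pairing alone for a single root, by a
-- pairing 1 and one neighbour at an end, and by two neighbours in the interior.
Pattern-dominant : ∀ {m i k} → Pattern m i k → ∀ l → segment i k l ℕ.+ segment i k l ℕ.≤ m l ℕ.+ prev (segment i k) l ℕ.+ segment i k (suc l)
Pattern-dominant {m} {i} {k} P l with (i ℕₚ.≤? l) ×-dec (l ℕₚ.≤? k)
... | no out = subst (λ c → c ℕ.+ c ℕ.≤ m l ℕ.+ prev (segment i k) l ℕ.+ segment i k (suc l)) (sym (segment-out {i} {k} {l} out)) z≤n
... | yes (a , b) = subst (λ c → c ℕ.+ c ℕ.≤ m l ℕ.+ prev (segment i k) l ℕ.+ segment i k (suc l)) (sym (segment-in a b)) (go P)
  where
  right : l ℕ.< k → segment i k (suc l) ≡ 1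
  right l<k = segment-in (ℕₚ.m≤n⇒m≤1+n a) l<k
  left : ∀ l → i ℕ.< l → l ℕ.≤ k → prev (segment i k) l ≡ 1
  left (suc l) (s≤s i≤l) l≤k = segment-in i≤l (ℕₚ.<⇒≤ l≤k)
  at : ∀ {x y z} → 2 ℕ.≤ x ℕ.+ y ℕ.+ z → m l ≡ x → prev (segment i k) l ≡ y → segment i k (suc l) ≡ z → 2 ℕ.≤ m l ℕ.+ prev (segment i k) l ℕ.+ segment i k (suc l)
  at h refl refl refl = h
  go : Pattern m i k → 2 ℕ.≤ m l ℕ.+ prev (segment i k) l ℕ.+ segment i k (suc l)
  go (inj₁ (refl , 2≤)) = ℕₚ.≤-trans (subst (λ l → 2 ℕ.≤ m l) (ℕₚ.≤-antisym a b) 2≤) (ℕₚ.≤-trans (ℕₚ.m≤m+n (m l) _) (ℕₚ.m≤m+n _ _))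
  go (inj₂ (i<k , mi , mk , mid)) with l ℕₚ.≟ i | l ℕₚ.≟ k
  ... | yes refl | _ = ℕₚ.≤-trans (ℕₚ.≤-reflexive (cong₂ ℕ._+_ (sym mi) (sym (right i<k)))) (ℕₚ.+-monoˡ-≤ (segment i k (suc l)) (ℕₚ.m≤m+n (m l) _))
  ... | no l≢i | yes refl = ℕₚ.≤-trans (ℕₚ.≤-reflexive (cong₂ ℕ._+_ (sym mk) (sym (left l (ℕₚ.≤∧≢⇒< a (l≢i ∘ sym)) b)))) (ℕₚ.m≤m+n _ _)
  ... | no l≢i | no l≢k = at (s≤s (s≤s z≤n)) (mid l il lk) (left l il b) (right lk)
    where
    il : i ℕ.< l
    il = ℕₚ.≤∧≢⇒< a (l≢i ∘ sym)
    lk : l ℕ.< k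
    lk = ℕₚ.≤∧≢⇒< b l≢k

rootsum-diff : ∀ {n} e (r : Fin n) → rootsum e (inject₁ r) - rootsum e (suc r) ≡ + (e (toℕ r) ℕ.+ e (toℕ r)) - + (prev e (toℕ r) ℕ.+ e (suc (toℕ r)))
rootsum-diff e r = trans (cong (λ k → + e k - + prev e k - rootsum e (suc r)) (Finₚ.toℕ-inject₁ r)) (ring (+ e (toℕ r)) (+ prev e (toℕ r)) (+ e (suc (toℕ r))))
  where
  ring : ∀ a b c → a - b - (c - a) ≡ a + a - (b + c)
  ring = solve-∀

≤D⇒rootsum : ∀ {n} (x y : Pt n) (x≤y : x ≤D y) → ∀ p → y p ℚ.- x p ≡ ⟦ rootsum (ext (proj₁ x≤y)) p ⟧
≤D⇒rootsum x y (d , h) p = trans (h p) (αsum d p)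

rootsum-injective : ∀ {n} {e e' : ℕ → ℕ} → (∀ (p : Fin (suc n)) → rootsum e p ≡ rootsum e' p) → ∀ l → l ℕ.≤ n → e l ≡ e' l
rootsum-injective {n} {e} {e'} h l l≤n = ℤₚ.+-injective (trans (sym (psum-rootsum {suc n} e (suc l) (s≤s l≤n)))
  (trans (psum-cong (suc l) h) (psum-rootsum {suc n} e' (suc l) (s≤s l≤n))))

rootsum-+ : ∀ {m} (e e' : ℕ → ℕ) (p : Fin m) → rootsum e p + rootsum e' p ≡ rootsum (λ l → e l ℕ.+ e' l) p
rootsum-+ e e' p = trans (ring (+ e (toℕ p)) (+ prev e (toℕ p)) (+ e' (toℕ p)) (+ prev e' (toℕ p))) (cong (λ c → + (e (toℕ p) ℕ.+ e' (toℕ p)) - + c) (prev-+ (toℕ p)))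
  where
  ring : ∀ a b c d → a - b + (c - d) ≡ a + c - (b + d)
  ring = solve-∀
  prev-+ : ∀ l → prev e l ℕ.+ prev e' l ≡ prev (λ l → e l ℕ.+ e' l) l
  prev-+ zero = refl
  prev-+ (suc l) = refl

rootsum-zero : ∀ {n} {e : ℕ → ℕ} → (∀ l → l ℕ.≤ n → e l ≡ 0) → ∀ (p : Fin (suc n)) → rootsum e p ≡ 0ℤ
rootsum-zero {n} {e} h p = cong₂ (λ a b → + a - + b) (h (toℕ p) (ℕₚ.≤-pred (Finₚ.toℕ<n p))) (prev0 (toℕ p) (ℕₚ.≤-pred (Finₚ.toℕ<n p)))
  where
  prev0 : ∀ l → l ℕ.≤ n → prev e l ≡ 0
  prev0 zero _ = refl
  prev0 (suc l) l<n = h l (ℕₚ.<⇒≤ l<n)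

Weight-≤D : ∀ {n} (x y : Pt n) {z : Window n} → Weight y z → (x≤y : x ≤D y) → Weight x (lowered (ext (proj₁ x≤y)) z)
Weight-≤D {n} x y {z} W x≤y = Weight-cong (λ p → trans (cong (λ w → y p ℚ.- w) (sym (≤D⇒rootsum x y x≤y p))) (ring (x p) (y p))) (λ p → refl)
  (Weight-below (ext (proj₁ x≤y)) (ext-out (proj₁ x≤y) n ℕₚ.≤-refl) W)
  where
  ring : ∀ x y → y ℚ.- (y ℚ.- x) ≡ x
  ring = RS.solve-∀ ℚring

-- Dominance of x = y - Σ d_r α_r reads m_r - 2 d_r + d_{r-1} + d_{r+1} ≥ 0, the concavity required
-- by `find-pattern`; since x ≠ y, some d_r is positive.
<D⇒pattern : ∀ {n} (x y : Pt n) {z m} → Weight y z → Pairing z m → InΛplus x → (x≤y : x ≤D y) → ¬ (x ≗ₚ y) →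
  Σ ℕ λ i → Σ ℕ λ k → Pattern m i k × (∀ l → segment i k l ℕ.≤ ext (proj₁ x≤y) l)
<D⇒pattern {n} x y {z} {m} W pair xΛ x≤y x≢y = start (Finₚ.any? (λ r → 1 ℕₚ.≤? d r))
  where
  d : Fin n → ℕ
  d = proj₁ x≤y
  D : ℕ → ℕ
  D = ext d
  m' : ℕ → ℕ
  m' = pairings x xΛ
  pair' : Pairing (lowered D z) m'
  pair' = Weight⇒Pairing (Weight-≤D x y W x≤y) (pairings-correct x xΛ)
  balance : ∀ r → + m (toℕ r) - (rootsum D (inject₁ r) - rootsum D (suc r)) ≡ + m' (toℕ r)
  balance r = *N-cancel-≡ n (+ m (toℕ r) - (rootsum D (inject₁ r) - rootsum D (suc r))) (+ m' (toℕ r)) (trans (ring₁ (z (suc r)) (+ m (toℕ r)) (rootsum D (inject₁ r)) (rootsum D (suc r)) (N n))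
    (trans (cong (λ w → w - rootsum D (inject₁ r) * N n - (z (suc r) - rootsum D (suc r) * N n)) (sym (paired pair r)))
      (trans (cong (_- (z (suc r) - rootsum D (suc r) * N n)) (paired pair' r)) (ring₂ (z (suc r) - rootsum D (suc r) * N n) (+ m' (toℕ r) * N n)))))
    where
    ring₁ : ∀ z m a b N → (m - (a - b)) * N ≡ z + m * N - a * N - (z - b * N)
    ring₁ = solve-∀
    ring₂ : ∀ a b → a + b - a ≡ b
    ring₂ = solve-∀
  conc : ∀ l → D l ℕ.+ D l ℕ.≤ m l ℕ.+ prev D l ℕ.+ D (suc l)
  conc l with l ℕₚ.<? n
  ... | no l≮n = subst (λ c → c ℕ.+ c ℕ.≤ m l ℕ.+ prev D l ℕ.+ D (suc l)) (sym (ext-out d l (ℕₚ.≮⇒≥ l≮n))) z≤n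
  ... | yes l<n = subst (λ l → D l ℕ.+ D l ℕ.≤ m l ℕ.+ prev D l ℕ.+ D (suc l)) (Finₚ.toℕ-fromℕ< l<n) (at (fromℕ< l<n))
    where
    at : ∀ r → D (toℕ r) ℕ.+ D (toℕ r) ℕ.≤ m (toℕ r) ℕ.+ prev D (toℕ r) ℕ.+ D (suc (toℕ r))
    at r = ℤₚ.drop‿+≤+ (lin≤ (subst (0ℤ ≤_) (trans (sym (balance r)) (cong (λ w → + m (toℕ r) - w) (rootsum-diff D r))) (ℤ.+≤+ z≤n))
      (ring (+ m (toℕ r)) (+ prev D (toℕ r)) (+ D (suc (toℕ r))) (+ (D (toℕ r) ℕ.+ D (toℕ r)))))
      where
      ring : ∀ m p s e → m + p + s - e ≡ m - (e - (p + s))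
      ring = solve-∀
  start : Dec (∃ λ r → 1 ℕ.≤ d r) → Σ ℕ λ i → Σ ℕ λ k → Pattern m i k × (∀ l → segment i k l ℕ.≤ ext d l)
  start (yes (r , 1≤)) = find-pattern n m D (ext-out d) conc (toℕ r) (subst (1 ℕ.≤_) (sym (ext-toℕ d r)) 1≤)
  start (no none) = ⊥-elim (x≢y λ p → sym (trans (ring (x p) (y p)) (trans (cong (λ w → x p ℚ.+ w) (trans (≤D⇒rootsum x y x≤y p) (trans (cong ⟦_⟧ (rootsum-zero D0 p)) ⟦⟧-0))) (ℚₚ.+-identityʳ (x p)))))
    where
    ring : ∀ x y → y ≡ x ℚ.+ (y ℚ.- x)
    ring = RS.solve-∀ ℚring
    D0 : ∀ l → l ℕ.≤ n → D l ≡ 0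
    D0 l _ with l ℕₚ.<? n
    ... | no l≮n = ext-out d l (ℕₚ.≮⇒≥ l≮n)
    ... | yes l<n = trans (cong D (sym (Finₚ.toℕ-fromℕ< l<n))) (trans (ext-toℕ d (fromℕ< l<n)) (zero-of (fromℕ< l<n)))
      where
      zero-of : ∀ r → d r ≡ 0
      zero-of r with d r in eq
      ... | zero = refl
      ... | suc c = ⊥-elim (none (r , subst (1 ℕ.≤_) (sym eq) (s≤s z≤n)))

module _ {n : ℕ} {x : Pt n} (xΛ : InΛplus x) where
  private
    m : ℕ → ℕ
    m = pairings x xΛ
    Wx : ∃ (Weight x)
    Wx = Λ-weight x xΛ

  Pattern-range : ∀ {i k} → Pattern m i k → ∀ l → n ℕ.≤ l → segment i k l ≡ 0
  Pattern-range {i} {k} P l n≤l = segment-out {i} {k} {l} λ (_ , l≤k) → ℕₚ.<⇒≱ (k<n P) (ℕₚ.≤-trans n≤l l≤k)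
    where
    k<n : Pattern m i k → k ℕ.< n
    k<n (inj₁ (refl , 2≤)) = ext-pos⇒< (λ r → proj₁ (proj₂ xΛ r)) k (ℕₚ.<⇒≤ 2≤)
    k<n (inj₂ (_ , _ , mk , _)) = ext-pos⇒< (λ r → proj₁ (proj₂ xΛ r)) k (ℕₚ.≤-reflexive (sym mk))

  Pattern-weight : ∀ {z i k} → Weight x z → Pattern m i k → Weight (below (segment i k) x) (lowered (segment i k) z)
  Pattern-weight {z} {i} {k} W P = Weight-below (segment i k) (Pattern-range P n ℕₚ.≤-refl) W

  below-Λ : ∀ {i k} → Pattern m i k → InΛplus (below (segment i k) x)
  below-Λ {i} {k} P = in-E (Pattern-weight (proj₂ Wx) P) , λ r → pairing′ r
    where
    e : ℕ → ℕ
    e = segment i k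
    ring₁ : ∀ a b s t → a ℚ.- s ℚ.- (b ℚ.- t) ≡ a ℚ.- b ℚ.- (s ℚ.- t)
    ring₁ = RS.solve-∀ ℚring
    ring₂ : ∀ m p s e → m - (e - (p + s)) ≡ m + p + s - e
    ring₂ = solve-∀
    pairing′ : ∀ r → Σ ℕ λ c → pairα (below e x) r ≡ ℕ→ℚ c
    pairing′ r = c , trans (ring₁ (x (inject₁ r)) (x (suc r)) ⟦ rootsum e (inject₁ r) ⟧ ⟦ rootsum e (suc r) ⟧)
        (trans (cong₂ ℚ._-_ (pairings-correct x xΛ r) (sym (⟦⟧-minus (rootsum e (inject₁ r)) (rootsum e (suc r)))))
        (trans (sym (⟦⟧-minus (+ m R) (rootsum e (inject₁ r) - rootsum e (suc r)))) (trans (cong ⟦_⟧ val) (⟦⟧≡ (+ c)))))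
      where
      R c : ℕ
      R = toℕ r
      c = (m R ℕ.+ prev e R ℕ.+ e (suc R)) ℕ.∸ (e R ℕ.+ e R)
      val : + m R - (rootsum e (inject₁ r) - rootsum e (suc r)) ≡ + c
      val = trans (cong (λ w → + m R - w) (rootsum-diff e r)) (trans (ring₂ (+ m R) (+ prev e R) (+ e (suc R)) (+ (e R ℕ.+ e R)))
        (trans (ℤₚ.[+m]-[+n]≡m⊖n (m R ℕ.+ prev e R ℕ.+ e (suc R)) (e R ℕ.+ e R)) (ℤₚ.⊖-≥ (Pattern-dominant P R))))

  -- For an intermediate ν, the difference x - ν again contains the roots of a pattern, and these
  -- lie in the segment. Nested patterns coincide, so nothing remains between ν and the lower
  -- weight.
  Pattern⇒cover : ∀ {i k} → Pattern m i k → below (segment i k) x ⋖ x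
  Pattern⇒cover {i} {k} P = below-Λ P , xΛ , (low , strict) , none
    where
    e : ℕ → ℕ
    e = segment i k
    ring₀ : ∀ a b → a ℚ.- (a ℚ.- b) ≡ b
    ring₀ = RS.solve-∀ ℚring
    low : below e x ≤D x
    low = (λ r → e (toℕ r)) , λ p → trans (ring₀ (x p) ⟦ rootsum e p ⟧) (sym (trans (αsum (λ r → e (toℕ r)) p)
      (cong ⟦_⟧ (rootsum-cong (ext-restrict e (Pattern-range P)) p))))
    1≤e : ∀ l → i ℕ.≤ l → l ℕ.≤ k → e l ≡ 1
    1≤e l a b = segment-in a b
    k≤n : k ℕ.≤ n
    k≤n = ℕₚ.≮⇒≥ λ n<k → ℕₚ.1+n≢0 (trans (sym (1≤e k (Pattern-≤ P) ℕₚ.≤-refl)) (Pattern-range P k (ℕₚ.<⇒≤ n<k)))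
    strict : ¬ (below e x ≗ₚ x)
    strict h = ℕₚ.1+n≢0 (trans (sym (1≤e k (Pattern-≤ P) ℕₚ.≤-refl)) (rootsum-injective {n} {e} {λ _ → 0}
      (λ p → trans (⟦⟧-injective (trans (sym (ring₀ (x p) ⟦ rootsum e p ⟧)) (trans (cong (λ w → x p ℚ.- w) (h p)) (trans (ℚₚ.+-inverseʳ (x p)) (sym ⟦⟧-0))))) (sym (rootsum-zero {n} {λ _ → 0} (λ _ _ → refl) p))) k k≤n))
    none : ¬ (Σ (Pt n) λ ν → InΛplus ν × below e x <D ν × ν <D x)
    none (ν , νΛ , (b≤ν , b≢ν) , (ν≤x , ν≢x)) = fromPattern (<D⇒pattern ν x (proj₂ Wx) (Weight⇒Pairing (proj₂ Wx) (pairings-correct x xΛ)) νΛ ν≤x ν≢x)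
      where
      D₁ D₂ : ℕ → ℕ
      D₁ = ext (proj₁ b≤ν)
      D₂ = ext (proj₁ ν≤x)
      ring₁ : ∀ a b ν → a ℚ.- b ≡ ν ℚ.- b ℚ.+ (a ℚ.- ν)
      ring₁ = RS.solve-∀ ℚring
      split : ∀ l → l ℕ.≤ n → e l ≡ D₁ l ℕ.+ D₂ l
      split = rootsum-injective {n} {e} {λ l → D₁ l ℕ.+ D₂ l} λ p → ⟦⟧-injective (trans (sym (ring₀ (x p) ⟦ rootsum e p ⟧))
        (trans (ring₁ (x p) (below e x p) (ν p)) (trans (cong₂ ℚ._+_ (≤D⇒rootsum (below e x) ν b≤ν p) (≤D⇒rootsum ν x ν≤x p))
          (trans (sym (⟦⟧-+ (rootsum D₁ p) (rootsum D₂ p))) (cong ⟦_⟧ (rootsum-+ D₁ D₂ p))))))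
      D₂≤e : ∀ l → D₂ l ℕ.≤ e l
      D₂≤e l with l ℕₚ.≤? n
      ... | yes l≤n = ℕₚ.≤-trans (ℕₚ.m≤n+m (D₂ l) (D₁ l)) (ℕₚ.≤-reflexive (sym (split l l≤n)))
      ... | no l≰n = subst (ℕ._≤ e l) (sym (ext-out (proj₁ ν≤x) l (ℕₚ.<⇒≤ (ℕₚ.≰⇒> l≰n)))) z≤n
      fromPattern : (Σ ℕ λ i' → Σ ℕ λ k' → Pattern m i' k' × (∀ l → segment i' k' l ℕ.≤ D₂ l)) → ⊥
      fromPattern (i' , k' , P' , sub) = b≢ν λ p → sym (trans (ring₂ (below e x p) (ν p)) (trans (cong (λ w → below e x p ℚ.+ w)
          (trans (≤D⇒rootsum (below e x) ν b≤ν p) (trans (cong ⟦_⟧ (rootsum-zero D₁0 p)) ⟦⟧-0))) (ℚₚ.+-identityʳ (below e x p))))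
        where
        ring₂ : ∀ x y → y ≡ x ℚ.+ (y ℚ.- x)
        ring₂ = RS.solve-∀ ℚring
        same : i ≡ i' × k ≡ k'
        same = Pattern-antichain P P' (λ l → ℕₚ.≤-trans (sub l) (D₂≤e l))
        e≤D₂ : ∀ l → e l ℕ.≤ D₂ l
        e≤D₂ l = ℕₚ.≤-trans (ℕₚ.≤-reflexive (cong₂ (λ i k → segment i k l) (proj₁ same) (proj₂ same))) (sub l)
        D₁0 : ∀ l → l ℕ.≤ n → D₁ l ≡ 0
        D₁0 l l≤n = ℕₚ.n≤0⇒n≡0 (ℕₚ.+-cancelʳ-≤ (D₂ l) (D₁ l) 0 (ℕₚ.≤-trans (ℕₚ.≤-reflexive (sym (split l l≤n))) (e≤D₂ l)))


-- Lower intervals and paper boats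

⊑-respʳ : ∀ {n} {x y y' : Window n} → (∀ p → y p ≡ y' p) → x ⊑ y → x ⊑ y'
⊑-respʳ {n} {x} {y} {y'} h le j j' = subst (Φ x j j' ℕ.≤_) (trans (Φ≡ y j j') (trans (ℕΣ.sum-cong-≗ λ p → cong (λ w → pos (fl n (w + j) - fl n (ι p + j'))) (h p)) (sym (Φ≡ y' j j')))) (le j j')

window-injective-entries : ∀ {n} {x : Aff n} → Good x → ∀ {p q} → window x p ≡ window x q → p ≡ q
window-injective-entries {n} gx {p} {q} eq = separate (window-distinct gx) p q (divides 0ℤ (trans (ℤₚ.i≡j⇒i-j≡0 eq) (sym (ℤₚ.*-zeroˡ (N n)))))

sorted : ∀ {n} {x : Aff n} → Good x → Window n
sorted {x = x} gx = Ranking.sorted (window x) (window-injective-entries gx)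

module PaperBoats {n : ℕ} (1≤n : 1 ℕ.≤ n) {a : Aff n} (aF : InF a) where

  b : Window n
  b = window (w₀ ∘ₐ a)

  gb : Good (w₀ ∘ₐ a)
  gb = good-∘ good-w₀ (InWaff⇒Good (proj₁ aF))

  module _ {x : Pt n} {z : Window n} (W : Weight x z) where

    top : Window n
    top p = b p + z p

    opaque
      θ : Aff n
      θ = unwindow top

      θ-window : ∀ p → window θ p ≡ top p
      θ-window = window-unwindow top

      θ-good : Good θ
      θ-good = unwindow-good top (translate-distinct W (window-distinct gb)) (trans (translate-sum {g = b} W) (window-sum gb))

    θ-isTheta : IsTheta a x θ
    θ-isTheta = Good⇒InWaff 1≤n θ-good , translate-SameSet θ-good gb W θ-window

    InI⇒⊑ : ∀ {w} → InI a x w → window w ⊑ top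
    InI⇒⊑ {w} (_ , t , (tW , same) , w≤t) = ⊑-respʳ (SameSet⇒window (InWaff⇒Good tW) gb W same) (≤B⇒⊑ 1≤n w≤t)

    θ-word : Word 1≤n θ
    θ-word = word 1≤n θ-good

    subword⇒InI : ∀ {us} → us ⊆ letters θ-word → InI a x (evalR 1≤n us)
    subword⇒InI {us} sub = Good⇒InWaff 1≤n (evalR-good 1≤n us) , θ , θ-isTheta , subword⇒≤B 1≤n θ-word sub

    ⊑⇒subword : ∀ {w} → Good w → window w ⊑ top → Σ (List (SGen n)) λ us → us ⊆ letters θ-word × evalR 1≤n us ≡ w
    ⊑⇒subword gw le = lower θ-word gw (⊑-respʳ (λ p → sym (θ-window p)) le)

    ⊑⇒InI : ∀ {w} → Good w → window w ⊑ top → InI a x w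
    ⊑⇒InI {w} gw le = let us , sub , eq = ⊑⇒subword gw le in subst (InI a x) eq (subword⇒InI sub)

    -- Only the sorted window of `w` enters. Left multiplication by W_f permutes the entries, so
    -- with `InI⇒Dom` the interval of a dominant weight is stable under it.
    Dom⇒InI : ∀ {w} (gw : Good w) → Dom (sorted gw) top → InI a x w
    Dom⇒InI {w} gw d = ⊑⇒InI gw (Dom⇒⊑ {x = window w} {y = top} (Perm.flip (Ranking.rankπ (window w) (window-injective-entries gw)))
      (strict⇒decreasing {h = sorted gw} (Ranking.sorted-strict (window w) (window-injective-entries gw))) d)

    InI⇒Dom : ∀ {m w} → Pairing z m → (gw : Good w) → InI a x w → Dom (sorted gw) top
    InI⇒Dom {m} {w} pair gw h = ⊑⇒Dom {x = window w} {y = top} (Perm.flip (Ranking.rankπ (window w) (window-injective-entries gw))) top-decreasing (InI⇒⊑ h)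
      where
      ring : ∀ x y s t → x + (t + s) - (1ℤ + (y + t)) ≡ x - (1ℤ + y) + s
      ring = solve-∀
      top-decreasing : Decreasing top
      top-decreasing = strict⇒decreasing (adjacent⇒strict top λ r → lin< (gap< (InF⇒strict aF {inject₁ r} {suc r} (s≤s (ℕₚ.≤-reflexive (Finₚ.toℕ-inject₁ r)))) ⊕ 0≤*N n (m (toℕ r)))
        (trans (cong (λ w → b (inject₁ r) + w - (1ℤ + (b (suc r) + z (suc r)))) (paired pair r)) (ring (b (inject₁ r)) (b (suc r)) (+ m (toℕ r) * N n) (z (suc r)))))

  lowered-top : ∀ (z : Window n) e p → b p + lowered e z p ≡ lowered e (λ p → b p + z p) p
  lowered-top z e p = ring (b p) (z p) (rootsum e p * N n)
    where
    ring : ∀ b z x → b + (z - x) ≡ b + z - x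
    ring = solve-∀

  module _ {x : Pt n} (xΛ : InΛplus x) {z : Window n} (W : Weight x z) where
    private
      m : ℕ → ℕ
      m = pairings x xΛ
      pair : Pairing z m
      pair = Weight⇒Pairing W (pairings-correct x xΛ)

    PB⇒Boat : ∀ {w} (gw : Good w) → InPB a x w → Boat (sorted gw) (λ p → b p + z p) m
    PB⇒Boat gw (ins , out) = boat (InI⇒Dom W pair gw ins) λ i k P d → out (below (segment i k) x , Pattern⇒cover xΛ P ,
      Dom⇒InI (Pattern-weight xΛ W P) gw (Dom-cong (λ p → refl) (λ p → sym (lowered-top z (segment i k) p)) d))

    -- A dominant μ below x subtracts at least the roots of some pattern, so its partial sums are at
    -- most those of the weight lowered by that pattern alone. Lying below μ thus contradicts
    -- `outside`.
    Boat⇒PB : ∀ {w} (gw : Good w) → Boat (sorted gw) (λ p → b p + z p) m → InPB a x w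
    Boat⇒PB {w} gw (boat ins out) = Dom⇒InI W gw ins , λ (μ , (μΛ , _ , (μ≤x , μ≢x) , _) , h) → refute μ μΛ μ≤x μ≢x h
      where
      refute : ∀ μ → InΛplus μ → (μ≤x : μ ≤D x) → ¬ (μ ≗ₚ x) → InI a μ w → ⊥
      refute μ μΛ μ≤x μ≢x h = fromPattern (<D⇒pattern μ x W pair μΛ μ≤x μ≢x)
        where
        D : ℕ → ℕ
        D = ext (proj₁ μ≤x)
        Wμ : Weight μ (lowered D z)
        Wμ = Weight-≤D μ x W μ≤x
        dμ : Dom (sorted gw) (lowered D (λ p → b p + z p))
        dμ = Dom-cong (λ p → refl) (λ p → lowered-top z D p) (InI⇒Dom Wμ (Weight⇒Pairing {m = pairings μ μΛ} Wμ (pairings-correct μ μΛ)) gw h)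
        prev-mono : ∀ {e e' : ℕ → ℕ} → (∀ l → e l ℕ.≤ e' l) → ∀ k → prev e k ℕ.≤ prev e' k
        prev-mono h zero = z≤n
        prev-mono h (suc k) = h k
        fromPattern : (Σ ℕ λ i → Σ ℕ λ k → Pattern m i k × (∀ l → segment i k l ℕ.≤ D l)) → ⊥
        fromPattern (i , k , P , sub) = out i k P (dom λ j c c≤ → ℤₚ.≤-trans (dominates dμ j c c≤)
          (subst₂ _≤_ (sym (psum-lowered D (λ p → b p + z p) j c c≤)) (sym (psum-lowered (segment i k) (λ p → b p + z p) j c c≤))
            (ℤₚ.+-monoʳ-≤ (psum c (V j (λ p → b p + z p))) (ℤₚ.neg-mono-≤ (ℤ.+≤+ (prev-mono sub c))))))

-- Transport between the paper boats of two weights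

opaque
  -- An alcove in the chamber u(C^+) is translated by u(λ' - λ): reading z' - z at the rank of each
  -- entry applies the permutation u. On sorted windows the map is plain translation.
  transport : ∀ {n} → (z z' : Window n) → Aff n → Aff n
  transport z z' w = unwindow λ p → window w p + (z' (rank (window w) p) - z (rank (window w) p))

  transport-window : ∀ {n} (z z' : Window n) w p → window (transport z z' w) p ≡ window w p + (z' (rank (window w) p) - z (rank (window w) p))
  transport-window z z' w p = window-unwindow (λ p → window w p + (z' (rank (window w) p) - z (rank (window w) p))) p

module _ {n : ℕ} {x x' : Pt n} {z z' : Window n} (W : Weight x z) (W' : Weight x' z') {w : Aff n} (gw : Good w) where
  private
    g G : Window n
    g = window w
    G p = g p + (z' (rank g p) - z (rank g p))
    Wv : Weight (λ p → x' p ℚ.+ ℚ.- x p) (λ p → z' p + - z p)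
    Wv = Weight-+ W' (Weight-neg W)
    inj : ∀ {p q} → g p ≡ g q → p ≡ q
    inj = window-injective-entries gw

  opaque
    unfolding transport

    transport-good : Good (transport z z' w)
    transport-good = unwindow-good G
      (distinct λ p q d → let c , ez , _ = zdiff Wv (rank g p) (rank g q) in
        separate (window-distinct gw) p q (dvd (∣m∣n⇒∣m-n d (divides c ez)) (ring (g p) (g q) (z' (rank g p) - z (rank g p)) (z' (rank g q) - z (rank g q)))))
      (trans (ℤΣ.∑-distrib-+ g (λ p → v (rank g p))) (trans (cong₂ _+_ (window-sum gw) Σv) (ℤₚ.+-identityʳ (ℤΣ.sum (ι {n})))))
      where
      ring : ∀ a b s t → a - b ≡ a + s - (b + t) - (s - t)
      ring = solve-∀
      v : Window n
      v s = z' s - z s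
      π : Permutation (suc n) (suc n)
      π = Ranking.rankπ g inj
      Σv : ℤΣ.sum (λ p → v (rank g p)) ≡ 0ℤ
      Σv = trans (ℤΣ.sum-cong-≗ {suc n} (λ p → cong v (sym (Ranking.rankπ≡ g inj p)))) (trans (sym (ℤΣ.sum-permute v π)) (zsum Wv))

  module _ (strict : ∀ {p q} → p Fin.< q → sorted gw q + (z' q - z q) < sorted gw p + (z' p - z p)) where
    private
      w' : Aff n
      w' = transport z z' w
      gs' : Window n
      gs' s = sorted gw s + (z' s - z s)
      factor : ∀ p → window w' p ≡ gs' (rank g p)
      factor p = trans (transport-window z z' w p) (cong (λ c → c + (z' (rank g p) - z (rank g p))) (sym (Ranking.sorted-rank g inj p)))
      forth : ∀ p q → g p < g q → window w' p < window w' q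
      forth p q lt = subst₂ _<_ (sym (factor p)) (sym (factor q)) (strict (Ranking.rank-anti g lt))
      back : ∀ p q → window w' p < window w' q → g p < g q
      back p q lt = go (ℤₚ.<-cmp (g p) (g q))
        where
        go : _ → g p < g q
        go (tri< h _ _) = h
        go (tri≈ _ e _) = ⊥-elim (ℤₚ.<-irrefl (cong (window w') (inj e)) lt)
        go (tri> _ _ h) = ⊥-elim (ℤₚ.<-asym lt (forth q p h))

    -- The translated sorted window is still strictly decreasing, so the order of the entries has
    -- not changed. With equal ranks the reverse transport subtracts exactly what was added.
    transport-rank : ∀ p → rank (window w) p ≡ rank (window (transport z z' w)) p
    transport-rank = rank-cong g (window w') forth back

    transport-sorted : ∀ s → sorted transport-good s ≡ sorted gw s + (z' s - z s)
    transport-sorted s = trans (factor p') (cong gs' (trans (transport-rank p') (Ranking.rank-unsorted (window w') inj' s)))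
      where
      inj' : ∀ {p q} → window w' p ≡ window w' q → p ≡ q
      inj' = window-injective-entries transport-good
      p' : Fin (suc n)
      p' = Ranking.rankπ (window w') inj' ⟨$⟩ˡ s

    transport-back : transport z' z (transport z z' w) ≡ w
    transport-back = window-injective λ p → trans (transport-window z' z w' p)
      (trans (cong₂ (λ c s → c + (z s - z' s)) (transport-window z z' w p) (sym (transport-rank p))) (ring (g p) (z (rank g p)) (z' (rank g p))))
      where
      ring : ∀ g z z' → g + (z' - z) + (z - z') ≡ g
      ring = solve-∀

_≟ₐ_ : ∀ {n} → DecidableEquality (Aff n)
aff p t ≟ₐ aff p' t' = map′ (λ (e , e') → cong₂ aff e e') (λ { refl → refl , refl }) (Vecₚ.≡-dec Fin._≟_ p p' ×-dec Vecₚ.≡-dec ℤₚ._≟_ t t')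

sublists : ∀ {A : Set} → List A → List (List A)
sublists [] = [] ∷ []
sublists (x ∷ xs) = sublists xs ++ map (x ∷_) (sublists xs)

∈-sublists⁺ : ∀ {A : Set} {us ws : List A} → us ⊆ ws → us ∈ sublists ws
∈-sublists⁺ [] = here refl
∈-sublists⁺ (y ∷ʳ sub) = Memₚ.∈-++⁺ˡ (∈-sublists⁺ sub)
∈-sublists⁺ {ws = w ∷ ws} (refl ∷ sub) = Memₚ.∈-++⁺ʳ (sublists ws) (Memₚ.∈-map⁺ (w ∷_) (∈-sublists⁺ sub))

∈-sublists⁻ : ∀ {A : Set} {us} (ws : List A) → us ∈ sublists ws → us ⊆ ws
∈-sublists⁻ [] (here refl) = []
∈-sublists⁻ (w ∷ ws) mem with Memₚ.∈-++⁻ (sublists ws) mem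
... | inj₁ left = w ∷ʳ ∈-sublists⁻ ws left
... | inj₂ right with Memₚ.∈-map⁻ (w ∷_) right
... | us , us∈ , refl = refl ∷ ∈-sublists⁻ ws us∈

Unique-map : ∀ {A B : Set} (f : A → B) (f' : B → A) (L : List A) → (∀ x → x ∈ L → f' (f x) ≡ x) → Unique L → Unique (map f L)
Unique-map f f' [] h [] = []
Unique-map f f' (x ∷ L) h (px ∷ u) = Allₚ.map⁺ (All.tabulate λ {y} y∈ eq → All.lookup px y∈ (trans (sym (h x (here refl))) (trans (cong f' eq) (h y (there y∈)))))
  ∷ Unique-map f f' L (λ y y∈ → h y (there y∈)) u

Pattern? : ∀ m i k → Dec (Pattern m i k)
Pattern? m i k = ((i ℕₚ.≟ k) ×-dec (2 ℕₚ.≤? m i)) ⊎-dec ((i ℕₚ.<? k) ×-dec ((m i ℕₚ.≟ 1) ×-dec ((m k ℕₚ.≟ 1) ×-dec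
  map′ (λ h l il lk → h lk il) (λ h {l} lk il → h l il lk) (ℕₚ.allUpTo? (λ l → (i ℕₚ.<? l) →-dec (m l ℕₚ.≟ 0)) k))))

module _ {n : ℕ} (1≤n : 1 ℕ.≤ n) {a : Aff n} (aF : InF a) where
  open PaperBoats 1≤n aF

  interval : ∀ {x : Pt n} {z} → Weight x z → List (Aff n)
  interval W = map (evalR 1≤n) (sublists (letters (θ-word W)))

  ∈-interval⁺ : ∀ {x : Pt n} {z} (W : Weight x z) {w} → InI a x w → w ∈ interval W
  ∈-interval⁺ W h = let us , sub , eq = ⊑⇒subword W (InWaff⇒Good (proj₁ h)) (InI⇒⊑ W h) in
    subst (_∈ interval W) eq (Memₚ.∈-map⁺ (evalR 1≤n) (∈-sublists⁺ sub))

  ∈-interval⁻ : ∀ {x : Pt n} {z} (W : Weight x z) {w} → w ∈ interval W → InI a x w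
  ∈-interval⁻ {x} W mem = let us , us∈ , eq = Memₚ.∈-map⁻ (evalR 1≤n) mem in
    subst (InI a x) (sym eq) (subword⇒InI W (∈-sublists⁻ (letters (θ-word W)) us∈))

  -- The Bruhat order quantifies over all words. The list of values of the subwords of one reduced
  -- word turns it into a finite search.
  InI? : ∀ {x : Pt n} {z} → Weight x z → ∀ w → Dec (InI a x w)
  InI? W w = map′ (∈-interval⁻ W) (∈-interval⁺ W) (DecMem._∈?_ _≟ₐ_ w (interval W))

  module _ {x : Pt n} (xΛ : InΛplus x) {z : Window n} (W : Weight x z) where
    private
      m : ℕ → ℕ
      m = pairings x xΛ

      -- A finite test in place of the quantifier over all covered weights: only segments of the n
      -- simple roots are tried, and by `Boat⇒PB` avoiding them suffices.
      Avoids : Aff n → Set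
      Avoids w = ∀ (i k : Fin n) → Pattern m (toℕ i) (toℕ k) → ¬ InI a (below (segment (toℕ i) (toℕ k)) x) w

      avoids? : ∀ w → Dec (Avoids w)
      avoids? w = Finₚ.all? λ i → Finₚ.all? λ k → one i k (Pattern? m (toℕ i) (toℕ k))
        where
        one : ∀ (i k : Fin n) → Dec (Pattern m (toℕ i) (toℕ k)) → Dec (Pattern m (toℕ i) (toℕ k) → ¬ InI a (below (segment (toℕ i) (toℕ k)) x) w)
        one i k (no ¬P) = yes λ P → ⊥-elim (¬P P)
        one i k (yes P) = map′ (λ h _ → h) (λ h → h P) (¬? (InI? (Pattern-weight xΛ W P) w))

      avoids⇒PB : ∀ {w} → InI a x w → Avoids w → InPB a x w
      avoids⇒PB {w} h av = Boat⇒PB xΛ W gw (boat (InI⇒Dom W pair gw h) out)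
        where
        gw : Good w
        gw = InWaff⇒Good (proj₁ h)
        pair : Pairing z m
        pair = Weight⇒Pairing {m = m} W (pairings-correct x xΛ)
        out : ∀ i k → Pattern m i k → ¬ Dom (sorted gw) (lowered (segment i k) (λ p → b p + z p))
        out i k P d = at (fromℕ< (ℕₚ.≤-<-trans (Pattern-≤ P) k<n)) (fromℕ< k<n) (Finₚ.toℕ-fromℕ< _) (Finₚ.toℕ-fromℕ< k<n)
          where
          k<n : k ℕ.< n
          k<n = ℕₚ.≰⇒> λ n≤k → ℕₚ.1+n≢0 (trans (sym (segment-in {i} {k} {k} (Pattern-≤ P) ℕₚ.≤-refl)) (Pattern-range {x = x} xΛ P k n≤k))
          inI : InI a (below (segment i k) x) w
          inI = Dom⇒InI (Pattern-weight xΛ W P) gw (Dom-cong (λ p → refl) (λ p → sym (lowered-top z (segment i k) p)) d)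
          at : ∀ (i' k' : Fin n) → toℕ i' ≡ i → toℕ k' ≡ k → ⊥
          at i' k' refl refl = av i' k' P inI

    enumeration : List (Aff n)
    enumeration = List.deduplicate _≟ₐ_ (List.filter avoids? (interval W))

    enumerates : Enumerates enumeration (InPB a x)
    enumerates = DecUnique.deduplicate-! _≟ₐ_ (List.filter avoids? (interval W)) ,
      λ w → (λ mem → let inL , av = Memₚ.∈-filter⁻ avoids? {xs = interval W} (Memₚ.∈-deduplicate⁻ _≟ₐ_ (List.filter avoids? (interval W)) mem) in avoids⇒PB (∈-interval⁻ W inL) av)
          , (λ (h , out) → Memₚ.∈-deduplicate⁺ _≟ₐ_ (Memₚ.∈-filter⁺ avoids? (∈-interval⁺ W h) λ i k P inI → out (below (segment (toℕ i) (toℕ k)) x , Pattern⇒cover xΛ P , inI)))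

  module _ {x x' : Pt n} (xΛ : InΛplus x) (x'Λ : InΛplus x') (zone : SameZone (pairings x xΛ) (pairings x' x'Λ))
           {z z' : Window n} (W : Weight x z) (W' : Weight x' z') {w : Aff n} (h : InPB a x w) where
    private
      gw : Good w
      gw = InWaff⇒Good (proj₁ (proj₁ h))
      bt : Boat (sorted gw) (λ p → b p + z p) (pairings x xΛ)
      bt = PB⇒Boat xΛ W gw h
      pair : Pairing z (pairings x xΛ)
      pair = Weight⇒Pairing {m = pairings x xΛ} W (pairings-correct x xΛ)
      pair' : Pairing z' (pairings x' x'Λ)
      pair' = Weight⇒Pairing {m = pairings x' x'Λ} W' (pairings-correct x' x'Λ)
      strict : ∀ {p q} → p Fin.< q → sorted gw q + (z' q - z q) < sorted gw p + (z' p - z p)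
      strict = translated-strict {b = b} {gs = sorted gw} pair pair' zone (strict⇒decreasing {h = b} (InF⇒strict aF)) (Ranking.sorted-strict (window w) (window-injective-entries gw)) bt

    PB-good : Good (transport z z' w)
    PB-good = transport-good W W' gw

    PB-transport : InPB a x' (transport z z' w)
    PB-transport = Boat⇒PB x'Λ W' PB-good (Boat-cong (λ s → sym (transport-sorted W W' gw strict s))
        (translated-boat {b = b} {gs = sorted gw} pair pair' zone (strict⇒decreasing {h = b} (InF⇒strict aF)) (Ranking.sorted-strict (window w) (window-injective-entries gw)) bt))
      where
      Boat-cong : ∀ {g g' y : Window n} {m} → (∀ p → g p ≡ g' p) → Boat g y m → Boat g' y m
      Boat-cong hg (boat i o) = boat (Dom-cong hg (λ p → refl) i) λ i k P d → o i k P (Dom-cong (λ p → sym (hg p)) (λ p → refl) d)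

    PB-back : transport z' z (transport z z' w) ≡ w
    PB-back = transport-back W W' gw strict

    -- The window of a dominant element is already sorted, so ranks are positions and the
    -- chamber-wise map is translation by the difference of the weights.
    PB-translate : InWplus w → InWplus (transport z z' w) × (∀ p → window (transport z z' w) p ≡ window w p + (z' p - z p))
    PB-translate w⁺ = strict⇒InWplus 1≤n PB-good dec , win
      where
      rank-id : ∀ p → rank (window w) p ≡ p
      rank-id = rank-sorted (window w) (InWplus⇒strict w⁺)
      win : ∀ p → window (transport z z' w) p ≡ window w p + (z' p - z p)
      win p = trans (transport-window z z' w p) (cong (λ s → window w p + (z' s - z s)) (rank-id p))
      sorted≡ : ∀ s → sorted gw s ≡ window w s
      sorted≡ s = trans (cong (sorted gw) (sym (rank-id s))) (Ranking.sorted-rank (window w) (window-injective-entries gw) s)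
      form : ∀ p → sorted gw p + (z' p - z p) ≡ window (transport z z' w) p
      form p = trans (cong (λ c → c + (z' p - z p)) (sorted≡ p)) (sym (win p))
      dec : ∀ {p q} → p Fin.< q → window (transport z z' w) q < window (transport z z' w) p
      dec {p} {q} p<q = subst₂ _<_ (form q) (form p) (strict p<q)

-- Zones and the conclusion

zone⇒SameZone : ∀ {n} (𝒊 : Fin n → Fin 3) (x x' : Pt n) (xZ : InZone 𝒊 x) (x'Z : InZone 𝒊 x') →
  SameZone (pairings x (proj₁ xZ)) (pairings x' (proj₁ x'Z))
zone⇒SameZone {n} 𝒊 x x' (xΛ , c) (x'Λ , c') l = byRange (l ℕₚ.<? n)
  where
  m m' : ℕ → ℕ
  m = pairings x xΛ
  m' = pairings x' x'Λ
  cases : ∀ (t : Fin 3) k k' → zoneCond t ⟦ + k ⟧ → zoneCond t ⟦ + k' ⟧ → k ≡ k' ⊎ (2 ℕ.≤ k × 2 ℕ.≤ k')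
  cases zero k k' h h' = inj₁ (ℤₚ.+-injective (⟦⟧-injective (trans h (sym h'))))
  cases (suc zero) k k' h h' = inj₁ (ℤₚ.+-injective (⟦⟧-injective (trans h (sym h'))))
  cases (suc (suc zero)) k k' h h' = inj₂ (two k h , two k' h')
    where
    two : ∀ k → ℕ→ℚ 2 ℚ.≤ ⟦ + k ⟧ → 2 ℕ.≤ k
    two k h = ℕₚ.≮⇒≥ λ k<2 → ℚₚ.<-irrefl refl (ℚₚ.<-≤-trans (⟦⟧-mono-< (ℤ.+<+ k<2)) (subst (ℚ._≤ ⟦ + k ⟧) (sym (⟦⟧≡ (+ 2))) h))
  at : ∀ r → m (toℕ r) ≡ m' (toℕ r) ⊎ (2 ℕ.≤ m (toℕ r) × 2 ℕ.≤ m' (toℕ r))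
  at r = cases (𝒊 r) (m (toℕ r)) (m' (toℕ r)) (subst (zoneCond (𝒊 r)) (pairings-correct x xΛ r) (c r)) (subst (zoneCond (𝒊 r)) (pairings-correct x' x'Λ r) (c' r))
  byRange : Dec (l ℕ.< n) → m l ≡ m' l ⊎ (2 ℕ.≤ m l × 2 ℕ.≤ m' l)
  byRange (yes l<n) = subst (λ l → m l ≡ m' l ⊎ (2 ℕ.≤ m l × 2 ℕ.≤ m' l)) (Finₚ.toℕ-fromℕ< l<n) (at (fromℕ< l<n))
  byRange (no l≮n) = inj₁ (trans (ext-out (λ r → proj₁ (proj₂ xΛ r)) l (ℕₚ.≮⇒≥ l≮n)) (sym (ext-out (λ r → proj₁ (proj₂ x'Λ r)) l (ℕₚ.≮⇒≥ l≮n))))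

theoremB : (n : ℕ) → 1 ℕ.≤ n → (a : Aff n) → InF a →
    (𝒊 : Fin n → Fin 3) → (lam mu : Pt n) → InZone 𝒊 lam → InZone 𝒊 mu →
    (Σ (Pt n) λ v → InE v ×
    (∀ w → InPB a lam w → InWplus w →
    Σ (Aff n) λ w' → InPB a mu w' × InWplus w' × SameSet (InAlc w) (InTrans (InAlc w') v)) ×
    (∀ w' → InPB a mu w' → InWplus w' →
    Σ (Aff n) λ w → InPB a lam w × InWplus w × SameSet (InAlc w) (InTrans (InAlc w') v)))
    × (Σ (List (Aff n)) λ L₁ → Σ (List (Aff n)) λ L₂ →
    Enumerates L₁ (InPB a lam) × Enumerates L₂ (InPB a mu) × length L₁ ≡ length L₂)
theoremB n 1≤n a aF 𝒊 lam mu lamZ muZ =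
    ((λ p → lam p ℚ.+ ℚ.- mu p) , in-E Wv , forth , back)
  , (L₁ , map f L₁ , E₁ , E₂ , sym (Listₚ.length-map f L₁))
  where
  lamΛ : InΛplus lam
  lamΛ = proj₁ lamZ
  muΛ : InΛplus mu
  muΛ = proj₁ muZ
  z z' : Window n
  z = proj₁ (Λ-weight lam lamΛ)
  z' = proj₁ (Λ-weight mu muΛ)
  W : Weight lam z
  W = proj₂ (Λ-weight lam lamΛ)
  W' : Weight mu z'
  W' = proj₂ (Λ-weight mu muΛ)
  Wv : Weight (λ p → lam p ℚ.+ ℚ.- mu p) (λ p → z p + - z' p)
  Wv = Weight-+ W (Weight-neg W')
  zone : SameZone (pairings lam lamΛ) (pairings mu muΛ)
  zone = zone⇒SameZone 𝒊 lam mu lamZ muZ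
  zone' : SameZone (pairings mu muΛ) (pairings lam lamΛ)
  zone' = zone⇒SameZone 𝒊 mu lam muZ lamZ
  f f' : Aff n → Aff n
  f = transport z z'
  f' = transport z' z
  ring : ∀ g z z' → g ≡ g + (z' - z) + (z + - z')
  ring = solve-∀
  forth : ∀ w → InPB a lam w → InWplus w → Σ (Aff n) λ w' → InPB a mu w' × InWplus w' × SameSet (InAlc w) (InTrans (InAlc w') (λ p → lam p ℚ.+ ℚ.- mu p))
  forth w h w⁺ = let w'⁺ , win = PB-translate 1≤n aF lamΛ muΛ zone W W' h w⁺ in
    f w , PB-transport 1≤n aF lamΛ muΛ zone W W' h , w'⁺ ,
    translate-SameSet (InWaff⇒Good (proj₁ w⁺)) (InWaff⇒Good (proj₁ w'⁺)) Wv (λ p → trans (ring (window w p) (z p) (z' p)) (cong (_+ (z p + - z' p)) (sym (win p))))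
  back : ∀ w' → InPB a mu w' → InWplus w' → Σ (Aff n) λ w → InPB a lam w × InWplus w × SameSet (InAlc w) (InTrans (InAlc w') (λ p → lam p ℚ.+ ℚ.- mu p))
  back w' h w'⁺ = let w⁺ , win = PB-translate 1≤n aF muΛ lamΛ zone' W' W h w'⁺ in
    f' w' , PB-transport 1≤n aF muΛ lamΛ zone' W' W h , w⁺ ,
    translate-SameSet (InWaff⇒Good (proj₁ w⁺)) (InWaff⇒Good (proj₁ w'⁺)) Wv win
  L₁ : List (Aff n)
  L₁ = enumeration 1≤n aF lamΛ W
  E₁ : Enumerates L₁ (InPB a lam)
  E₁ = enumerates 1≤n aF lamΛ W
  -- `f'` undoes `f` on PB_a(lam), which excludes repetitions; `f` undoes `f'` on PB_a(mu), so that
  -- every element is reached.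
  E₂ : Enumerates (map f L₁) (InPB a mu)
  E₂ = Unique-map f f' L₁ (λ w w∈ → PB-back 1≤n aF lamΛ muΛ zone W W' (proj₁ (proj₂ E₁ w) w∈)) (proj₁ E₁) , λ w' →
    (λ mem → let w , w∈ , eq = Memₚ.∈-map⁻ f mem in subst (InPB a mu) (sym eq) (PB-transport 1≤n aF lamΛ muΛ zone W W' (proj₁ (proj₂ E₁ w) w∈)))
    , λ h → subst (_∈ map f L₁) (PB-back 1≤n aF muΛ lamΛ zone' W' W h) (Memₚ.∈-map⁺ f (proj₂ (proj₂ E₁ (f' w')) (PB-transport 1≤n aF muΛ lamΛ zone' W' W h)))
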